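{- Let $p\neq 3$ be a rational prime, let $b=p$ or $b=-p$, and let $c\in\mathbb{Z}$ be such that $x^3+bx+c$ is irreducible over $\mathbb{Q}$. If $c$ is either prime to $p$ or divisible by $p^2$, then the splitting field of $x^3+bx+c$ over $\mathbb{Q}$ is an unramified extension of its quadratic subfield $\mathbb{Q}(\sqrt{\delta})$, where $\delta=-4b^3-27c^2$.
   Context: Unramified means unramified at all places, finite and infinite. -}

module Defs where

open import Algebra.Apartness using (HeytingField; HeytingCommutativeRing)
open import Algebra.Bundles using (CommutativeRing)
open import Algebra.Bundles.Raw using (RawRing; RawSemiring)
open import Algebra.Definitions.RawSemiring using (sum)
open import Algebra.Morphism.Structures using (IsRingHomomorphism)
open import Data.Integer as ℤ using (ℤ; +_)
import Data.Integer.Divisibility as ℤ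
open import Data.List using (List; []; _∷_; map; foldr)
open import Data.List.Membership.Propositional using (_∈_)
open import Data.Nat as ℕ using (ℕ; zero; suc)
import Data.Nat.Properties as ℕ
open import Data.Product using (∃; ∃₂; _×_; _,_; proj₁; proj₂)
open import Data.Rational as ℚ using (ℚ; 0ℚ; 1ℚ; ½; _+_; _*_; _-_; -_; ∣_∣; _<_; _≤_; 1/_; _/_)
open import Data.Rational.Properties
open import Data.Rational.Solver using (module +-*-Solver)
open import Data.Vec.Functional using (Vector)
open import Function using (_⇔_)
open import Level using (Level; _⊔_; 0ℓ)
open import Relation.Binary.PropositionalEquality using (_≡_; refl; sym; trans; cong; cong₂; subst)
open import Relation.Unary using (Pred)

private variable
  a ℓ c ℓ₁ ℓ₂ : Level

------------------------------------------------------------------------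
-- Polynomials in one variable, as lists of coefficients starting with
-- the constant one; trailing zeros are ignored by _≈_.

module Polynomial (R : RawRing a ℓ) where
  private module R = RawRing R

  Poly : Set a
  Poly = List R.Carrier

  coeff : Poly → ℕ → R.Carrier
  coeff []      _       = R.0#
  coeff (r ∷ f) zero    = r
  coeff (r ∷ f) (suc n) = coeff f n

  infix  4 _≈ₚ_
  infixl 6 _+ₚ_
  infixl 7 _*ₚ_

  _≈ₚ_ : Poly → Poly → Set ℓ
  f ≈ₚ g = ∀ n → coeff f n R.≈ coeff g n

  _+ₚ_ : Poly → Poly → Poly
  []      +ₚ g       = g
  (r ∷ f) +ₚ []      = r ∷ f
  (r ∷ f) +ₚ (s ∷ g) = r R.+ s ∷ f +ₚ g

  _*ₚ_ : Poly → Poly → Poly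
  []      *ₚ g = []
  (r ∷ f) *ₚ g = map (r R.*_) g +ₚ (R.0# ∷ f *ₚ g)

  rawSemiring : RawSemiring a ℓ
  rawSemiring = record
    { Carrier = Poly
    ; _≈_     = _≈ₚ_
    ; _+_     = _+ₚ_
    ; _*_     = _*ₚ_
    ; 0#      = []
    ; 1#      = R.1# ∷ []
    }

  X-_ : R.Carrier → Poly
  X- r = R.- r ∷ R.1# ∷ []

  ∏[X-_] : List R.Carrier → Poly
  ∏[X- rs ] = foldr (λ r f → (X- r) *ₚ f) (R.1# ∷ []) rs

ℚ[X] : RawSemiring 0ℓ 0ℓ
ℚ[X] = Polynomial.rawSemiring ℚ.+-*-rawRing

fromℤ : ℤ → ℚ
fromℤ n = n / 1

X³+_X+_ : ℤ → ℤ → RawSemiring.Carrier ℚ[X]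
X³+ b X+ c = fromℤ c ∷ fromℤ b ∷ 0ℚ ∷ 1ℚ ∷ []

------------------------------------------------------------------------
-- Real numbers: Cauchy sequences of rationals with a modulus of
-- convergence, equal when their difference tends to zero.

Cauchy : (ℕ → ℚ) → Set
Cauchy x = ∀ ε → 0ℚ < ε →
  ∃ λ N → ∀ {m n} → N ℕ.≤ m → N ℕ.≤ n → ∣ x m - x n ∣ < ε

ℝ : Set
ℝ = ∃ Cauchy

infix 4 _≈ᵣ_

_≈ᵣ_ : ℝ → ℝ → Set
(x , _) ≈ᵣ (y , _) = ∀ ε → 0ℚ < ε →
  ∃ λ N → ∀ {n} → N ℕ.≤ n → ∣ x n - y n ∣ < ε

module _ where
  private
    half-pos : ∀ {ε} → 0ℚ < ε → 0ℚ < ½ * ε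
    half-pos {ε} 0<ε = positive⁻¹ (½ * ε)
      where instance
        _ = ℚ.positive 0<ε
        _ = pos*pos⇒pos ½ ε

    half+half : ∀ ε → ½ * ε + ½ * ε ≡ ε
    half+half ε = trans (sym (*-distribʳ-+ ε ½ ½)) (*-identityˡ ε)

    const : ∀ q → Cauchy (λ _ → q)
    const q ε 0<ε = 0 , λ _ _ → subst (_< ε) (cong ∣_∣ (sym (+-inverseʳ q))) 0<ε

    neg : ∀ x → Cauchy x → Cauchy (λ n → - x n)
    neg x cx ε 0<ε = let N , h = cx ε 0<ε in N , λ {m} {n} N≤m N≤n →
      subst (_< ε)
        (trans (sym (∣-p∣≡∣p∣ (x m - x n))) (cong ∣_∣ (neg-distrib-+ (x m) (- x n))))
        (h N≤m N≤n)

    add : ∀ x y → Cauchy x → Cauchy y → Cauchy (λ n → x n + y n)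
    add x y cx cy ε 0<ε =
      let N , h = cx (½ * ε) (half-pos 0<ε)
          M , k = cy (½ * ε) (half-pos 0<ε)
      in N ℕ.⊔ M , λ {m} {n} l l′ → begin-strict
        ∣ x m + y m - (x n + y n) ∣         ≡⟨ cong ∣_∣ (eq (x m) (y m) (x n) (y n)) ⟩
        ∣ (x m - x n) + (y m - y n) ∣       ≤⟨ ∣p+q∣≤∣p∣+∣q∣ (x m - x n) (y m - y n) ⟩
        ∣ x m - x n ∣ + ∣ y m - y n ∣       <⟨ +-mono-< (h (ℕ.m⊔n≤o⇒m≤o N M l) (ℕ.m⊔n≤o⇒m≤o N M l′))
                                                        (k (ℕ.m⊔n≤o⇒n≤o N M l) (ℕ.m⊔n≤o⇒n≤o N M l′)) ⟩
        ½ * ε + ½ * ε                       ≡⟨ half+half ε ⟩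
        ε                                   ∎
      where
      open ≤-Reasoning
      eq : ∀ p q r s → p + q - (r + s) ≡ (p - r) + (q - s)
      eq = solve 4 (λ p q r s → p :+ q :- (r :+ s) := (p :- r) :+ (q :- s)) refl
        where open +-*-Solver

    bounded : ∀ x → Cauchy x → ∃₂ λ B N → 0ℚ < B × (∀ {n} → N ℕ.≤ n → ∣ x n ∣ ≤ B)
    bounded x cx =
      let N , h = cx 1ℚ (positive⁻¹ 1ℚ)
      in ∣ x N ∣ + 1ℚ , N , +-mono-≤-< (0≤∣p∣ (x N)) (positive⁻¹ 1ℚ) , λ {n} l → begin
        ∣ x n ∣                   ≡⟨ cong ∣_∣ (eq (x n) (x N)) ⟩
        ∣ x N + (x n - x N) ∣     ≤⟨ ∣p+q∣≤∣p∣+∣q∣ (x N) (x n - x N) ⟩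
        ∣ x N ∣ + ∣ x n - x N ∣   ≤⟨ +-monoʳ-≤ ∣ x N ∣ (<⇒≤ (h l ℕ.≤-refl)) ⟩
        ∣ x N ∣ + 1ℚ              ∎
      where
      open ≤-Reasoning
      eq : ∀ p q → p ≡ q + (p - q)
      eq = solve 2 (λ p q → p := q :+ (p :- q)) refl
        where open +-*-Solver

    scale : ∀ B ε → 0ℚ < B → 0ℚ < ε → ∃ λ η → 0ℚ < η × B * η ≡ ε
    scale B ε 0<B 0<ε = 1/ B * ε , positive⁻¹ (1/ B * ε) ,
      trans (sym (*-assoc B (1/ B) ε)) (trans (cong (_* ε) (*-inverseʳ B)) (*-identityˡ ε))
      where instance
        _ = ℚ.positive 0<B
        _ = ℚ.positive 0<ε
        _ = pos⇒nonZero B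
        _ = 1/pos⇒pos B
        _ = pos*pos⇒pos (1/ B) ε

    *-bound : ∀ {B η} u v → 0ℚ < B → ∣ u ∣ ≤ B → ∣ v ∣ < η → ∣ u * v ∣ < B * η
    *-bound {B} {η} u v 0<B u≤B v<η = begin-strict
      ∣ u * v ∣       ≡⟨ ∣p*q∣≡∣p∣*∣q∣ u v ⟩
      ∣ u ∣ * ∣ v ∣   ≤⟨ *-monoʳ-≤-nonNeg ∣ v ∣ {{ℚ.nonNegative (0≤∣p∣ v)}} u≤B ⟩
      B * ∣ v ∣       <⟨ *-monoʳ-<-pos B {{ℚ.positive 0<B}} v<η ⟩
      B * η           ∎
      where open ≤-Reasoning

    mul : ∀ x y → Cauchy x → Cauchy y → Cauchy (λ n → x n * y n)
    mul x y cx cy ε 0<ε =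
      let A , N₁ , 0<A , bx = bounded x cx
          B , N₂ , 0<B , by = bounded y cy
          η , 0<η , Aη = scale A (½ * ε) 0<A (half-pos 0<ε)
          θ , 0<θ , Bθ = scale B (½ * ε) 0<B (half-pos 0<ε)
          N₃ , h = cy η 0<η
          N₄ , k = cx θ 0<θ
          N = (N₁ ℕ.⊔ N₂) ℕ.⊔ (N₃ ℕ.⊔ N₄)
          ≥₁ = λ {m} (l : N ℕ.≤ m) → ℕ.m⊔n≤o⇒m≤o N₁ N₂ (ℕ.m⊔n≤o⇒m≤o (N₁ ℕ.⊔ N₂) (N₃ ℕ.⊔ N₄) l)
          ≥₂ = λ {m} (l : N ℕ.≤ m) → ℕ.m⊔n≤o⇒n≤o N₁ N₂ (ℕ.m⊔n≤o⇒m≤o (N₁ ℕ.⊔ N₂) (N₃ ℕ.⊔ N₄) l)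
          ≥₃ = λ {m} (l : N ℕ.≤ m) → ℕ.m⊔n≤o⇒m≤o N₃ N₄ (ℕ.m⊔n≤o⇒n≤o (N₁ ℕ.⊔ N₂) (N₃ ℕ.⊔ N₄) l)
          ≥₄ = λ {m} (l : N ℕ.≤ m) → ℕ.m⊔n≤o⇒n≤o N₃ N₄ (ℕ.m⊔n≤o⇒n≤o (N₁ ℕ.⊔ N₂) (N₃ ℕ.⊔ N₄) l)
      in N , λ {m} {n} l l′ → begin-strict
        ∣ x m * y m - x n * y n ∣                             ≡⟨ cong ∣_∣ (eq (x m) (y m) (x n) (y n)) ⟩
        ∣ x m * (y m - y n) + y n * (x m - x n) ∣             ≤⟨ ∣p+q∣≤∣p∣+∣q∣ (x m * (y m - y n)) (y n * (x m - x n)) ⟩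
        ∣ x m * (y m - y n) ∣ + ∣ y n * (x m - x n) ∣         <⟨ +-mono-<
          (*-bound (x m) (y m - y n) 0<A (bx (≥₁ l)) (h (≥₃ l) (≥₃ l′)))
          (*-bound (y n) (x m - x n) 0<B (by (≥₂ l′)) (k (≥₄ l) (≥₄ l′))) ⟩
        A * η + B * θ                                         ≡⟨ cong₂ _+_ Aη Bθ ⟩
        ½ * ε + ½ * ε                                         ≡⟨ half+half ε ⟩
        ε                                                     ∎
      where
      open ≤-Reasoning
      eq : ∀ p q r s → p * q - r * s ≡ p * (q - s) + s * (p - r)
      eq = solve 4 (λ p q r s → p :* q :- r :* s := p :* (q :- s) :+ s :* (p :- r)) refl
        where open +-*-Solver

  ℝ-rawRing : RawRing 0ℓ 0ℓ
  ℝ-rawRing = record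
    { Carrier = ℝ
    ; _≈_     = _≈ᵣ_
    ; _+_     = λ (x , cx) (y , cy) → (λ n → x n + y n) , add x y cx cy
    ; _*_     = λ (x , cx) (y , cy) → (λ n → x n * y n) , mul x y cx cy
    ; -_      = λ (x , cx) → (λ n → - x n) , neg x cx
    ; 0#      = (λ _ → 0ℚ) , const 0ℚ
    ; 1#      = (λ _ → 1ℚ) , const 1ℚ
    }

------------------------------------------------------------------------
-- Complex numbers

module ℝ = RawRing ℝ-rawRing

record ℂ : Set where
  constructor _+i_
  field
    re im : ℝ

open ℂ public

ℂ-rawRing : RawRing 0ℓ 0ℓ
ℂ-rawRing = record
  { Carrier = ℂ
  ; _≈_     = λ z w → re z ℝ.≈ re w × im z ℝ.≈ im w
  ; _+_     = λ z w → (re z ℝ.+ re w) +i (im z ℝ.+ im w)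
  ; _*_     = λ z w → (re z ℝ.* re w ℝ.+ ℝ.- (im z ℝ.* im w))
                   +i (re z ℝ.* im w ℝ.+ im z ℝ.* re w)
  ; -_      = λ z → (ℝ.- re z) +i (ℝ.- im z)
  ; 0#      = ℝ.0# +i ℝ.0#
  ; 1#      = ℝ.1# +i ℝ.0#
  }

Real : ℂ → Set
Real z = im z ℝ.≈ ℝ.0#

------------------------------------------------------------------------
-- Discrete valuations, normalised to have value group ℤ. Up to
-- equivalence these are the finite places of a number field.

fieldRawRing : HeytingField c ℓ₁ ℓ₂ → RawRing c ℓ₁
fieldRawRing L = CommutativeRing.rawRing
  (HeytingCommutativeRing.commutativeRing (HeytingField.heytingCommutativeRing L))

record DiscreteValuation (L : HeytingField c ℓ₁ ℓ₂) : Set (c ⊔ ℓ₁ ⊔ ℓ₂) where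
  open HeytingField L using (Carrier; _≈_; _#_; 0#)
    renaming (_+_ to _+ᴸ_; _*_ to _*ᴸ_)
  field
    v          : ∀ x → x # 0# → ℤ
    v-cong     : ∀ {x y} x# y# → x ≈ y → v x x# ≡ v y y#
    v-*        : ∀ {x y} x# y# xy# → v (x *ᴸ y) xy# ≡ v x x# ℤ.+ v y y#
    v-+        : ∀ {x y} x# y# x+y# → v x x# ℤ.⊓ v y y# ℤ.≤ v (x +ᴸ y) x+y#
    surjective : ∀ n → ∃₂ λ x x# → v x x# ≡ n

------------------------------------------------------------------------
-- Extensions of ℚ

module Extension (L : HeytingField c ℓ₁ ℓ₂) (ι : ℚ → HeytingField.Carrier L) where
  open HeytingField L using (Carrier; _≈_; _#_; 0#; 1#)
    renaming (_+_ to _+ᴸ_; _*_ to _*ᴸ_; -_ to -ᴸ_)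
  private module L = RawRing (fieldRawRing L)

  -- The subfield of L generated by a finite list of elements.

  data ℚ⟨_⟩ (gs : List Carrier) : Pred Carrier (c ⊔ ℓ₁) where
    rational  : ∀ q → ℚ⟨ gs ⟩ (ι q)
    generator : ∀ {g} → g ∈ gs → ℚ⟨ gs ⟩ g
    plus      : ∀ {x y} → ℚ⟨ gs ⟩ x → ℚ⟨ gs ⟩ y → ℚ⟨ gs ⟩ (x +ᴸ y)
    times     : ∀ {x y} → ℚ⟨ gs ⟩ x → ℚ⟨ gs ⟩ y → ℚ⟨ gs ⟩ (x *ᴸ y)
    minus     : ∀ {x} → ℚ⟨ gs ⟩ x → ℚ⟨ gs ⟩ (-ᴸ x)
    inverse   : ∀ {x y} → x *ᴸ y ≈ 1# → ℚ⟨ gs ⟩ x → ℚ⟨ gs ⟩ y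
    respects  : ∀ {x y} → x ≈ y → ℚ⟨ gs ⟩ x → ℚ⟨ gs ⟩ y

  private variable
    k : Level

  -- K has dimension n as a vector space over ℚ.

  HasDegree : ℕ → Pred Carrier k → Set (c ⊔ ℓ₁ ⊔ k)
  HasDegree n K = ∃ λ (e : Vector Carrier n) →
    let combination = λ (q : Vector ℚ n) → sum L.rawSemiring (λ i → ι (q i) *ᴸ e i) in
    (∀ i → K (e i)) ×
    (∀ x → K x → ∃ λ q → x ≈ combination q) ×
    (∀ q → combination q ≈ 0# → ∀ i → q i ≡ 0ℚ)

  -- The ramification index (v (Lˣ) : v (Kˣ)) is e, i.e. v (Kˣ) = eℤ.
  -- Residue extensions of number fields are extensions of finite fields,
  -- hence separable, so a finite place is unramified exactly when e = 1.

  HasRamificationIndex : DiscreteValuation L → Pred Carrier k → ℕ → Set (c ⊔ ℓ₂ ⊔ k)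
  HasRamificationIndex w K e =
    ∀ n → (∃₂ λ x x# → K x × v x x# ≡ n) ⇔ + e ℤ.∣ n
    where open DiscreteValuation w

  -- An infinite place of L is an embedding into ℂ up to conjugation;
  -- it ramifies over K if it is complex but its restriction to K is real.

  record Unramified (K : Pred Carrier k) : Set (c ⊔ ℓ₁ ⊔ ℓ₂ ⊔ k) where
    field
      finite   : ∀ (w : DiscreteValuation L) → HasRamificationIndex w K 1
      infinite : ∀ (σ : Carrier → ℂ) → IsRingHomomorphism (fieldRawRing L) ℂ-rawRing σ →
                 (∀ x → K x → Real (σ x)) → ∀ x → Real (σ x)

record SplittingField (f : RawSemiring.Carrier ℚ[X]) (L : HeytingField c ℓ₁ ℓ₂) : Set (c ⊔ ℓ₁) where
  open HeytingField L using (Carrier)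
  open Polynomial (fieldRawRing L)
  field
    ι        : ℚ → Carrier
    ι-isHom  : IsRingHomomorphism ℚ.+-*-rawRing (fieldRawRing L) ι
    leading  : Carrier
    roots    : List Carrier
    splits   : map ι f ≈ₚ (leading ∷ []) *ₚ ∏[X- roots ]
    generate : ∀ x → Extension.ℚ⟨_⟩ L ι roots x

module Submission where

-- Let α, β, γ be the roots of f = x³ + bx + c and √δ = (α - β)(β - γ)(γ - α), so that
-- √δ² = δ, and let K = ℚ(√δ).
--
-- The field K is quadratic because δ is not a square (discriminant-nonsquare). If
-- b = p then δ < 0. If b = -p and p² divides c then c ≠ 0, since f has no root in ℚ, so
-- that 27c² ≥ 27p⁴ > 4p³ and again δ < 0. If b = -p, c is prime to p and δ = n², then
-- 4p³ = n² + 27c², so an Eisenstein integer whose second coordinate is 3c has norm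
-- p³. Reduction of binary quadratic forms of discriminant -3 (represents-1) writes it
-- as ε π³ with N(ε) = 1 and N(π) = p (cube); as p ≠ 3, the factor 3 in the second coordinate
-- forces ε = ±1, and then a coordinate of π is, up to sign, a root of f
-- (square-discriminant⇒root).
--
-- Since f has no root in ℚ, it has none in the quadratic extension K either, because
-- the third root would be rational (no-root). So 1, α, α² are independent over K
-- (ev-injective); and L = K + Kα + Kα² (generated), because f′(α) (6bα² - 9cα + 4b²) = -δ
-- makes β and γ polynomials in α over K. In particular equality in L is decidable.
--
-- Let w be a finite place of L. It is unramified over K if every value of w on L is a
-- value on K.
-- * If w(δ) = 0, Cramer's rule shows that the least of the values of three
--   conjugates P(α), P(β), P(γ) equals the least value of the coefficients of
--   P. Applied to products of two conjugates it gives the greatest value too, and the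
--   sum is the value of a norm, so all three are values on K (separable).
-- * If w(δ) > 0 and w(b) = 0, then f has a double and a simple root modulo w. The
--   simple one is congruent to 3c/b, and by the Newton iteration with the constant
--   slope -3b it is a limit of elements of K (SimpleRoot). Hence L has the values of K
--   (dense).
-- * If w(δ) > 0 and w(b) > 0, then w(p) > 0, so p² divides c, as p ≠ 3. Some root has value
--   at least w(b), and the iteration x ↦ -(c + x³)/b converges to it (SmallRoot).
--
-- An embedding of L into ℂ that is real on K is real on L (real-cubic): if x + iy is
-- the image of a root, and s the image of √δ, then (ys)² = -(2y²(9x² + y²))². A vanishing sum
-- of two squares of real numbers has vanishing terms, so
-- 0 = y²(9x² + y²) = (3xy)² + (y²)² and y = 0.

open import Algebra.Apartness using (HeytingField; HeytingCommutativeRing)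
open import Algebra.Bundles using (CommutativeRing)
open import Data.Empty using (⊥; ⊥-elim)
open import Data.Integer as ℤ using (ℤ; +_; -[1+_])
import Data.Integer.Properties as ℤ
open import Data.Nat as ℕ using (ℕ; zero; suc; s≤s; z≤n)
import Data.Nat.Properties as ℕ
open import Data.Product using (∃; ∃₂; _×_; _,_; proj₁; proj₂)
open import Data.Sum using (_⊎_; inj₁; inj₂; [_,_]′)
open import Function using (id; _∘_)
open import Level using (_⊔_; 0ℓ)
open import Relation.Binary.PropositionalEquality as ≡ using (_≡_; _≢_)
import Relation.Binary.Reasoning.Setoid
open import Relation.Nullary using (¬_; Dec; yes; no)
open import Relation.Unary using (Pred)

-- Integers in commutative rings

-- A solver for identities in a commutative ring, with integer coefficients.
module IntegerSolver {c ℓ} (R : CommutativeRing c ℓ) where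
  open import Data.Maybe using (Maybe; map)
  open import Relation.Nullary.Decidable using (dec⇒maybe)
  import Algebra.Solver.Ring
  import Algebra.Solver.Ring.AlmostCommutativeRing as ACR
  import Algebra.Properties.Ring
  import Algebra.Properties.AbelianGroup
  import Algebra.Properties.Semiring.Mult.TCOptimised
  open CommutativeRing R
  open Algebra.Properties.Ring ring
  open Algebra.Properties.AbelianGroup +-abelianGroup using (⁻¹-∙-comm)
  open Algebra.Properties.Semiring.Mult.TCOptimised semiring renaming (_×_ to _·_)
  open Relation.Binary.Reasoning.Setoid setoid

  -- The image of an integer under the unique ring homomorphism.
  int : ℤ → Carrier
  int (+ n)    = n · 1#
  int -[1+ n ] = - (suc n · 1#)

  int-neg : ∀ m → int (ℤ.- m) ≈ - int m
  int-neg (+ zero)  = sym -0#≈0#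
  int-neg (+ suc n) = refl
  int-neg -[1+ n ]  = sym (-‿involutive _)

  cancel : ∀ x y z → (z + x) - (z + y) ≈ x - y
  cancel x y z = begin
    (z + x) - (z + y)       ≈⟨ +-cong (+-comm z x) (sym (⁻¹-∙-comm z y)) ⟩
    (x + z) + (- z + - y)   ≈⟨ +-assoc x z _ ⟩
    x + (z + (- z + - y))   ≈⟨ +-congˡ (sym (+-assoc z (- z) (- y))) ⟩
    x + ((z + - z) + - y)   ≈⟨ +-congˡ (+-congʳ (-‿inverseʳ z)) ⟩
    x + (0# + - y)          ≈⟨ +-congˡ (+-identityˡ _) ⟩
    x - y                   ∎

  int-⊖ : ∀ m n → int (m ℤ.⊖ n) ≈ m · 1# - n · 1#
  int-⊖ zero    zero    = sym (-‿inverseʳ 0#)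
  int-⊖ zero    (suc n) = sym (+-identityˡ _)
  int-⊖ (suc m) zero    = sym (trans (+-congˡ -0#≈0#) (+-identityʳ _))
  int-⊖ (suc m) (suc n) = begin
    int (suc m ℤ.⊖ suc n)         ≡⟨ ≡.cong int (ℤ.[1+m]⊖[1+n]≡m⊖n m n) ⟩
    int (m ℤ.⊖ n)                 ≈⟨ int-⊖ m n ⟩
    m · 1# - n · 1#               ≈⟨ cancel _ _ 1# ⟨
    (1# + m · 1#) - (1# + n · 1#) ≈⟨ +-cong (1+× m 1#) (-‿cong (1+× n 1#)) ⟨
    suc m · 1# - suc n · 1#       ∎

  int-+ : ∀ m n → int (m ℤ.+ n) ≈ int m + int n
  int-+ (+ m)    (+ n)    = ×-homo-+ 1# m n
  int-+ (+ m)    -[1+ n ] = int-⊖ m (suc n)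
  int-+ -[1+ m ] (+ n)    = trans (int-⊖ n (suc m)) (+-comm _ _)
  int-+ -[1+ m ] -[1+ n ] = begin
    - (suc (suc (m ℕ.+ n)) · 1#)     ≡⟨ ≡.cong (λ k → - (suc k · 1#)) (≡.sym (ℕ.+-suc m n)) ⟩
    - ((suc m ℕ.+ suc n) · 1#)       ≈⟨ -‿cong (×-homo-+ 1# (suc m) (suc n)) ⟩
    - (suc m · 1# + suc n · 1#)      ≈⟨ ⁻¹-∙-comm _ _ ⟨
    - (suc m · 1#) - suc n · 1#      ∎

  int-*-pos : ∀ m n → int (m ℤ.* + n) ≈ int m * (n · 1#)
  int-*-pos (+ m) n = begin
    int (+ m ℤ.* + n)     ≡⟨ ≡.cong int (≡.sym (ℤ.pos-* m n)) ⟩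
    (m ℕ.* n) · 1#        ≈⟨ ×1-homo-* m n ⟩
    (m · 1#) * (n · 1#)   ∎
  int-*-pos -[1+ m ] n = begin
    int (-[1+ m ] ℤ.* + n)        ≡⟨ ≡.cong int (≡.sym (ℤ.neg-distribˡ-* (+ suc m) (+ n))) ⟩
    int (ℤ.- (+ suc m ℤ.* + n))   ≈⟨ int-neg (+ suc m ℤ.* + n) ⟩
    - int (+ suc m ℤ.* + n)       ≈⟨ -‿cong (int-*-pos (+ suc m) n) ⟩
    - ((suc m · 1#) * (n · 1#))   ≈⟨ -‿distribˡ-* _ _ ⟩
    - (suc m · 1#) * (n · 1#)     ∎

  int-* : ∀ m n → int (m ℤ.* n) ≈ int m * int n
  int-* m (+ n)    = int-*-pos m n
  int-* m -[1+ n ] = begin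
    int (m ℤ.* -[1+ n ])       ≡⟨ ≡.cong int (≡.sym (ℤ.neg-distribʳ-* m (+ suc n))) ⟩
    int (ℤ.- (m ℤ.* + suc n))  ≈⟨ int-neg (m ℤ.* + suc n) ⟩
    - int (m ℤ.* + suc n)      ≈⟨ -‿cong (int-*-pos m (suc n)) ⟩
    - (int m * (suc n · 1#))   ≈⟨ -‿distribʳ-* _ _ ⟩
    int m * - (suc n · 1#)     ∎

  int-morphism : ℤ.+-*-rawRing ACR.-Raw-AlmostCommutative⟶ ACR.fromCommutativeRing R
  int-morphism = record
    { ⟦_⟧ = int ; +-homo = int-+ ; *-homo = int-* ; -‿homo = int-neg ; 0-homo = refl ; 1-homo = refl }

  int-≟ : ∀ m n → Maybe (int m ≈ int n)
  int-≟ m n = map (λ m≡n → reflexive (≡.cong int m≡n)) (dec⇒maybe (m ℤ.≟ n))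

  open Algebra.Solver.Ring ℤ.+-*-rawRing (ACR.fromCommutativeRing R) int-morphism int-≟
    public using (solve; _:=_; _:+_; _:*_; _:-_; :-_; con)

  x-y≈0 : ∀ {x y} → x ≈ y → x - y ≈ 0#
  x-y≈0 {x} {y} x≈y = trans (+-congʳ x≈y) (-‿inverseʳ y)

  x-y≈0⇒x≈y : ∀ {x y} → x - y ≈ 0# → x ≈ y
  x-y≈0⇒x≈y {x} {y} h = begin
    x             ≈⟨ solve 2 (λ x y → x := y :+ (x :- y)) refl x y ⟩
    y + (x - y)   ≈⟨ +-congˡ h ⟩
    y + 0#        ≈⟨ +-identityʳ y ⟩
    y             ∎

  -- An identity x = y + m h, checked by the solver, gives x = y modulo h = 0;
  -- the cofactors m have to be supplied.
  modulo₁ : ∀ {x y h} m → x ≈ y + m * h → h ≈ 0# → x ≈ y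
  modulo₁ {x} {y} {h} m eq h≈0 = begin
    x            ≈⟨ eq ⟩
    y + m * h    ≈⟨ +-congˡ (*-congˡ h≈0) ⟩
    y + m * 0#   ≈⟨ +-congˡ (zeroʳ m) ⟩
    y + 0#       ≈⟨ +-identityʳ y ⟩
    y            ∎

  modulo₂ : ∀ {x y h h′} m m′ → x ≈ y + m * h + m′ * h′ → h ≈ 0# → h′ ≈ 0# → x ≈ y
  modulo₂ m m′ eq h≈0 h′≈0 = modulo₁ m (modulo₁ m′ eq h′≈0) h≈0

  modulo₃ : ∀ {x y h h′ h″} m m′ m″ → x ≈ y + m * h + m′ * h′ + m″ * h″ →
            h ≈ 0# → h′ ≈ 0# → h″ ≈ 0# → x ≈ y
  modulo₃ m m′ m″ eq h≈0 h′≈0 h″≈0 = modulo₂ m m′ (modulo₁ m″ eq h″≈0) h≈0 h′≈0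

module ℤ-Solver = IntegerSolver ℤ.+-*-commutativeRing

-- Binary quadratic forms and Eisenstein integers

module IntegerForms where
  open import Data.Integer using (∣_∣; _⊖_; _+_; _*_; _-_; -_; _/ℕ_; _%ℕ_)
  import Data.Integer.DivMod as ℤ
  open import Data.Integer.Coprimality using (Coprime)
  import Data.Nat.Coprimality as ℕ
  open import Data.Nat.GCD using (module Bézout)
  open ≡ using (refl; sym; trans; cong; cong₂; module ≡-Reasoning)
  open ℤ-Solver using (solve; _:=_; _:+_; _:*_; _:-_; :-_; con; modulo₁; x-y≈0)

  bézout : ∀ i j → Coprime i j → ∃₂ λ u w → u * i + w * j ≡ + 1
  bézout i j coprime with signed i | signed j | ℕ.coprime-Bézout coprime
    where
    signed : ∀ i → ∃ λ s → s * i ≡ + ∣ i ∣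
    signed (+ n)    = + 1 , ℤ.*-identityˡ (+ n)
    signed -[1+ n ] = -[1+ 0 ] , ℤ.-1*i≡-i -[1+ n ]
  ... | s , si | t , tj | Bézout.+- x y eq = + x * s , - (+ y * t) , (begin
    (+ x * s) * i + - (+ y * t) * j
      ≡⟨ solve 6 (λ x y s t i j → (x :* s) :* i :+ :- (y :* t) :* j := x :* (s :* i) :- y :* (t :* j)) refl (+ x) (+ y) s t i j ⟩
    + x * (s * i) - + y * (t * j)     ≡⟨ cong₂ (λ k l → + x * k - + y * l) si tj ⟩
    + x * + ∣ i ∣ - + y * + ∣ j ∣     ≡⟨ cong₂ _-_ (ℤ.pos-* x ∣ i ∣) (ℤ.pos-* y ∣ j ∣) ⟨
    + (x ℕ.* ∣ i ∣) - + (y ℕ.* ∣ j ∣) ≡⟨ cong (λ k → + k - + (y ℕ.* ∣ j ∣)) eq ⟨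
    + (1 ℕ.+ y ℕ.* ∣ j ∣) - + (y ℕ.* ∣ j ∣) ≡⟨ solve 1 (λ k → con (+ 1) :+ k :- k := con (+ 1)) refl (+ (y ℕ.* ∣ j ∣)) ⟩
    + 1 ∎)
    where open ≡-Reasoning
  ... | s , si | t , tj | Bézout.-+ x y eq = - (+ x * s) , + y * t , (begin
    - (+ x * s) * i + (+ y * t) * j
      ≡⟨ solve 6 (λ x y s t i j → :- (x :* s) :* i :+ (y :* t) :* j := y :* (t :* j) :- x :* (s :* i)) refl (+ x) (+ y) s t i j ⟩
    + y * (t * j) - + x * (s * i)     ≡⟨ cong₂ (λ k l → + y * l - + x * k) si tj ⟩
    + y * + ∣ j ∣ - + x * + ∣ i ∣     ≡⟨ cong₂ _-_ (ℤ.pos-* y ∣ j ∣) (ℤ.pos-* x ∣ i ∣) ⟨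
    + (y ℕ.* ∣ j ∣) - + (x ℕ.* ∣ i ∣) ≡⟨ cong (λ k → + k - + (x ℕ.* ∣ i ∣)) eq ⟨
    + (1 ℕ.+ x ℕ.* ∣ i ∣) - + (x ℕ.* ∣ i ∣) ≡⟨ solve 1 (λ k → con (+ 1) :+ k :- k := con (+ 1)) refl (+ (x ℕ.* ∣ i ∣)) ⟩
    + 1 ∎)
    where open ≡-Reasoning

  square-abs : ∀ i → i * i ≡ + (∣ i ∣ ℕ.* ∣ i ∣)
  square-abs (+ n)    = sym (ℤ.pos-* n n)
  square-abs -[1+ n ] = refl

  -- A positive definite binary form Ax² + Bxy + Cy² with B² - 4AC = -3 represents 1.
  -- The middle coefficient is reduced to ∣B′∣ ≤ A by a shift of x; then either
  -- C′ < A and the variables are exchanged, or 4A² ≤ 4AC′ = B′² + 3 ≤ A² + 3 and A = 1.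
  -- The bound n on A is the induction variable.
  represents-1 : ∀ n a B (C : ℤ) → suc a ℕ.≤ n → B * B + + 3 ≡ + 4 * + suc a * C →
                 ∃₂ λ x y → + suc a * (x * x) + B * (x * y) + C * (y * y) ≡ + 1
  represents-1 (suc n) a B C (s≤s a≤n) disc = reduced C′ refl disc′
    where
    A = + suc a
    2a = suc a ℕ.+ suc a
    k = (B + A) /ℕ 2a
    r = (B + A) %ℕ 2a
    B′ = B - + 2 * (A * k)
    C′ = C - B * k + A * (k * k)

    division : B + A ≡ + r + k * (A + A)
    division = ℤ.a≡a%ℕn+[a/ℕn]*n (B + A) 2a

    B′≡ : B′ ≡ r ⊖ suc a
    B′≡ = trans (modulo₁ (+ 1) (solve 4 (λ A B k r →
        B :- con (+ 2) :* (A :* k) := r :- A :+ con (+ 1) :* (B :+ A :- (r :+ k :* (A :+ A)))) refl A B k (+ r))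
        (x-y≈0 division)) (ℤ.m-n≡m⊖n r (suc a))

    ∣B′∣≤ : ∣ B′ ∣ ℕ.≤ suc a
    ∣B′∣≤ rewrite B′≡ with ℕ.≤-total r (suc a)
    ... | inj₁ r≤a rewrite ℤ.∣⊖∣-≤ r≤a = ℕ.m∸n≤m (suc a) r
    ... | inj₂ a≤r rewrite ℤ.⊖-≥ a≤r = ℕ.≤-trans (ℕ.∸-monoˡ-≤ (suc a) (ℕ.<⇒≤ (ℤ.n%ℕd<d (B + A) 2a)))
                                                  (ℕ.≤-reflexive (ℕ.m+n∸n≡m (suc a) (suc a)))

    disc′ : B′ * B′ + + 3 ≡ + 4 * A * C′
    disc′ = modulo₁ (+ 1) (solve 4 (λ A B C k →
       let B′ = B :- con (+ 2) :* (A :* k) ; C′ = C :- B :* k :+ A :* (k :* k) in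
       B′ :* B′ :+ con (+ 3) := con (+ 4) :* A :* C′ :+ con (+ 1) :* (B :* B :+ con (+ 3) :- con (+ 4) :* A :* C)) refl A B C k)
       (x-y≈0 disc)

    shift : ∀ {C″} → C″ ≡ C′ → (∃₂ λ x y → A * (x * x) + B′ * (x * y) + C″ * (y * y) ≡ + 1) →
            ∃₂ λ x y → A * (x * x) + B * (x * y) + C * (y * y) ≡ + 1
    shift refl (x , y , eq) = x - k * y , y , trans (solve 6 (λ A B C k x y →
        A :* ((x :- k :* y) :* (x :- k :* y)) :+ B :* ((x :- k :* y) :* y) :+ C :* (y :* y)
        := A :* (x :* x) :+ (B :- con (+ 2) :* (A :* k)) :* (x :* y) :+ (C :- B :* k :+ A :* (k :* k)) :* (y :* y)) refl A B C k x y) eq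

    swap : ∀ c → (∃₂ λ x y → c * (x * x) + B′ * (x * y) + A * (y * y) ≡ + 1) →
           ∃₂ λ x y → A * (x * x) + B′ * (x * y) + c * (y * y) ≡ + 1
    swap c (x , y , eq) = y , x , trans (solve 5 (λ A B c x y →
      A :* (y :* y) :+ B :* (y :* x) :+ c :* (x :* x) := c :* (x :* x) :+ B :* (x :* y) :+ A :* (y :* y)) refl A B′ c x y) eq

    reduced : ∀ C″ → C″ ≡ C′ → B′ * B′ + + 3 ≡ + 4 * A * C″ →
              ∃₂ λ x y → A * (x * x) + B * (x * y) + C * (y * y) ≡ + 1
    reduced (+ zero) _ eq with trans (cong (_+ + 3) (sym (square-abs B′))) (trans eq (ℤ.*-zeroʳ (+ 4 * A)))
    ... | eq′ with trans (ℕ.+-comm 3 _) (ℤ.+-injective eq′)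
    ... | ()
    reduced -[1+ c ] _ eq with trans (cong (_+ + 3) (sym (square-abs B′))) eq
    ... | ()
    reduced (+ suc c) C″≡ eq with suc c ℕ.≤? a
    ... | yes c<a = shift C″≡ (swap (+ suc c) (represents-1 n c B′ A (ℕ.≤-trans c<a a≤n)
                     (trans eq (solve 2 (λ A c → con (+ 4) :* A :* c := con (+ 4) :* c :* A) refl A (+ suc c)))))
    ... | no c≮a  = minimal a refl
      where
      eq-ℕ : ∣ B′ ∣ ℕ.* ∣ B′ ∣ ℕ.+ 3 ≡ 4 ℕ.* suc a ℕ.* suc c
      eq-ℕ = ℤ.+-injective (trans (cong (_+ + 3) (sym (square-abs B′))) eq)

      bound : 3 ℕ.* (suc a ℕ.* suc a) ℕ.≤ 3
      bound = ℕ.+-cancelˡ-≤ (suc a ℕ.* suc a) _ _ (begin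
        4 ℕ.* (suc a ℕ.* suc a)         ≡⟨ ℕ.*-assoc 4 (suc a) (suc a) ⟨
        4 ℕ.* suc a ℕ.* suc a           ≤⟨ ℕ.*-monoʳ-≤ (4 ℕ.* suc a) (ℕ.≰⇒> c≮a) ⟩
        4 ℕ.* suc a ℕ.* suc c           ≡⟨ eq-ℕ ⟨
        ∣ B′ ∣ ℕ.* ∣ B′ ∣ ℕ.+ 3         ≤⟨ ℕ.+-monoˡ-≤ 3 (ℕ.*-mono-≤ ∣B′∣≤ ∣B′∣≤) ⟩
        suc a ℕ.* suc a ℕ.+ 3           ∎)
        where open ℕ.≤-Reasoning

      minimal : ∀ a′ → a′ ≡ a → ∃₂ λ x y → A * (x * x) + B * (x * y) + C * (y * y) ≡ + 1
      minimal zero    refl = + 1 , + 0 , solve 2 (λ B C →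
        con (+ 1) :* (con (+ 1) :* con (+ 1)) :+ B :* (con (+ 1) :* con (+ 0)) :+ C :* (con (+ 0) :* con (+ 0)) := con (+ 1)) refl B C
      minimal (suc _) refl with ℕ.≤-trans (ℕ.*-monoʳ-≤ 3 (ℕ.*-mono-≤ 2≤ 2≤)) bound
        where
        2≤ : 2 ℕ.≤ suc a
        2≤ = s≤s (s≤s z≤n)
      ... | s≤s (s≤s (s≤s ()))

-- Identities behind the extraction of a factor π³ from an element of norm p³
module CubeIdentities {c ℓ} (R : CommutativeRing c ℓ) where
  open CommutativeRing R using () renaming (Carrier to A; _≈_ to _∼_; _+_ to _⊕_; _*_ to _⊗_; _-_ to _⊝_; 0# to 𝟘)
  open CommutativeRing R using (setoid; refl; sym; trans; *-cong; *-congˡ; *-congʳ; +-congˡ)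
  open IntegerSolver R

  -- The quotient of τπ̄³ by p³ in the next lemma
  ε-part : (τ τ̄ p x y C : A) → A
  ε-part τ τ̄ p x y C = x ⊗ x ⊗ x ⊗ τ ⊕ C ⊗ (int (+ 3) ⊗ (p ⊗ p ⊗ x ⊗ x ⊗ y)
         ⊕ int (+ 3) ⊗ (p ⊗ x ⊗ y ⊗ y ⊗ τ̄) ⊕ y ⊗ y ⊗ y ⊗ τ̄ ⊗ τ̄)

  -- If N(τ) = p³C and π̄ = px + yτ̄ then τπ̄³ is divisible by p³.
  τ-cube : ∀ τ τ̄ p x y C → τ ⊗ τ̄ ⊝ p ⊗ p ⊗ p ⊗ C ∼ 𝟘 → let π̄ = p ⊗ x ⊕ y ⊗ τ̄ in
           τ ⊗ (π̄ ⊗ π̄ ⊗ π̄) ∼ p ⊗ p ⊗ p ⊗ ε-part τ τ̄ p x y C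
  τ-cube τ τ̄ p x y C = modulo₁ _
     (solve 6 (λ τ τ̄ p x y C →
       let π̄ = p :* x :+ y :* τ̄
           e = con (+ 3) :* (p :* p :* x :* x :* y) :+ con (+ 3) :* (p :* x :* y :* y :* τ̄) :+ y :* y :* y :* τ̄ :* τ̄ in
       τ :* (π̄ :* π̄ :* π̄) :=
       p :* p :* p :* (x :* x :* x :* τ :+ C :* e) :+ e :* (τ :* τ̄ :- p :* p :* p :* C)) refl τ τ̄ p x y C)

  -- An element z = bτ + kp³ is ε π³ up to the factor p³ = π³π̄³.
  divided : ∀ z π π̄ τ τ̄ p x y b k C → z ∼ b ⊗ τ ⊕ k ⊗ (p ⊗ p ⊗ p) → π ⊗ π̄ ∼ p → π̄ ∼ p ⊗ x ⊕ y ⊗ τ̄ →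
            τ ⊗ τ̄ ∼ p ⊗ p ⊗ p ⊗ C →
            ∃ λ ε → p ⊗ (p ⊗ (p ⊗ z)) ∼ p ⊗ (p ⊗ (p ⊗ (ε ⊗ (π ⊗ π ⊗ π))))
  divided z π π̄ τ τ̄ p x y b k C z≡ N≡ π̄≡ ττ̄ = k ⊗ (π̄ ⊗ π̄ ⊗ π̄) ⊕ b ⊗ ε-part τ τ̄ p x y C , (begin
    p ⊗ (p ⊗ (p ⊗ z))
      ≈⟨ *-cong (sym N≡) (*-cong (sym N≡) (*-congʳ (sym N≡))) ⟩
    π ⊗ π̄ ⊗ (π ⊗ π̄ ⊗ (π ⊗ π̄ ⊗ z))
      ≈⟨ solve 3 (λ z q r → q :* r :* (q :* r :* (q :* r :* z)) := z :* (r :* r :* r) :* (q :* q :* q)) refl z π π̄ ⟩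
    z ⊗ (π̄ ⊗ π̄ ⊗ π̄) ⊗ (π ⊗ π ⊗ π)
      ≈⟨ *-congʳ (*-congʳ z≡) ⟩
    (b ⊗ τ ⊕ k ⊗ (p ⊗ p ⊗ p)) ⊗ (π̄ ⊗ π̄ ⊗ π̄) ⊗ (π ⊗ π ⊗ π)
      ≈⟨ solve 6 (λ b τ k p q r → (b :* τ :+ k :* p) :* q :* r := (p :* (k :* q) :+ b :* (τ :* q)) :* r) refl
          b τ k (p ⊗ p ⊗ p) (π̄ ⊗ π̄ ⊗ π̄) (π ⊗ π ⊗ π) ⟩
    (p ⊗ p ⊗ p ⊗ (k ⊗ (π̄ ⊗ π̄ ⊗ π̄)) ⊕ b ⊗ (τ ⊗ (π̄ ⊗ π̄ ⊗ π̄))) ⊗ (π ⊗ π ⊗ π)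
      ≈⟨ *-congʳ (+-congˡ (*-congˡ (trans (*-congˡ (*-cong (*-cong π̄≡ π̄≡) π̄≡)) (τ-cube τ τ̄ p x y C (x-y≈0 ττ̄))))) ⟩
    (p ⊗ p ⊗ p ⊗ (k ⊗ (π̄ ⊗ π̄ ⊗ π̄)) ⊕ b ⊗ (p ⊗ p ⊗ p ⊗ ε-part τ τ̄ p x y C)) ⊗ (π ⊗ π ⊗ π)
      ≈⟨ solve 5 (λ p l b e r → (p :* p :* p :* l :+ b :* (p :* p :* p :* e)) :* r := p :* (p :* (p :* ((l :+ b :* e) :* r)))) refl
          p (k ⊗ (π̄ ⊗ π̄ ⊗ π̄)) b (ε-part τ τ̄ p x y C) (π ⊗ π ⊗ π) ⟩
    p ⊗ (p ⊗ (p ⊗ ((k ⊗ (π̄ ⊗ π̄ ⊗ π̄) ⊕ b ⊗ ε-part τ τ̄ p x y C) ⊗ (π ⊗ π ⊗ π)))) ∎)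
    where open Relation.Binary.Reasoning.Setoid setoid

module EisensteinIntegers where
  open import Data.Integer using (_+_; _*_; _-_; -_)
  open IntegerForms
  open ≡ using (refl; sym; trans; cong; cong₂; subst; module ≡-Reasoning)
  open ℤ-Solver using (solve; _:=_; _:+_; _:*_; _:-_; :-_; con; modulo₁; modulo₂; x-y≈0)

  -- The element a + bω of ℤ[ω], where ω is a primitive sixth root of unity: ω² = ω - 1
  infix 5 _+ω_
  record Eisenstein : Set where
    constructor _+ω_
    field
      fst snd : ℤ
  open Eisenstein

  ≡-E : ∀ {a b c d} → a ≡ c → b ≡ d → (a +ω b) ≡ (c +ω d)
  ≡-E = cong₂ _+ω_

  Eisenstein-ring : CommutativeRing 0ℓ 0ℓ
  Eisenstein-ring = record
    { Carrier = Eisenstein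
    ; _≈_ = _≡_
    ; _+_ = λ x y → (fst x + fst y) +ω (snd x + snd y)
    ; _*_ = λ x y → (fst x * fst y - snd x * snd y) +ω (fst x * snd y + snd x * fst y + snd x * snd y)
    ; -_  = λ x → (- fst x) +ω (- snd x)
    ; 0#  = + 0 +ω + 0
    ; 1#  = + 1 +ω + 0
    ; isCommutativeRing = record
      { isRing = record
        { +-isAbelianGroup = record
          { isGroup = record
            { isMonoid = record
              { isSemigroup = record
                { isMagma = record { isEquivalence = ≡.isEquivalence ; ∙-cong = cong₂ _ }
                ; assoc = λ x y z → ≡-E (ℤ.+-assoc (fst x) (fst y) (fst z)) (ℤ.+-assoc (snd x) (snd y) (snd z)) }
              ; identity = (λ x → ≡-E (ℤ.+-identityˡ (fst x)) (ℤ.+-identityˡ (snd x)))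
                         , (λ x → ≡-E (ℤ.+-identityʳ (fst x)) (ℤ.+-identityʳ (snd x))) }
            ; inverse = (λ x → ≡-E (ℤ.+-inverseˡ (fst x)) (ℤ.+-inverseˡ (snd x)))
                      , (λ x → ≡-E (ℤ.+-inverseʳ (fst x)) (ℤ.+-inverseʳ (snd x)))
            ; ⁻¹-cong = λ { refl → refl } }
          ; comm = λ x y → ≡-E (ℤ.+-comm (fst x) (fst y)) (ℤ.+-comm (snd x) (snd y)) }
        ; *-cong = cong₂ _
        ; *-assoc = λ (a +ω b) (c +ω d) (e +ω f) → ≡-E
            (solve 6 (λ a b c d e f → (a :* c :- b :* d) :* e :- (a :* d :+ b :* c :+ b :* d) :* f
               := a :* (c :* e :- d :* f) :- b :* (c :* f :+ d :* e :+ d :* f)) refl a b c d e f)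
            (solve 6 (λ a b c d e f →
               (a :* c :- b :* d) :* f :+ (a :* d :+ b :* c :+ b :* d) :* e :+ (a :* d :+ b :* c :+ b :* d) :* f
               := a :* (c :* f :+ d :* e :+ d :* f) :+ b :* (c :* e :- d :* f) :+ b :* (c :* f :+ d :* e :+ d :* f)) refl a b c d e f)
        ; *-identity = (λ (a +ω b) → ≡-E
              (solve 2 (λ a b → con (+ 1) :* a :- con (+ 0) :* b := a) refl a b)
              (solve 2 (λ a b → con (+ 1) :* b :+ con (+ 0) :* a :+ con (+ 0) :* b := b) refl a b))
          , (λ (a +ω b) → ≡-E
              (solve 2 (λ a b → a :* con (+ 1) :- b :* con (+ 0) := a) refl a b)
              (solve 2 (λ a b → a :* con (+ 0) :+ b :* con (+ 1) :+ b :* con (+ 0) := b) refl a b))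
        ; distrib = (λ (a +ω b) (c +ω d) (e +ω f) → ≡-E
              (solve 6 (λ a b c d e f → a :* (c :+ e) :- b :* (d :+ f) := (a :* c :- b :* d) :+ (a :* e :- b :* f)) refl a b c d e f)
              (solve 6 (λ a b c d e f → a :* (d :+ f) :+ b :* (c :+ e) :+ b :* (d :+ f)
                 := (a :* d :+ b :* c :+ b :* d) :+ (a :* f :+ b :* e :+ b :* f)) refl a b c d e f))
          , (λ (a +ω b) (c +ω d) (e +ω f) → ≡-E
              (solve 6 (λ a b c d e f → (c :+ e) :* a :- (d :+ f) :* b := (c :* a :- d :* b) :+ (e :* a :- f :* b)) refl a b c d e f)
              (solve 6 (λ a b c d e f → (c :+ e) :* b :+ (d :+ f) :* a :+ (d :+ f) :* b
                 := (c :* b :+ d :* a :+ d :* b) :+ (e :* b :+ f :* a :+ f :* b)) refl a b c d e f))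
        }
      ; *-comm = λ (a +ω b) (c +ω d) → ≡-E
          (solve 4 (λ a b c d → a :* c :- b :* d := c :* a :- d :* b) refl a b c d)
          (solve 4 (λ a b c d → a :* d :+ b :* c :+ b :* d := c :* b :+ d :* a :+ d :* b) refl a b c d)
      }
    }

  module E = CommutativeRing Eisenstein-ring
  module I = CubeIdentities Eisenstein-ring

  -- The product of a + bω and its conjugate
  norm : Eisenstein → ℤ
  norm (a +ω b) = a * a + a * b + b * b

  norm-* : ∀ x y → norm (x E.* y) ≡ norm x * norm y
  norm-* (a +ω b) (c +ω d) = solve 4 (λ a b c d →
    (a :* c :- b :* d) :* (a :* c :- b :* d) :+ (a :* c :- b :* d) :* (a :* d :+ b :* c :+ b :* d)
      :+ (a :* d :+ b :* c :+ b :* d) :* (a :* d :+ b :* c :+ b :* d)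
    := (a :* a :+ a :* b :+ b :* b) :* (c :* c :+ c :* d :+ d :* d)) refl a b c d

  -- Complex conjugation, ω ↦ 1 - ω
  conj : Eisenstein → Eisenstein
  conj (a +ω b) = a + b +ω - b

  -- The embedding of ℤ
  rat : ℤ → Eisenstein
  rat n = n +ω + 0

  rat-* : ∀ m n → rat (m * n) ≡ rat m E.* rat n
  rat-* m n = ≡-E (solve 2 (λ m n → m :* n := m :* n :- con (+ 0) :* con (+ 0)) refl m n)
                  (solve 2 (λ m n → con (+ 0) := m :* con (+ 0) :+ con (+ 0) :* n :+ con (+ 0) :* con (+ 0)) refl m n)

  *-conj : ∀ z → z E.* conj z ≡ rat (norm z)
  *-conj (a +ω b) = ≡-E (solve 2 (λ a b → a :* (a :+ b) :- b :* :- b := a :* a :+ a :* b :+ b :* b) refl a b)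
                        (solve 2 (λ a b → a :* :- b :+ b :* (a :+ b) :+ b :* :- b := con (+ 0)) refl a b)

  scale : ∀ n a b → rat n E.* (a +ω b) ≡ (n * a +ω n * b)
  scale n a b = ≡-E (solve 3 (λ n a b → n :* a :- con (+ 0) :* b := n :* a) refl n a b)
                    (solve 3 (λ n a b → n :* b :+ con (+ 0) :* a :+ con (+ 0) :* b := n :* b) refl n a b)

  rat-cancel : ∀ n .{{_ : ℤ.NonZero n}} x y → rat n E.* x ≡ rat n E.* y → x ≡ y
  rat-cancel n (a +ω b) (c +ω d) eq with trans (sym (scale n a b)) (trans eq (scale n c d))
  ... | eq′ = ≡-E (ℤ.*-cancelˡ-≡ n a c (cong fst eq′)) (ℤ.*-cancelˡ-≡ n b d (cong snd eq′))

  -- The element τ = s + ω has norm p³C and z = a + bω is bτ modulo p³. A representation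
  -- of 1 by the form px² + (2s + 1)xy + p²Cy² gives the element π = px + yτ of norm p in the
  -- ideal (p, τ), and π³ divides z.
  divides-cube : ∀ p .{{_ : ℤ.NonZero p}} a b s k x y C → a ≡ s * b + k * (p * p * p) →
    s * s + s + + 1 ≡ p * p * p * C →
    p * (x * x) + (+ 2 * s + + 1) * (x * y) + (p * p * C) * (y * y) ≡ + 1 →
    norm (a +ω b) ≡ p * p * p →
    ∃₂ λ ε π → norm ε ≡ + 1 × norm π ≡ p × (a +ω b) ≡ ε E.* (π E.* π E.* π)
  divides-cube p a b s k x y C a≡ s²+s+1 form N≡ =
    let ε , eq = I.divided z π (conj π) τ (conj τ) (rat p) (rat x) (rat y) (rat b) (rat k) (rat C) z≡ ππ̄ π̄≡ ττ̄
        w = ε E.* (π E.* π E.* π)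
        z≡w = rat-cancel p z w (rat-cancel p (rat p E.* z) (rat p E.* w)
                (rat-cancel p (rat p E.* (rat p E.* z)) (rat p E.* (rat p E.* w)) eq))
    in ε , π , norm-ε ε z≡w , Nπ , z≡w
    where
    z = a +ω b
    τ = s +ω + 1
    π = p * x + y * s +ω y

    Nπ : norm π ≡ p
    Nπ = modulo₂ p (y * y) (solve 5 (λ p x y s C →
      (p :* x :+ y :* s) :* (p :* x :+ y :* s) :+ (p :* x :+ y :* s) :* y :+ y :* y
      := p :+ p :* (p :* (x :* x) :+ (con (+ 2) :* s :+ con (+ 1)) :* (x :* y) :+ p :* p :* C :* (y :* y) :- con (+ 1))
         :+ y :* y :* (s :* s :+ s :+ con (+ 1) :- p :* p :* p :* C)) refl p x y s C)
      (x-y≈0 form) (x-y≈0 s²+s+1)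

    P≡ : rat (p * p * p) ≡ rat p E.* rat p E.* rat p
    P≡ = trans (rat-* (p * p) p) (cong (E._* rat p) (rat-* p p))

    ππ̄ : π E.* conj π ≡ rat p
    ππ̄ = trans (*-conj π) (cong rat Nπ)

    ττ̄ : τ E.* conj τ ≡ rat p E.* rat p E.* rat p E.* rat C
    ττ̄ = trans (*-conj τ) (trans (cong rat (trans (solve 1 (λ s →
      s :* s :+ s :* con (+ 1) :+ con (+ 1) :* con (+ 1) := s :* s :+ s :+ con (+ 1)) refl s) s²+s+1))
      (trans (rat-* (p * p * p) C) (cong (E._* rat C) P≡)))

    π̄≡ : conj π ≡ rat p E.* rat x E.+ rat y E.* conj τ
    π̄≡ = trans (≡-E (solve 4 (λ p x y s → p :* x :+ y :* s :+ y := p :* x :+ y :* (s :+ con (+ 1))) refl p x y s)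
                    (solve 1 (λ y → :- y := con (+ 0) :+ y :* con -[1+ 0 ]) refl y))
               (sym (cong₂ E._+_ (sym (rat-* p x)) (scale y (s + + 1) -[1+ 0 ])))

    z≡ : (a +ω b) ≡ rat b E.* τ E.+ rat k E.* (rat p E.* rat p E.* rat p)
    z≡ = trans (≡-E (trans a≡ (cong (_+ k * (p * p * p)) (ℤ.*-comm s b)))
                     (solve 1 (λ b → b := b :* con (+ 1) :+ con (+ 0)) refl b))
                (sym (cong₂ E._+_ (scale b s (+ 1)) (trans (cong (rat k E.*_) (sym P≡)) (sym (rat-* k (p * p * p))))))

    norm-ε : ∀ ε → z ≡ ε E.* (π E.* π E.* π) → norm ε ≡ + 1
    norm-ε ε eq = ℤ.*-cancelʳ-≡ (norm ε) (+ 1) (p * p * p) {{ℤ.i*j≢0 (p * p) p {{ℤ.i*j≢0 p p}}}} (begin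
      norm ε * (p * p * p)                  ≡⟨ cong (λ q → norm ε * (q * q * q)) Nπ ⟨
      norm ε * (norm π * norm π * norm π)   ≡⟨ cong (λ q → norm ε * (q * norm π)) (norm-* π π) ⟨
      norm ε * (norm (π E.* π) * norm π)    ≡⟨ cong (norm ε *_) (norm-* (π E.* π) π) ⟨
      norm ε * norm (π E.* π E.* π)         ≡⟨ norm-* ε (π E.* π E.* π) ⟨
      norm (ε E.* (π E.* π E.* π))          ≡⟨ cong norm eq ⟨
      norm z                                ≡⟨ N≡ ⟩
      p * p * p                             ≡⟨ ℤ.*-identityˡ (p * p * p) ⟨
      + 1 * (p * p * p)                     ∎)
      where open ≡-Reasoning

  -- If b is invertible modulo the norm P of a + bω then a + bω = b(s + ω) modulo P for
  -- some s, and P divides the norm of s + ω.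
  square-divides : ∀ P a b u w → u * b + w * P ≡ + 1 → norm (a +ω b) ≡ P → let s = a * u ; k = a * w in
    a ≡ s * b + k * P × ∃ λ C → s * s + s + + 1 ≡ P * C
  square-divides P a b u w bez N≡ = a≡ , C , s²+s+1
    where
    s = a * u
    k = a * w
    M = + 1 - + 2 * (a * k) + k * k * P - k * b
    C = u * u * M + (+ 2 * (u * b * w) + w * w * P) * (s * s + s + + 1)

    a≡ : a ≡ s * b + k * P
    a≡ = sym (modulo₁ a (solve 5 (λ a b u w P → a :* u :* b :+ a :* w :* P
               := a :+ a :* (u :* b :+ w :* P :- con (+ 1))) refl a b u w P) (x-y≈0 bez))

    -- P divides s² + s + 1 because it divides b²(s² + s + 1) and b is invertible.
    b²N : b * b * (s * s + s + + 1) ≡ P * M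
    b²N = modulo₂ (a + s * b - k * P + b) (+ 1) (solve 5 (λ a b k s P →
       b :* b :* (s :* s :+ s :+ con (+ 1)) :=
       P :* (con (+ 1) :- con (+ 2) :* (a :* k) :+ k :* k :* P :- k :* b)
        :+ (a :+ s :* b :- k :* P :+ b) :* (s :* b :+ k :* P :- a) :+ con (+ 1) :* (a :* a :+ a :* b :+ b :* b :- P)) refl a b k s P)
       (x-y≈0 (sym a≡)) (x-y≈0 N≡)

    s²+s+1 : s * s + s + + 1 ≡ P * C
    s²+s+1 = modulo₂ (- ((s * s + s + + 1) * (u * b + w * P + + 1))) (u * u) (solve 6 (λ b s u w P M →
       let n = s :* s :+ s :+ con (+ 1) in
       n := P :* (u :* u :* M :+ (con (+ 2) :* (u :* b :* w) :+ w :* w :* P) :* n)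
          :+ :- (n :* (u :* b :+ w :* P :+ con (+ 1))) :* (u :* b :+ w :* P :- con (+ 1))
          :+ u :* u :* (b :* b :* n :- P :* M)) refl b s u w P M) (x-y≈0 bez) (x-y≈0 b²N)

  discriminant-3 : ∀ p s C → s * s + s + + 1 ≡ p * p * p * C →
    (+ 2 * s + + 1) * (+ 2 * s + + 1) + + 3 ≡ + 4 * p * (p * p * C)
  discriminant-3 p s C eq = modulo₁ (+ 4) (solve 3 (λ p s C →
       (con (+ 2) :* s :+ con (+ 1)) :* (con (+ 2) :* s :+ con (+ 1)) :+ con (+ 3)
       := con (+ 4) :* p :* (p :* p :* C) :+ con (+ 4) :* (s :* s :+ s :+ con (+ 1) :- p :* p :* p :* C)) refl p s C) (x-y≈0 eq)

  -- An Eisenstein integer a + bω of norm p³ with b prime to p is ε π³ with N(ε) = 1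
  -- and N(π) = p. The argument q exhibits p as positive.
  cube : ∀ p q a b u w → p ≡ + suc q → u * b + w * (p * p * p) ≡ + 1 → norm (a +ω b) ≡ p * p * p →
         ∃₂ λ ε π → norm ε ≡ + 1 × norm π ≡ p × (a +ω b) ≡ ε E.* (π E.* π E.* π)
  cube p q a b u w p≡ bez N≡ =
    let a≡ , C , s²+s+1 = square-divides (p * p * p) a b u w bez N≡
        s = a * u
        x , y , form = represents-1 (suc q) q (+ 2 * s + + 1) (p * p * C) ℕ.≤-refl
          (trans (discriminant-3 p s C s²+s+1) (cong (λ p′ → + 4 * p′ * (p * p * C)) p≡))
    in divides-cube p {{subst ℤ.NonZero (sym p≡) _}} a b s (a * w) x y C a≡ s²+s+1
         (trans (cong (λ p′ → p′ * (x * x) + (+ 2 * s + + 1) * (x * y) + (p * p * C) * (y * y)) p≡) form) N≡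

-- The discriminant is not a square

module SquareDiscriminant where
  open import Data.Integer using (∣_∣; _+_; _*_; _-_; -_; _^_)
  open import Data.Integer.Coprimality using (Coprime)
  open import Data.Integer.Divisibility using (_∣_)
  import Data.Nat.Coprimality as ℕ
  import Data.Nat.Divisibility as ℕ
  open import Data.Nat.Primality using (Prime; prime?; euclidsLemma; prime[2]; prime⇒irreducible; prime⇒nonZero)
  open import Relation.Nullary.Decidable using (from-yes)
  open IntegerForms
  open EisensteinIntegers
  open Eisenstein
  open ≡ using (refl; sym; trans; cong; cong₂; subst; module ≡-Reasoning)
  open ℤ-Solver using (solve; _:=_; _:+_; _:*_; _:-_; :-_; con; modulo₁; modulo₂; x-y≈0)

  prime[3] : Prime 3
  prime[3] = from-yes (prime? 3)

  3-coprime : ∀ {p} → Prime p → p ≢ 3 → ℕ.Coprime 3 p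
  3-coprime pp p≢3 (d∣3 , d∣p) with prime⇒irreducible pp d∣p
  ... | inj₁ d≡1 = d≡1
  ... | inj₂ refl with prime⇒irreducible prime[3] d∣3
  ...   | inj₁ d≡1 = d≡1
  ...   | inj₂ d≡3 = ⊥-elim (p≢3 d≡3)

  -- Integers of absolute value at most 1, the coordinates of Eisenstein units
  data IsSmall : ℤ → Set where
    is0  : IsSmall (+ 0)
    is1  : IsSmall (+ 1)
    is-1 : IsSmall (-[1+ 0 ])

  small : ∀ f → 3 ℕ.* (∣ f ∣ ℕ.* ∣ f ∣) ℕ.≤ 4 → IsSmall f
  small (+ 0) _ = is0
  small (+ 1) _ = is1
  small -[1+ 0 ] _ = is-1
  small (+ suc (suc n)) h with ℕ.≤-trans (ℕ.*-monoʳ-≤ 3 (ℕ.*-mono-≤ {2} {2 ℕ.+ n} (ℕ.m≤m+n 2 n) (ℕ.m≤m+n 2 n))) h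
  ... | s≤s (s≤s (s≤s (s≤s ())))
  small -[1+ suc n ] h with ℕ.≤-trans (ℕ.*-monoʳ-≤ 3 (ℕ.*-mono-≤ {2} {2 ℕ.+ n} (ℕ.m≤m+n 2 n) (ℕ.m≤m+n 2 n))) h
  ... | s≤s (s≤s (s≤s (s≤s ())))

  squares-4 : ∀ e f → e * e + + 3 * (f * f) ≡ + 4 → IsSmall f
  squares-4 e f eq = small f (ℕ.m+n≤o⇒n≤o (∣ e ∣ ℕ.* ∣ e ∣) (ℕ.≤-reflexive (ℤ.+-injective (begin
    + (∣ e ∣ ℕ.* ∣ e ∣) + + (3 ℕ.* (∣ f ∣ ℕ.* ∣ f ∣))   ≡⟨ cong (λ k → + (∣ e ∣ ℕ.* ∣ e ∣) + k) (ℤ.pos-* 3 (∣ f ∣ ℕ.* ∣ f ∣)) ⟩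
    + (∣ e ∣ ℕ.* ∣ e ∣) + + 3 * + (∣ f ∣ ℕ.* ∣ f ∣)     ≡⟨ cong₂ (λ k l → k + + 3 * l) (square-abs e) (square-abs f) ⟨
    e * e + + 3 * (f * f)                           ≡⟨ eq ⟩
    + 4                                             ∎))))
    where open ≡-Reasoning

  -- 4N(e + fω) = (2e + f)² + 3f²
  norm-1⇒small : ∀ e f → norm (e +ω f) ≡ + 1 → IsSmall e × IsSmall f
  norm-1⇒small e f eq =
      squares-4 (+ 2 * f + e) e (modulo₁ (+ 4) (solve 2 (λ e f →
        (con (+ 2) :* f :+ e) :* (con (+ 2) :* f :+ e) :+ con (+ 3) :* (e :* e)
        := con (+ 4) :+ con (+ 4) :* (e :* e :+ e :* f :+ f :* f :- con (+ 1))) refl e f) (x-y≈0 eq))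
    , squares-4 (+ 2 * e + f) f (modulo₁ (+ 4) (solve 2 (λ e f →
        (con (+ 2) :* e :+ f) :* (con (+ 2) :* e :+ f) :+ con (+ 3) :* (f :* f)
        := con (+ 4) :+ con (+ 4) :* (e :* e :+ e :* f :+ f :* f :- con (+ 1))) refl e f) (x-y≈0 eq))

  -- The cube of u + vω
  π³ : ℤ → ℤ → Eisenstein
  π³ u v = u * u * u - + 3 * (u * v * v) - v * v * v +ω + 3 * (u * v * (u + v))

  π³≡ : ∀ u v → let π = u +ω v in π E.* π E.* π ≡ π³ u v
  π³≡ u v = ≡-E
    (solve 2 (λ u v → (u :* u :- v :* v) :* u :- (u :* v :+ v :* u :+ v :* v) :* v
        := u :* u :* u :- con (+ 3) :* (u :* v :* v) :- v :* v :* v) refl u v)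
    (solve 2 (λ u v → (u :* u :- v :* v) :* v :+ (u :* v :+ v :* u :+ v :* v) :* u :+ (u :* v :+ v :* u :+ v :* v) :* v
        := con (+ 3) :* (u :* v :* (u :+ v))) refl u v)

  multiple⇒∣ : ∀ k i j → i ≡ + k * j → k ℕ.∣ ∣ i ∣
  multiple⇒∣ k i j eq = ℕ.divides ∣ j ∣ (trans (cong ∣_∣ eq) (trans (ℤ.abs-* (+ k) j) (ℕ.*-comm k ∣ j ∣)))

  ∣⇒multiple : ∀ k i → k ℕ.∣ ∣ i ∣ → ∃ λ j → i ≡ + k * j
  ∣⇒multiple k (+ n) (ℕ.divides q eq) = + q , trans (cong +_ (trans eq (ℕ.*-comm q k))) (ℤ.pos-* k q)
  ∣⇒multiple k -[1+ n ] (ℕ.divides q eq) = - + q , trans (cong (λ m → - + m) (trans eq (ℕ.*-comm q k)))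
    (trans (cong -_ (ℤ.pos-* k q)) (ℤ.neg-distribʳ-* (+ k) (+ q)))

  -- If 3 divides the first coordinate u³ - 3uv² - v³ of π³, where π = u + vω, then it
  -- divides d³ for d = u - v, hence d, hence N(π) = d² + 3uv.
  3∣norm : ∀ u v m → u * u * u - + 3 * (u * v * v) - v * v * v ≡ + 3 * m → 3 ℕ.∣ ∣ norm (u +ω v) ∣
  3∣norm u v m eq = from d≡
    where
    d = u - v
    3∣ddd : 3 ℕ.∣ ∣ d ∣ ℕ.* (∣ d ∣ ℕ.* ∣ d ∣)
    3∣ddd = subst (3 ℕ.∣_) (trans (ℤ.abs-* d (d * d)) (cong (∣ d ∣ ℕ.*_) (ℤ.abs-* d d)))
      (multiple⇒∣ 3 (d * (d * d)) (m + u * v * v - u * v * (u - v)) (modulo₁ (+ 1) (solve 3 (λ u v m →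
         (u :- v) :* ((u :- v) :* (u :- v)) := con (+ 3) :* (m :+ u :* v :* v :- u :* v :* (u :- v))
           :+ con (+ 1) :* (u :* u :* u :- con (+ 3) :* (u :* v :* v) :- v :* v :* v :- con (+ 3) :* m)) refl u v m) (x-y≈0 eq)))

    3∣d : 3 ℕ.∣ ∣ d ∣
    3∣d = [ id , [ id , id ]′ ∘ euclidsLemma ∣ d ∣ ∣ d ∣ prime[3] ]′ (euclidsLemma ∣ d ∣ (∣ d ∣ ℕ.* ∣ d ∣) prime[3] 3∣ddd)

    d≡ = ∣⇒multiple 3 d 3∣d

    from : (∃ λ k → d ≡ + 3 * k) → 3 ℕ.∣ ∣ norm (u +ω v) ∣
    from (k , eq) = multiple⇒∣ 3 (norm (u +ω v)) (k * (u - v) + u * v) (modulo₁ (u - v) (solve 3 (λ u v k →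
      u :* u :+ u :* v :+ v :* v := con (+ 3) :* (k :* (u :- v) :+ u :* v) :+ (u :- v) :* (u :- v :- con (+ 3) :* k)) refl u v k) (x-y≈0 eq))


  -- The second coordinate of (e + fω)(A + 3qω) is a multiple of 3 for the
  -- units ±1, and for the other four only if A is a multiple of 3.
  unit-cases : ∀ {e f} → IsSmall e → IsSmall f → norm (e +ω f) ≡ + 1 → ∀ A q c →
    e * (+ 3 * q) + f * A + f * (+ 3 * q) ≡ + 3 * c → q ≡ c ⊎ - q ≡ c ⊎ ∃ λ m → A ≡ + 3 * m
  unit-cases is0  is0  () _
  unit-cases is1  is1  () _
  unit-cases is-1 is-1 () _
  unit-cases is1 is0 _ A q c eq = inj₁ (ℤ.*-cancelˡ-≡ (+ 3) q c
    (trans (solve 2 (λ A B → B := con (+ 1) :* B :+ con (+ 0) :* A :+ con (+ 0) :* B) refl A (+ 3 * q)) eq))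
  unit-cases is-1 is0 _ A q c eq = inj₂ (inj₁ (ℤ.*-cancelˡ-≡ (+ 3) (- q) c
    (trans (solve 2 (λ A q → con (+ 3) :* :- q := con -[1+ 0 ] :* (con (+ 3) :* q) :+ con (+ 0) :* A :+ con (+ 0) :* (con (+ 3) :* q)) refl A q) eq)))
  unit-cases is0 is1 _ A q c eq = inj₂ (inj₂ (c - q , modulo₁ (+ 1) (solve 3 (λ A q c → A := con (+ 3) :* (c :- q)
          :+ con (+ 1) :* (con (+ 0) :* (con (+ 3) :* q) :+ con (+ 1) :* A :+ con (+ 1) :* (con (+ 3) :* q) :- con (+ 3) :* c)) refl A q c) (x-y≈0 eq)))
  unit-cases is-1 is1 _ A q c eq = inj₂ (inj₂ (c , modulo₁ (+ 1) (solve 3 (λ A q c → A := con (+ 3) :* c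
          :+ con (+ 1) :* (con -[1+ 0 ] :* (con (+ 3) :* q) :+ con (+ 1) :* A :+ con (+ 1) :* (con (+ 3) :* q) :- con (+ 3) :* c)) refl A q c) (x-y≈0 eq)))
  unit-cases is0 is-1 _ A q c eq = inj₂ (inj₂ (- c - q , modulo₁ (- + 1) (solve 3 (λ A q c → A := con (+ 3) :* (:- c :- q)
          :+ :- con (+ 1) :* (con (+ 0) :* (con (+ 3) :* q) :+ con -[1+ 0 ] :* A :+ con -[1+ 0 ] :* (con (+ 3) :* q) :- con (+ 3) :* c)) refl A q c) (x-y≈0 eq)))
  unit-cases is1 is-1 _ A q c eq = inj₂ (inj₂ (- c , modulo₁ (- + 1) (solve 3 (λ A q c → A := con (+ 3) :* :- c
          :+ :- con (+ 1) :* (con (+ 1) :* (con (+ 3) :* q) :+ con -[1+ 0 ] :* A :+ con -[1+ 0 ] :* (con (+ 3) :* q) :- con (+ 3) :* c)) refl A q c) (x-y≈0 eq)))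

  -- If p = N(u + vω) and c = uv(u + v) then u is a root of x³ - px + c; if c = -uv(u + v)
  -- then -u is one.
  cube-root : ∀ u v p c → norm (u +ω v) ≡ p → u * v * (u + v) ≡ c → u * u * u + - p * u + c ≡ + 0
  cube-root u v p c Nπ eq = modulo₂ u (- + 1) (solve 4 (λ u v p c →
         u :* u :* u :+ :- p :* u :+ c := con (+ 0) :+ u :* (u :* u :+ u :* v :+ v :* v :- p) :+ :- con (+ 1) :* (u :* v :* (u :+ v) :- c))
         refl u v p c) (x-y≈0 Nπ) (x-y≈0 eq)

  cube-root′ : ∀ u v p c → norm (u +ω v) ≡ p → - (u * v * (u + v)) ≡ c → - u * - u * - u + - p * - u + c ≡ + 0
  cube-root′ u v p c Nπ eq = modulo₂ (- u) (- + 1) (solve 4 (λ u v p c →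
         :- u :* :- u :* :- u :+ :- p :* :- u :+ c := con (+ 0) :+ :- u :* (u :* u :+ u :* v :+ v :* v :- p) :+ :- con (+ 1) :* (:- (u :* v :* (u :+ v)) :- c))
         refl u v p c) (x-y≈0 Nπ) (x-y≈0 eq)

  -- If the second coordinate of ε π³ is 3c, where ε = e + fω is a unit and π = u + vω has
  -- norm p, then x³ - px + c has a root.
  unit-times-cube : ∀ {p} → Prime p → p ≢ 3 → ∀ e f u v c → norm (e +ω f) ≡ + 1 → norm (u +ω v) ≡ + p →
    e * (+ 3 * (u * v * (u + v))) + f * (u * u * u - + 3 * (u * v * v) - v * v * v) + f * (+ 3 * (u * v * (u + v))) ≡ + 3 * c →
    ∃ λ x → x * x * x + - + p * x + c ≡ + 0
  unit-times-cube {p} pp p≢3 e f u v c Nε Nπ eq =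
    [ (λ h → u , cube-root u v (+ p) c Nπ h) , [ (λ h → - u , cube-root′ u v (+ p) c Nπ h) , (λ (m , h) → ⊥-elim (3∤A m h)) ]′ ]′
    (unit-cases (proj₁ smalls) (proj₂ smalls) Nε (u * u * u - + 3 * (u * v * v) - v * v * v) (u * v * (u + v)) c eq)
    where
    smalls = norm-1⇒small e f Nε

    3∤A : ∀ m → u * u * u - + 3 * (u * v * v) - v * v * v ≢ + 3 * m
    3∤A m eq = [ (λ ()) , (λ 3≡p → p≢3 (sym 3≡p)) ]′
      (prime⇒irreducible pp (subst (λ q → 3 ℕ.∣ ∣ q ∣) Nπ (3∣norm u v m eq)))

  snd-unit-times-cube : ∀ e f u v → let π = u +ω v in snd ((e +ω f) E.* (π E.* π E.* π)) ≡
    e * (+ 3 * (u * v * (u + v))) + f * (u * u * u - + 3 * (u * v * v) - v * v * v) + f * (+ 3 * (u * v * (u + v)))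
  snd-unit-times-cube e f u v = cong (λ z → e * snd z + f * fst z + f * snd z) (π³≡ u v)

  -- n and 3c have the same parity.
  half-difference : ∀ q c n → n * n + + 27 * (c * c) ≡ + 4 * q → ∃ λ a → n ≡ + 2 * a + + 3 * c
  half-difference q c n eq = [ even-difference ∘ ∣⇒multiple 2 (n - + 3 * c) , even-sum ∘ ∣⇒multiple 2 (n + + 3 * c) ]′
    (euclidsLemma ∣ n - + 3 * c ∣ ∣ n + + 3 * c ∣ prime[2] 2∣product)
    where
    product≡ : (n - + 3 * c) * (n + + 3 * c) ≡ (+ 2 * q - + 18 * (c * c)) * + 2
    product≡ = modulo₁ (+ 1) (solve 3 (λ n c q →
          (n :- con (+ 3) :* c) :* (n :+ con (+ 3) :* c) := (con (+ 2) :* q :- con (+ 18) :* (c :* c)) :* con (+ 2)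
            :+ con (+ 1) :* (n :* n :+ con (+ 27) :* (c :* c) :- con (+ 4) :* q)) refl n c q) (x-y≈0 eq)

    2∣product : 2 ℕ.∣ ∣ n - + 3 * c ∣ ℕ.* ∣ n + + 3 * c ∣
    2∣product = ℕ.divides ∣ + 2 * q - + 18 * (c * c) ∣ (begin
      ∣ n - + 3 * c ∣ ℕ.* ∣ n + + 3 * c ∣    ≡⟨ ℤ.abs-* (n - + 3 * c) (n + + 3 * c) ⟨
      ∣ (n - + 3 * c) * (n + + 3 * c) ∣      ≡⟨ cong ∣_∣ product≡ ⟩
      ∣ (+ 2 * q - + 18 * (c * c)) * + 2 ∣   ≡⟨ ℤ.abs-* (+ 2 * q - + 18 * (c * c)) (+ 2) ⟩
      ∣ + 2 * q - + 18 * (c * c) ∣ ℕ.* 2     ∎)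
      where open ≡-Reasoning

    even-difference : (∃ λ a → n - + 3 * c ≡ + 2 * a) → ∃ λ a → n ≡ + 2 * a + + 3 * c
    even-difference (a , eq) = a , modulo₁ (+ 1) (solve 3 (λ n a c →
          n := con (+ 2) :* a :+ con (+ 3) :* c :+ con (+ 1) :* (n :- con (+ 3) :* c :- con (+ 2) :* a)) refl n a c) (x-y≈0 eq)

    even-sum : (∃ λ a → n + + 3 * c ≡ + 2 * a) → ∃ λ a → n ≡ + 2 * a + + 3 * c
    even-sum (a , eq) = a - + 3 * c , modulo₁ (+ 1) (solve 3 (λ n a c →
          n := con (+ 2) :* (a :- con (+ 3) :* c) :+ con (+ 3) :* c :+ con (+ 1) :* (n :+ con (+ 3) :* c :- con (+ 2) :* a)) refl n a c) (x-y≈0 eq)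

  -- The Bézout relations for (c, p) and (3, p) combine to one for (3c, p³).
  bézout-3c : ∀ u w u′ w′ c p → u * c + w * p ≡ + 1 → u′ * + 3 + w′ * p ≡ + 1 →
              ∃₂ λ U W → U * (+ 3 * c) + W * (p * p * p) ≡ + 1
  bézout-3c u w u′ w′ c p eq eq′ =
      U * U * U * b * b + + 3 * (U * U * b * (W * p)) + + 3 * (U * (W * p) * (W * p)) , W * W * W
    , trans (solve 4 (λ U W b p →
        (U :* U :* U :* b :* b :+ con (+ 3) :* (U :* U :* b :* (W :* p)) :+ con (+ 3) :* (U :* (W :* p) :* (W :* p))) :* b
          :+ W :* W :* W :* (p :* p :* p) := (U :* b :+ W :* p) :* (U :* b :+ W :* p) :* (U :* b :+ W :* p)) refl U W b p)
        (cong (λ q → q * q * q) first-power)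
    where
    b = + 3 * c
    U = u * u′
    W = w * (u′ * + 3 + w′ * p) + u * c * w′
    first-power : U * b + W * p ≡ + 1
    first-power = trans (solve 6 (λ u w u′ w′ c p →
        u :* u′ :* (con (+ 3) :* c) :+ (w :* (u′ :* con (+ 3) :+ w′ :* p) :+ u :* c :* w′) :* p
        := (u :* c :+ w :* p) :* (u′ :* con (+ 3) :+ w′ :* p)) refl u w u′ w′ c p) (cong₂ _*_ eq eq′)

  -- If x³ - px + c has square discriminant 4p³ - 27c² = n² and c is prime to p then it
  -- has a root: with n = 2a + 3c, the Eisenstein integer a + 3cω has norm p³.
  square-discriminant⇒root : ∀ {p} → Prime p → p ≢ 3 → ∀ c n → Coprime c (+ p) →
    n * n + + 27 * (c * c) ≡ + 4 * (+ p * + p * + p) → ∃ λ x → x * x * x + - + p * x + c ≡ + 0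
  square-discriminant⇒root {zero} pp with prime⇒nonZero pp
  ... | record { nonZero = () }
  square-discriminant⇒root {suc q} pp p≢3 c n coprime eq =
    from (+ suc q) refl (bézout c (+ suc q) coprime) (bézout (+ 3) (+ suc q) (3-coprime pp p≢3)) eq
    where
    from : ∀ p → p ≡ + suc q →
           (∃₂ λ u w → u * c + w * p ≡ + 1) → (∃₂ λ u w → u * + 3 + w * p ≡ + 1) →
           n * n + + 27 * (c * c) ≡ + 4 * (p * p * p) → ∃ λ x → x * x * x + - + suc q * x + c ≡ + 0
    from p p≡ (u , w , eq₁) (u′ , w′ , eq₂) eq =
      let a , n≡ = half-difference (p * p * p) c n eq
          U , W , bez = bézout-3c u w u′ w′ c p eq₁ eq₂
          (e +ω f) , (r +ω s) , Nε , Nπ , z≡ = cube p q a (+ 3 * c) U W p≡ bez (norm≡ a n≡)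
      in unit-times-cube pp p≢3 e f r s c Nε (trans Nπ p≡) (trans (sym (snd-unit-times-cube e f r s)) (sym (cong snd z≡)))
      where
      norm≡ : ∀ a → n ≡ + 2 * a + + 3 * c → norm (a +ω + 3 * c) ≡ p * p * p
      norm≡ a n≡ = ℤ.*-cancelˡ-≡ (+ 4) (norm (a +ω + 3 * c)) (p * p * p) (trans (solve 2 (λ a c →
        con (+ 4) :* (a :* a :+ a :* (con (+ 3) :* c) :+ con (+ 3) :* c :* (con (+ 3) :* c))
        := (con (+ 2) :* a :+ con (+ 3) :* c) :* (con (+ 2) :* a :+ con (+ 3) :* c) :+ con (+ 27) :* (c :* c)) refl a c)
        (trans (cong (λ m → m * m + + 27 * (c * c)) (sym n≡)) eq))

  square+27square : ∀ n c → n * n + + 27 * (c * c) ≡ + (∣ n ∣ ℕ.* ∣ n ∣ ℕ.+ 27 ℕ.* (∣ c ∣ ℕ.* ∣ c ∣))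
  square+27square n c = cong₂ (λ k l → k + l) (square-abs n)
    (trans (cong (+ 27 *_) (square-abs c)) (sym (ℤ.pos-* 27 (∣ c ∣ ℕ.* ∣ c ∣))))

  4p³ : ∀ p → + 4 * (+ p * + p * + p) ≡ + (4 ℕ.* (p ℕ.* p ℕ.* p))
  4p³ p = trans (cong (+ 4 *_) (trans (cong (_* + p) (sym (ℤ.pos-* p p))) (sym (ℤ.pos-* (p ℕ.* p) p)))) (sym (ℤ.pos-* 4 (p ℕ.* p ℕ.* p)))

  -- If b = p, or if b = -p and p² divides c, the discriminant is negative.
  discriminant-nonsquare : ∀ {p} b c → Prime p → p ≢ 3 → b ≡ + p ⊎ b ≡ - + p →
    (∀ x → x * x * x + b * x + c ≢ + 0) → Coprime c (+ p) ⊎ (+ p) ^ 2 ∣ c →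
    ∀ n → n * n ≢ - (+ 4) * b ^ 3 - + 27 * c ^ 2
  discriminant-nonsquare {zero} b c pp with prime⇒nonZero pp
  ... | record { nonZero = () }
  discriminant-nonsquare {p@(suc q)} b c pp p≢3 (inj₁ refl) noroot h n eq =
    ℕ.1+n≢0 (ℕ.m+n≡0⇒n≡0 (∣ n ∣ ℕ.* ∣ n ∣ ℕ.+ 27 ℕ.* (∣ c ∣ ℕ.* ∣ c ∣)) {4 ℕ.* (p ℕ.* p ℕ.* p)} (ℤ.+-injective (begin
      + (∣ n ∣ ℕ.* ∣ n ∣ ℕ.+ 27 ℕ.* (∣ c ∣ ℕ.* ∣ c ∣)) + + (4 ℕ.* (p ℕ.* p ℕ.* p))
         ≡⟨ cong₂ (λ k l → k + l) (square+27square n c) (4p³ p) ⟨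
      n * n + + 27 * (c * c) + + 4 * (+ p * + p * + p)
         ≡⟨ identity (+ p) eq ⟩
      + 0 ∎)))
    where
    open ≡-Reasoning
    identity : ∀ p → n * n ≡ - (+ 4) * p ^ 3 - + 27 * c ^ 2 → n * n + + 27 * (c * c) + + 4 * (p * p * p) ≡ + 0
    identity p eq = modulo₁ (+ 1) (solve 3 (λ n c p → n :* n :+ con (+ 27) :* (c :* c) :+ con (+ 4) :* (p :* p :* p)
        := con (+ 0) :+ con (+ 1) :* (n :* n :- (con (- + 4) :* (p :* (p :* (p :* con (+ 1)))) :- con (+ 27) :* (c :* (c :* con (+ 1)))))) refl n c p) (x-y≈0 eq)
  discriminant-nonsquare {p@(suc q)} b c pp p≢3 (inj₂ refl) noroot h n eq = cases h
    where
    eq′ : n * n + + 27 * (c * c) ≡ + 4 * (+ p * + p * + p)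
    eq′ = identity (+ p) eq
      where
      identity : ∀ p → n * n ≡ - (+ 4) * (- p) ^ 3 - + 27 * c ^ 2 → n * n + + 27 * (c * c) ≡ + 4 * (p * p * p)
      identity p eq = modulo₁ (+ 1) (solve 3 (λ n c p → n :* n :+ con (+ 27) :* (c :* c)
        := con (+ 4) :* (p :* p :* p) :+ con (+ 1) :* (n :* n :- (con (- + 4) :* (:- p :* (:- p :* (:- p :* con (+ 1)))) :- con (+ 27) :* (c :* (c :* con (+ 1)))))) refl n c p) (x-y≈0 eq)

    cases : Coprime c (+ p) ⊎ (+ p) ^ 2 ∣ c → ⊥
    cases (inj₁ coprime) = let x , root = square-discriminant⇒root pp p≢3 c n coprime eq′ in noroot x root
    cases (inj₂ p²∣c) = ℕ.<⇒≱ {4 ℕ.* P} {27 ℕ.* P} (ℕ.*-monoˡ-< P {4} {27} (ℕ.m≤m+n 5 22)) (begin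
      27 ℕ.* P                              ≤⟨ ℕ.*-monoʳ-≤ 27 (ℕ.m≤m*n P p) ⟩
      27 ℕ.* (P ℕ.* p)                      ≡⟨ cong (27 ℕ.*_) (ℕ.*-assoc (p ℕ.* p) p p) ⟩
      27 ℕ.* (p ℕ.* p ℕ.* (p ℕ.* p))        ≤⟨ ℕ.*-monoʳ-≤ 27 (ℕ.*-mono-≤ p²≤ p²≤) ⟩
      27 ℕ.* (∣ c ∣ ℕ.* ∣ c ∣)              ≤⟨ ℕ.m≤n+m _ (∣ n ∣ ℕ.* ∣ n ∣) ⟩
      ∣ n ∣ ℕ.* ∣ n ∣ ℕ.+ 27 ℕ.* (∣ c ∣ ℕ.* ∣ c ∣) ≡⟨ ℤ.+-injective (trans (sym (square+27square n c)) (trans eq′ (4p³ p))) ⟩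
      4 ℕ.* P                               ∎)
      where
      open ℕ.≤-Reasoning
      P = p ℕ.* p ℕ.* p
      c≢0 : ∣ c ∣ ≢ 0
      c≢0 ∣c∣≡0 = noroot (+ 0) (trans (cong (λ c → + 0 * + 0 * + 0 + - + p * + 0 + c) (ℤ.∣i∣≡0⇒i≡0 ∣c∣≡0)) (solve 1 (λ p → con (+ 0) :* con (+ 0) :* con (+ 0) :+ p :* con (+ 0) :+ con (+ 0) := con (+ 0)) refl (- + p)))
      p²≤ : p ℕ.* p ℕ.≤ ∣ c ∣
      p²≤ = ℕ.∣⇒≤ {{ℕ.≢-nonZero c≢0}} (subst (ℕ._∣ ∣ c ∣) (trans (ℤ.abs-* (+ p) ((+ p) ^ 1)) (cong (p ℕ.*_) (trans (ℤ.abs-* (+ p) (+ 1)) (ℕ.*-identityʳ p)))) p²∣c)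

-- Polynomials and rational roots

module PolynomialCoefficients {a ℓ} (R : CommutativeRing a ℓ) where
  open import Data.List using (List; []; _∷_; map; length)
  open import Defs using (module Polynomial)
  open CommutativeRing R hiding (zero) renaming (refl to ≈-refl; sym to ≈-sym; trans to ≈-trans)
  open Polynomial rawRing
  open Relation.Binary.Reasoning.Setoid setoid
  private module R = IntegerSolver R

  coeff-+ : ∀ f g n → coeff (f +ₚ g) n ≈ coeff f n + coeff g n
  coeff-+ []      g       n       = ≈-sym (+-identityˡ (coeff g n))
  coeff-+ (r ∷ f) []      n       = ≈-sym (+-identityʳ (coeff (r ∷ f) n))
  coeff-+ (r ∷ f) (s ∷ g) zero    = ≈-refl
  coeff-+ (r ∷ f) (s ∷ g) (suc n) = coeff-+ f g n

  coeff-map : ∀ r g n → coeff (map (r *_) g) n ≈ r * coeff g n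
  coeff-map r []      n       = ≈-sym (zeroʳ r)
  coeff-map r (s ∷ g) zero    = ≈-refl
  coeff-map r (s ∷ g) (suc n) = coeff-map r g n

  coeff-∷* : ∀ r f g n → coeff ((r ∷ f) *ₚ g) n ≈ r * coeff g n + coeff (0# ∷ f *ₚ g) n
  coeff-∷* r f g n = ≈-trans (coeff-+ (map (r *_) g) (0# ∷ f *ₚ g) n) (+-congʳ (coeff-map r g n))

  coeff-0* : ∀ f g → (∀ n → coeff f n ≈ 0#) → ∀ n → coeff (f *ₚ g) n ≈ 0#
  coeff-0* []      g f≈0 n = ≈-refl
  coeff-0* (r ∷ f) g f≈0 n = ≈-trans (coeff-∷* r f g n) (≈-trans (+-cong (*-congʳ (f≈0 0)) (shifted n))
      (≈-trans (+-identityʳ (0# * coeff g n)) (zeroˡ (coeff g n))))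
    where
    shifted : ∀ n → coeff (0# ∷ f *ₚ g) n ≈ 0#
    shifted zero    = ≈-refl
    shifted (suc n) = coeff-0* f g (λ n → f≈0 (suc n)) n

  coeff-const* : ∀ r g n → coeff ((r ∷ []) *ₚ g) n ≈ r * coeff g n
  coeff-const* r g n = ≈-trans (coeff-∷* r [] g n) (≈-trans (+-congˡ (shifted n)) (+-identityʳ (r * coeff g n)))
    where
    shifted : ∀ n → coeff (0# ∷ []) n ≈ 0#
    shifted zero    = ≈-refl
    shifted (suc n) = ≈-refl

  coeff-linear*-zero : ∀ r g → coeff ((X- r) *ₚ g) 0 ≈ - r * coeff g 0
  coeff-linear*-zero r g = ≈-trans (coeff-∷* (- r) (1# ∷ []) g 0) (+-identityʳ (- r * coeff g 0))

  coeff-linear*-suc : ∀ r g n → coeff ((X- r) *ₚ g) (suc n) ≈ - r * coeff g (suc n) + coeff g n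
  coeff-linear*-suc r g n = ≈-trans (coeff-∷* (- r) (1# ∷ []) g (suc n))
    (+-congˡ (≈-trans (coeff-const* 1# g n) (*-identityˡ (coeff g n))))

  -- A product of a polynomial and a monic polynomial of degree d has degree
  -- less than d only if the first factor is zero.
  monic-degree : ∀ d h → coeff h d ≈ 1# → (∀ m → d ℕ.< m → coeff h m ≈ 0#) →
                 ∀ g → (∀ m → d ℕ.≤ m → coeff (g *ₚ h) m ≈ 0#) → ∀ n → coeff g n ≈ 0#
  monic-degree d h lead high []      gh n = ≈-refl
  monic-degree d h lead high (r ∷ g) gh = λ { zero → r≈0 ; (suc n) → g≈0 n }
    where
    g≈0 : ∀ n → coeff g n ≈ 0#
    g≈0 = monic-degree d h lead high g (λ m d≤m → begin
      coeff (g *ₚ h) m                             ≈⟨ +-identityˡ (coeff (g *ₚ h) m) ⟨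
      0# + coeff (g *ₚ h) m                        ≈⟨ +-congʳ (≈-trans (*-congˡ (high (suc m) (s≤s d≤m))) (zeroʳ r)) ⟨
      r * coeff h (suc m) + coeff (g *ₚ h) m       ≈⟨ coeff-∷* r g h (suc m) ⟨
      coeff ((r ∷ g) *ₚ h) (suc m)                 ≈⟨ gh (suc m) (ℕ.m≤n⇒m≤1+n d≤m) ⟩
      0#                                           ∎)
    shifted : ∀ n → coeff (0# ∷ g *ₚ h) n ≈ 0#
    shifted zero    = ≈-refl
    shifted (suc n) = coeff-0* g h g≈0 n
    r≈0 : r ≈ 0#
    r≈0 = begin
      r                                            ≈⟨ *-identityʳ r ⟨
      r * 1#                                       ≈⟨ *-congˡ lead ⟨
      r * coeff h d                                ≈⟨ +-identityʳ (r * coeff h d) ⟨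
      r * coeff h d + 0#                           ≈⟨ +-congˡ (shifted d) ⟨
      r * coeff h d + coeff (0# ∷ g *ₚ h) d        ≈⟨ coeff-∷* r g h d ⟨
      coeff ((r ∷ g) *ₚ h) d                       ≈⟨ gh d ℕ.≤-refl ⟩
      0#                                           ∎

  -- A product of n linear factors is monic of degree n.
  ∏-degree : ∀ rs m → length rs ℕ.< m → coeff ∏[X- rs ] m ≈ 0#
  ∏-degree []       (suc m) _         = ≈-refl
  ∏-degree (r ∷ rs) (suc m) (s≤s d<m) = ≈-trans (coeff-linear*-suc r ∏[X- rs ] m)
    (≈-trans (+-cong (≈-trans (*-congˡ (∏-degree rs (suc m) (ℕ.m≤n⇒m≤1+n d<m))) (zeroʳ (- r))) (∏-degree rs m d<m)) (+-identityʳ 0#))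

  ∏-monic : ∀ rs → coeff ∏[X- rs ] (length rs) ≈ 1#
  ∏-monic []       = ≈-refl
  ∏-monic (r ∷ rs) = ≈-trans (coeff-linear*-suc r ∏[X- rs ] (length rs))
    (≈-trans (+-cong (≈-trans (*-congˡ (∏-degree rs (suc (length rs)) ℕ.≤-refl)) (zeroʳ (- r))) (∏-monic rs)) (+-identityˡ 1#))

  -- Vieta's formulas
  vieta : ∀ α β γ → let f = ∏[X- α ∷ β ∷ γ ∷ [] ] in
          coeff f 0 ≈ - (α * β * γ) × coeff f 1 ≈ α * β + β * γ + γ * α × coeff f 2 ≈ - (α + β + γ)
  vieta α β γ =
      (begin
        coeff f₃ 0               ≈⟨ coeff-linear*-zero α f₂ ⟩
        - α * coeff f₂ 0         ≈⟨ *-congˡ f₂0 ⟩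
        - α * (β * γ)            ≈⟨ R.solve 3 (λ α β γ → R.:- α R.:* (β R.:* γ) R.:= R.:- (α R.:* β R.:* γ)) ≈-refl α β γ ⟩
        - (α * β * γ)            ∎)
    , (begin
        coeff f₃ 1                     ≈⟨ coeff-linear*-suc α f₂ 0 ⟩
        - α * coeff f₂ 1 + coeff f₂ 0  ≈⟨ +-cong (*-congˡ f₂1) f₂0 ⟩
        - α * - (β + γ) + β * γ        ≈⟨ R.solve 3 (λ α β γ → R.:- α R.:* R.:- (β R.:+ γ) R.:+ β R.:* γ R.:= α R.:* β R.:+ β R.:* γ R.:+ γ R.:* α) ≈-refl α β γ ⟩
        α * β + β * γ + γ * α          ∎)
    , (begin
        coeff f₃ 2                     ≈⟨ coeff-linear*-suc α f₂ 1 ⟩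
        - α * coeff f₂ 2 + coeff f₂ 1  ≈⟨ +-cong (*-congˡ (∏-monic (β ∷ γ ∷ []))) f₂1 ⟩
        - α * 1# + - (β + γ)           ≈⟨ R.solve 3 (λ α β γ → R.:- α R.:* R.con (+ 1) R.:+ R.:- (β R.:+ γ) R.:= R.:- (α R.:+ β R.:+ γ)) ≈-refl α β γ ⟩
        - (α + β + γ)                  ∎)
    where
    f₁ = ∏[X- γ ∷ [] ]
    f₂ = ∏[X- β ∷ γ ∷ [] ]
    f₃ = ∏[X- α ∷ β ∷ γ ∷ [] ]
    f₁0 : coeff f₁ 0 ≈ - γ
    f₁0 = ≈-trans (coeff-linear*-zero γ (1# ∷ [])) (*-identityʳ (- γ))
    f₂0 : coeff f₂ 0 ≈ β * γ
    f₂0 = begin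
      coeff f₂ 0          ≈⟨ coeff-linear*-zero β f₁ ⟩
      - β * coeff f₁ 0    ≈⟨ *-congˡ f₁0 ⟩
      - β * - γ           ≈⟨ R.solve 2 (λ β γ → R.:- β R.:* R.:- γ R.:= β R.:* γ) ≈-refl β γ ⟩
      β * γ               ∎
    f₂1 : coeff f₂ 1 ≈ - (β + γ)
    f₂1 = begin
      coeff f₂ 1                       ≈⟨ coeff-linear*-suc β f₁ 0 ⟩
      - β * coeff f₁ 1 + coeff f₁ 0    ≈⟨ +-cong (*-congˡ (∏-monic (γ ∷ []))) f₁0 ⟩
      - β * 1# + - γ                   ≈⟨ R.solve 2 (λ β γ → R.:- β R.:* R.con (+ 1) R.:+ R.:- γ R.:= R.:- (β R.:+ γ)) ≈-refl β γ ⟩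
      - (β + γ)                        ∎

module RationalRoots where
  import Algebra.Definitions.RawMagma as RawMagma
  open import Data.Integer using (∣_∣)
  open import Data.List using ([]; _∷_)
  import Data.Nat.Coprimality as ℕ
  import Data.Nat.Divisibility as ℕ
  open import Data.Rational as ℚ using (ℚ; mkℚ; 0ℚ; 1ℚ; _+_; _*_; -_)
  import Data.Rational.Properties as ℚ
  import Data.Rational.Unnormalised as ℚᵘ
  import Data.Rational.Unnormalised.Properties as ℚᵘ
  open import Defs using (module Polynomial; ℚ[X]; fromℤ; X³+_X+_)
  open import Algebra.Definitions.RawSemiring ℚ[X] using (Irreducible; _∤_)
  open ≡ using (refl; sym; trans; cong; cong₂; module ≡-Reasoning)
  module ℚ-Solver = IntegerSolver ℚ.+-*-commutativeRing

  open Polynomial ℚ.+-*-rawRing using (Poly; coeff; _*ₚ_; _≈ₚ_)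
  open PolynomialCoefficients ℚ.+-*-commutativeRing using (coeff-0*; monic-degree)
  open ℚ-Solver using (solve; _:=_; _:+_; _:*_; :-_; con; modulo₁)

  -- A monic polynomial of positive degree is not a unit.
  monic-∤1 : ∀ d h → coeff h (suc d) ≡ 1ℚ → (∀ m → suc d ℕ.< m → coeff h m ≡ 0ℚ) → h ∤ (1ℚ ∷ [])
  monic-∤1 d h lead high (g RawMagma., gh≈1) = 1≢0 (trans (sym (gh≈1 0)) (coeff-0* g h g≈0 0))
    where
    1≢0 : 1ℚ ≢ 0ℚ
    1≢0 ()
    g≈0 : ∀ n → coeff g n ≡ 0ℚ
    g≈0 = monic-degree (suc d) h lead high g (λ { (suc m) _ → gh≈1 (suc m) })

  -- A root q would give the factorisation (x - q)(x² + qx + q² + b).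
  irreducible⇒no-root : ∀ b c → Irreducible (X³+ b X+ c) → ∀ q → q * q * q + fromℤ b * q + fromℤ c ≢ 0ℚ
  irreducible⇒no-root b c irr q f[q]≡0 =
    [ monic-∤1 0 linear refl (λ { (suc (suc m)) _ → refl ; (suc zero) (s≤s ()) })
    , monic-∤1 1 quadratic refl (λ { (suc (suc (suc m))) _ → refl ; (suc (suc zero)) (s≤s (s≤s ())) ; (suc zero) (s≤s ()) }) ]′
    (Irreducible.split-∣1 irr {linear} {quadratic} factors)
    where
    linear quadratic : Poly
    linear    = - q ∷ 1ℚ ∷ []
    quadratic = q * q + fromℤ b ∷ q ∷ 1ℚ ∷ []
    factors : X³+ b X+ c ≈ₚ linear *ₚ quadratic
    factors 0 = modulo₁ 1ℚ (solve 3 (λ q b c → c := :- q :* (q :* q :+ b) :+ con (+ 0) :+ con (+ 1) :* (q :* q :* q :+ b :* q :+ c)) refl q (fromℤ b) (fromℤ c)) f[q]≡0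
    factors 1 = solve 2 (λ q b → b := :- q :* q :+ (con (+ 1) :* (q :* q :+ b) :+ con (+ 0))) refl q (fromℤ b)
    factors 2 = solve 1 (λ q → con (+ 0) := :- q :* con (+ 1) :+ con (+ 1) :* q) refl q
    factors 3 = refl
    factors (suc (suc (suc (suc n)))) = refl

  -- The normal form of n / 1
  fromℤ≡ : ∀ n → fromℤ n ≡ mkℚ n 0 (ℕ.sym (ℕ.1-coprimeTo ∣ n ∣))
  fromℤ≡ n = ℚ.↥p/↧p≡p (mkℚ n 0 (ℕ.sym (ℕ.1-coprimeTo ∣ n ∣)))

  fromℤ-+ : ∀ m n → fromℤ (m ℤ.+ n) ≡ fromℤ m + fromℤ n
  fromℤ-+ m n rewrite fromℤ≡ m | fromℤ≡ n | ℤ.*-identityʳ m | ℤ.*-identityʳ n = refl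

  fromℤ-* : ∀ m n → fromℤ (m ℤ.* n) ≡ fromℤ m * fromℤ n
  fromℤ-* m n rewrite fromℤ≡ m | fromℤ≡ n = refl

  -- The denominator of q divides the square of its numerator.
  rational-square⇒integer-square : ∀ δ q → q * q ≡ fromℤ δ → ∃ λ n → n ℤ.* n ≡ δ
  rational-square⇒integer-square δ q@(mkℚ n d-1 coprime) q²≡δ = n , n²≡δ
    where
    d = suc d-1
    coprime′ : ℕ.Coprime ∣ n ∣ d
    coprime′ = ℕ.recompute coprime
    n²≡δd² : n ℤ.* n ≡ δ ℤ.* (+ d ℤ.* + d)
    n²≡δd² with ℚᵘ.≃-trans (ℚᵘ.≃-sym (ℚ.toℚᵘ-homo-* q q)) (ℚ.toℚᵘ-cong (trans q²≡δ (fromℤ≡ δ)))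
    ... | ℚᵘ.*≡* eq = trans (sym (ℤ.*-identityʳ (n ℤ.* n))) (trans eq (cong (δ ℤ.*_) (ℤ.pos-* d d)))
    d∣n² : d ℕ.∣ ∣ n ∣ ℕ.* ∣ n ∣
    d∣n² = ℕ.divides (∣ δ ∣ ℕ.* d) (trans (sym (ℤ.abs-* n n)) (trans (cong ∣_∣ n²≡δd²)
      (trans (ℤ.abs-* δ (+ d ℤ.* + d)) (trans (cong (∣ δ ∣ ℕ.*_) (ℤ.abs-* (+ d) (+ d))) (sym (ℕ.*-assoc ∣ δ ∣ d d))))))
    d≡1 : d ≡ 1
    d≡1 = coprime′ (ℕ.coprime-divisor (ℕ.sym coprime′) d∣n² , ℕ.∣-refl)
    n²≡δ : n ℤ.* n ≡ δ
    n²≡δ = trans n²≡δd² (trans (cong (λ d → δ ℤ.* (+ d ℤ.* + d)) d≡1) (ℤ.*-identityʳ δ))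

  irreducible⇒no-integer-root : ∀ b c → Irreducible (X³+ b X+ c) → ∀ x → x ℤ.* x ℤ.* x ℤ.+ b ℤ.* x ℤ.+ c ≢ + 0
  irreducible⇒no-integer-root b c irr x eq = irreducible⇒no-root b c irr (fromℤ x) (begin
    fromℤ x * fromℤ x * fromℤ x + fromℤ b * fromℤ x + fromℤ c
      ≡⟨ cong₂ (λ k l → k * fromℤ x + l + fromℤ c) (fromℤ-* x x) (fromℤ-* b x) ⟨
    fromℤ (x ℤ.* x) * fromℤ x + fromℤ (b ℤ.* x) + fromℤ c
      ≡⟨ cong (λ k → k + fromℤ (b ℤ.* x) + fromℤ c) (fromℤ-* (x ℤ.* x) x) ⟨
    fromℤ (x ℤ.* x ℤ.* x) + fromℤ (b ℤ.* x) + fromℤ c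
      ≡⟨ cong (_+ fromℤ c) (fromℤ-+ (x ℤ.* x ℤ.* x) (b ℤ.* x)) ⟨
    fromℤ (x ℤ.* x ℤ.* x ℤ.+ b ℤ.* x) + fromℤ c
      ≡⟨ fromℤ-+ (x ℤ.* x ℤ.* x ℤ.+ b ℤ.* x) c ⟨
    fromℤ (x ℤ.* x ℤ.* x ℤ.+ b ℤ.* x ℤ.+ c)  ≡⟨ cong fromℤ eq ⟩
    0ℚ ∎)
    where open ≡-Reasoning

-- The ring of real numbers

module RealNumbers where
  open import Data.Rational as ℚ using (ℚ; 0ℚ; 1ℚ; ½; _+_; _*_; _-_; -_; _<_; _≤_; ∣_∣; 1/_)
  import Data.Rational.Properties as ℚ
  open import Defs using (ℝ; module ℝ; _≈ᵣ_)
  open ≡ using (refl; sym; trans; cong; cong₂; subst)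
  private
    module ℚS = IntegerSolver ℚ.+-*-commutativeRing

  half-positive : ∀ {ε} → 0ℚ < ε → 0ℚ < ½ * ε
  half-positive {ε} 0<ε = ℚ.positive⁻¹ (½ * ε) {{ℚ.pos*pos⇒pos ½ ε {{ℚ.positive 0<ε}}}}

  halves : ∀ ε → ½ * ε + ½ * ε ≡ ε
  halves ε = trans (sym (ℚ.*-distribʳ-+ ε ½ ½)) (ℚ.*-identityˡ ε)

  -- An equality of real numbers that holds term by term.
  pointwise : ∀ {x y : ℝ} → (∀ n → proj₁ x n ≡ proj₁ y n) → x ≈ᵣ y
  pointwise {x , _} {y , _} eq ε 0<ε = 0 , λ {n} _ → subst (_< ε) (cong ∣_∣ (sym (trans (cong (_- y n) (eq n)) (ℚ.+-inverseʳ (y n))))) 0<ε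

  ≈ᵣ-sym : ∀ {x y : ℝ} → x ≈ᵣ y → y ≈ᵣ x
  ≈ᵣ-sym {x , _} {y , _} h ε 0<ε = let N , close = h ε 0<ε in N , λ {n} N≤n →
    subst (_< ε) (trans (sym (ℚ.∣-p∣≡∣p∣ (x n - y n))) (cong ∣_∣ (ℚS.solve 2 (λ x y → ℚS.:- (x ℚS.:- y) ℚS.:= y ℚS.:- x) refl (x n) (y n)))) (close N≤n)

  sum-close : ∀ {ε} (p q : ℕ → ℚ) → (∃ λ N → ∀ {n} → N ℕ.≤ n → ∣ p n ∣ < ½ * ε) → (∃ λ N → ∀ {n} → N ℕ.≤ n → ∣ q n ∣ < ½ * ε) →
              ∃ λ N → ∀ {n} → N ℕ.≤ n → ∣ p n + q n ∣ < ε
  sum-close {ε} p q (M , h) (N , k) = M ℕ.⊔ N , λ {n} l → begin-strict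
      ∣ p n + q n ∣       ≤⟨ ℚ.∣p+q∣≤∣p∣+∣q∣ (p n) (q n) ⟩
      ∣ p n ∣ + ∣ q n ∣   <⟨ ℚ.+-mono-< (h (ℕ.m⊔n≤o⇒m≤o M N l)) (k (ℕ.m⊔n≤o⇒n≤o M N l)) ⟩
      ½ * ε + ½ * ε       ≡⟨ halves ε ⟩
      ε                   ∎
    where open ℚ.≤-Reasoning

  close-cong : ∀ {ε} (p q : ℕ → ℚ) → (∀ n → p n ≡ q n) → (∃ λ N → ∀ {n} → N ℕ.≤ n → ∣ p n ∣ < ε) → ∃ λ N → ∀ {n} → N ℕ.≤ n → ∣ q n ∣ < ε
  close-cong {ε} p q eq (N , h) = N , λ {n} l → subst (λ x → ∣ x ∣ < ε) (eq n) (h l)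

  ≈ᵣ-trans : ∀ {x y z : ℝ} → x ≈ᵣ y → y ≈ᵣ z → x ≈ᵣ z
  ≈ᵣ-trans {x , _} {y , _} {z , _} h k ε 0<ε = close-cong _ (λ n → x n - z n)
    (λ n → ℚS.solve 3 (λ x y z → (x ℚS.:- y) ℚS.:+ (y ℚS.:- z) ℚS.:= x ℚS.:- z) refl (x n) (y n) (z n))
    (sum-close (λ n → x n - y n) (λ n → y n - z n) (h (½ * ε) (half-positive 0<ε)) (k (½ * ε) (half-positive 0<ε)))

  +-cong-ᵣ : ∀ {x x′ y y′ : ℝ} → x ≈ᵣ x′ → y ≈ᵣ y′ → (x ℝ.+ y) ≈ᵣ (x′ ℝ.+ y′)
  +-cong-ᵣ {x , _} {x′ , _} {y , _} {y′ , _} h k ε 0<ε = close-cong _ (λ n → x n + y n - (x′ n + y′ n))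
    (λ n → ℚS.solve 4 (λ x x′ y y′ → (x ℚS.:- x′) ℚS.:+ (y ℚS.:- y′) ℚS.:= x ℚS.:+ y ℚS.:- (x′ ℚS.:+ y′)) refl (x n) (x′ n) (y n) (y′ n))
    (sum-close (λ n → x n - x′ n) (λ n → y n - y′ n) (h (½ * ε) (half-positive 0<ε)) (k (½ * ε) (half-positive 0<ε)))

  neg-cong-ᵣ : ∀ {x y : ℝ} → x ≈ᵣ y → (ℝ.- x) ≈ᵣ (ℝ.- y)
  neg-cong-ᵣ {x , _} {y , _} h ε 0<ε = let N , close = h ε 0<ε in N , λ {n} N≤n →
    subst (_< ε) (trans (sym (ℚ.∣-p∣≡∣p∣ (x n - y n))) (cong ∣_∣ (ℚ.neg-distrib-+ (x n) (- y n)))) (close N≤n)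

  bounded : ∀ (x : ℝ) → ∃₂ λ B N → 0ℚ < B × (∀ {n} → N ℕ.≤ n → ∣ proj₁ x n ∣ ≤ B)
  bounded (x , cx) = let N , h = cx 1ℚ (ℚ.positive⁻¹ 1ℚ) in
    ∣ x N ∣ + 1ℚ , N , ℚ.+-mono-≤-< (ℚ.0≤∣p∣ (x N)) (ℚ.positive⁻¹ 1ℚ) , λ {n} l → begin
      ∣ x n ∣                   ≡⟨ cong ∣_∣ (ℚS.solve 2 (λ p q → p ℚS.:= q ℚS.:+ (p ℚS.:- q)) refl (x n) (x N)) ⟩
      ∣ x N + (x n - x N) ∣     ≤⟨ ℚ.∣p+q∣≤∣p∣+∣q∣ (x N) (x n - x N) ⟩
      ∣ x N ∣ + ∣ x n - x N ∣   ≤⟨ ℚ.+-monoʳ-≤ ∣ x N ∣ (ℚ.<⇒≤ (h l ℕ.≤-refl)) ⟩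
      ∣ x N ∣ + 1ℚ              ∎
    where open ℚ.≤-Reasoning

  -- A bounded sequence times one that tends to zero tends to zero.
  product-close : ∀ (x : ℝ) (q : ℕ → ℚ) → (∀ ε → 0ℚ < ε → ∃ λ N → ∀ {n} → N ℕ.≤ n → ∣ q n ∣ < ε) →
                  ∀ ε → 0ℚ < ε → ∃ λ N → ∀ {n} → N ℕ.≤ n → ∣ proj₁ x n * q n ∣ < ε
  product-close x q h ε 0<ε = from (bounded x)
    where
    open ℚ.≤-Reasoning
    from : (∃₂ λ B N → 0ℚ < B × (∀ {n} → N ℕ.≤ n → ∣ proj₁ x n ∣ ≤ B)) → ∃ λ N → ∀ {n} → N ℕ.≤ n → ∣ proj₁ x n * q n ∣ < ε
    from (B , M , 0<B , bx) = M ℕ.⊔ proj₁ hη , λ {n} l → begin-strict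
        ∣ proj₁ x n * q n ∣      ≡⟨ ℚ.∣p*q∣≡∣p∣*∣q∣ (proj₁ x n) (q n) ⟩
        ∣ proj₁ x n ∣ * ∣ q n ∣  ≤⟨ ℚ.*-monoʳ-≤-nonNeg ∣ q n ∣ {{ℚ.nonNegative (ℚ.0≤∣p∣ (q n))}} (bx (ℕ.m⊔n≤o⇒m≤o M (proj₁ hη) l)) ⟩
        B * ∣ q n ∣              <⟨ ℚ.*-monoʳ-<-pos B (proj₂ hη (ℕ.m⊔n≤o⇒n≤o M (proj₁ hη) l)) ⟩
        B * η                    ≡⟨ trans (sym (ℚ.*-assoc B (1/ B) ε)) (trans (cong (_* ε) (ℚ.*-inverseʳ B)) (ℚ.*-identityˡ ε)) ⟩
        ε                        ∎
      where
      instance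
        _ = ℚ.positive 0<B
        _ = ℚ.positive 0<ε
        _ = ℚ.pos⇒nonZero B
        _ = ℚ.1/pos⇒pos B
        _ = ℚ.pos*pos⇒pos (1/ B) ε
      η = 1/ B * ε
      hη = h η (ℚ.positive⁻¹ η)

  *-cong-ᵣ : ∀ {x x′ y y′ : ℝ} → x ≈ᵣ x′ → y ≈ᵣ y′ → (x ℝ.* y) ≈ᵣ (x′ ℝ.* y′)
  *-cong-ᵣ {x@(a , _)} {a′ , _} {b , _} {y′@(b′ , _)} h k ε 0<ε = close-cong _ (λ n → a n * b n - a′ n * b′ n)
    (λ n → ℚS.solve 4 (λ a a′ b b′ → a ℚS.:* (b ℚS.:- b′) ℚS.:+ b′ ℚS.:* (a ℚS.:- a′) ℚS.:= a ℚS.:* b ℚS.:- a′ ℚS.:* b′) refl (a n) (a′ n) (b n) (b′ n))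
    (sum-close (λ n → a n * (b n - b′ n)) (λ n → b′ n * (a n - a′ n)) (product-close x (λ n → b n - b′ n) k (½ * ε) (half-positive 0<ε))
       (product-close y′ (λ n → a n - a′ n) h (½ * ε) (half-positive 0<ε)))

  ℝ-ring : CommutativeRing 0ℓ 0ℓ
  ℝ-ring = record
    { Carrier = ℝ ; _≈_ = _≈ᵣ_ ; _+_ = ℝ._+_ ; _*_ = ℝ._*_ ; -_ = ℝ.-_ ; 0# = ℝ.0# ; 1# = ℝ.1#
    ; isCommutativeRing = record
      { isRing = record
        { +-isAbelianGroup = record
          { isGroup = record
            { isMonoid = record
              { isSemigroup = record
                { isMagma = record
                  { isEquivalence = record { refl = λ {x} → pointwise {x} {x} (λ _ → refl) ; sym = λ {x} {y} → ≈ᵣ-sym {x} {y} ; trans = λ {x} {y} {z} → ≈ᵣ-trans {x} {y} {z} }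
                  ; ∙-cong = λ {x} {x′} {y} {y′} → +-cong-ᵣ {x} {x′} {y} {y′} }
                ; assoc = λ x y z → pointwise {x ℝ.+ y ℝ.+ z} {x ℝ.+ (y ℝ.+ z)} (λ n → ℚ.+-assoc (proj₁ x n) (proj₁ y n) (proj₁ z n)) }
              ; identity = (λ x → pointwise {ℝ.0# ℝ.+ x} {x} (λ n → ℚ.+-identityˡ (proj₁ x n)))
                         , (λ x → pointwise {x ℝ.+ ℝ.0#} {x} (λ n → ℚ.+-identityʳ (proj₁ x n))) }
            ; inverse = (λ x → pointwise {ℝ.- x ℝ.+ x} {ℝ.0#} (λ n → ℚ.+-inverseˡ (proj₁ x n)))
                      , (λ x → pointwise {x ℝ.+ ℝ.- x} {ℝ.0#} (λ n → ℚ.+-inverseʳ (proj₁ x n)))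
            ; ⁻¹-cong = λ {x} {y} → neg-cong-ᵣ {x} {y} }
          ; comm = λ x y → pointwise {x ℝ.+ y} {y ℝ.+ x} (λ n → ℚ.+-comm (proj₁ x n) (proj₁ y n)) }
        ; *-cong = λ {x} {x′} {y} {y′} → *-cong-ᵣ {x} {x′} {y} {y′}
        ; *-assoc = λ x y z → pointwise {x ℝ.* y ℝ.* z} {x ℝ.* (y ℝ.* z)} (λ n → ℚ.*-assoc (proj₁ x n) (proj₁ y n) (proj₁ z n))
        ; *-identity = (λ x → pointwise {ℝ.1# ℝ.* x} {x} (λ n → ℚ.*-identityˡ (proj₁ x n)))
                     , (λ x → pointwise {x ℝ.* ℝ.1#} {x} (λ n → ℚ.*-identityʳ (proj₁ x n)))
        ; distrib = (λ x y z → pointwise {x ℝ.* (y ℝ.+ z)} {x ℝ.* y ℝ.+ x ℝ.* z} (λ n → ℚ.*-distribˡ-+ (proj₁ x n) (proj₁ y n) (proj₁ z n)))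
                  , (λ x y z → pointwise {(y ℝ.+ z) ℝ.* x} {y ℝ.* x ℝ.+ z ℝ.* x} (λ n → ℚ.*-distribʳ-+ (proj₁ x n) (proj₁ y n) (proj₁ z n)))
        }
      ; *-comm = λ x y → pointwise {x ℝ.* y} {y ℝ.* x} (λ n → ℚ.*-comm (proj₁ x n) (proj₁ y n))
      }
    }

  ∣p∣*∣p∣≡p*p : ∀ p → ∣ p ∣ * ∣ p ∣ ≡ p * p
  ∣p∣*∣p∣≡p*p p = [ (λ eq → cong₂ _*_ eq eq) , (λ eq → trans (cong₂ _*_ eq eq) (ℚS.solve 1 (λ p → ℚS.:- p ℚS.:* ℚS.:- p ℚS.:= p ℚS.:* p) refl p)) ]′ (ℚ.∣p∣≡p∨∣p∣≡-p p)

  0≤p*p : ∀ p → 0ℚ ≤ p * p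
  0≤p*p p = subst (0ℚ ≤_) (trans (ℚ.∣p*q∣≡∣p∣*∣q∣ p p) (∣p∣*∣p∣≡p*p p)) (ℚ.0≤∣p∣ (p * p))

  -- Squares are nonnegative, so the terms of a vanishing sum of two squares vanish.
  squares-vanish : ∀ (x y : ℝ) → (x ℝ.* x ℝ.+ y ℝ.* y) ≈ᵣ ℝ.0# → x ≈ᵣ ℝ.0#
  squares-vanish (x , _) (y , _) h ε 0<ε = let N , close = h (ε * ε) (ℚ.positive⁻¹ (ε * ε) {{ℚ.pos*pos⇒pos ε ε}}) in
    N , λ {n} l → ℚ.≰⇒> λ ε≤ → ℚ.<-irrefl {ε * ε} refl (begin-strict
      ε * ε                                ≤⟨ ℚ.*-monoʳ-≤-nonNeg ε ε≤ ⟩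
      ∣ x n - 0ℚ ∣ * ε                     ≤⟨ ℚ.*-monoˡ-≤-nonNeg ∣ x n - 0ℚ ∣ {{ℚ.nonNegative (ℚ.0≤∣p∣ (x n - 0ℚ))}} ε≤ ⟩
      ∣ x n - 0ℚ ∣ * ∣ x n - 0ℚ ∣          ≡⟨ ∣p∣*∣p∣≡p*p (x n - 0ℚ) ⟩
      (x n - 0ℚ) * (x n - 0ℚ)              ≡⟨ cong₂ _*_ (ℚ.+-identityʳ (x n)) (ℚ.+-identityʳ (x n)) ⟩
      x n * x n                            ≡⟨ ℚ.+-identityʳ (x n * x n) ⟨
      x n * x n + 0ℚ                       ≤⟨ ℚ.+-monoʳ-≤ (x n * x n) (0≤p*p (y n)) ⟩
      x n * x n + y n * y n                ≡⟨ ℚ.0≤p⇒∣p∣≡p (ℚ.+-mono-≤ (0≤p*p (x n)) (0≤p*p (y n))) ⟨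
      ∣ x n * x n + y n * y n ∣            ≡⟨ cong ∣_∣ (ℚ.+-identityʳ (x n * x n + y n * y n)) ⟨
      ∣ x n * x n + y n * y n - 0ℚ ∣       <⟨ close l ⟩
      ε * ε                                ∎)
    where
    open ℚ.≤-Reasoning
    instance
      _ = ℚ.positive 0<ε
      _ = ℚ.pos⇒nonNeg ε

-- Quadratic extensions

-- Arithmetic in a Heyting field, where being invertible is being apart from zero
module FieldTheory {c ℓ₁ ℓ₂} (L : HeytingField c ℓ₁ ℓ₂) where
  import Algebra.Apartness.Properties.HeytingCommutativeRing as HCR
  open HeytingField L public using (Carrier; _≈_; _#_; _+_; _*_; -_; 0#; 1#; #⇒invertible; tight)
  ring : CommutativeRing c ℓ₁
  ring = HeytingCommutativeRing.commutativeRing (HeytingField.heytingCommutativeRing L)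
  open CommutativeRing ring public using (_-_; setoid; refl; sym; trans; +-cong; +-congˡ; +-congʳ; *-cong; *-congˡ; *-congʳ; -‿cong
    ; +-identityˡ; +-identityʳ; *-identityˡ; *-identityʳ; zeroˡ; zeroʳ; *-comm; *-assoc; reflexive)
  open IntegerSolver ring public
  open HCR (HeytingField.heytingCommutativeRing L) public using (1#0; x#0y#0→xy#0; #-congʳ; x-0≈x; invertibleʳ⇒#)
  open Relation.Binary.Reasoning.Setoid setoid

  private variable x y z : Carrier

  #0⇒inverse : x # 0# → ∃ λ y → x * y ≈ 1#
  #0⇒inverse {x} x#0 with #⇒invertible x#0
  ... | y , _ , xy≈1 = y , trans (*-congʳ (sym (x-0≈x x))) xy≈1

  inverse⇒#0 : x * y ≈ 1# → x # 0#
  inverse⇒#0 {x} {y} xy≈1 = invertibleʳ⇒# (y , trans (*-congʳ (x-0≈x x)) xy≈1)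

  #0⇒≉0 : x # 0# → ¬ x ≈ 0#
  #0⇒≉0 {x} x#0 x≈0 = proj₂ (tight x 0#) x≈0 x#0

  ≉0⇒¬¬#0 : ¬ x ≈ 0# → ¬ ¬ x # 0#
  ≉0⇒¬¬#0 {x} x≉0 ¬x#0 = x≉0 (proj₁ (tight x 0#) ¬x#0)

  1≉0 : ¬ 1# ≈ 0#
  1≉0 = #0⇒≉0 1#0

  cancel-inverse : x * y ≈ 1# → x * z ≈ 0# → z ≈ 0#
  cancel-inverse {x} {y} {z} xy≈1 xz≈0 = modulo₂ z y eq (x-y≈0 (sym xy≈1)) (xz≈0)
    where
    eq : z ≈ 0# + z * (1# - x * y) + y * (x * z)
    eq = solve 3 (λ x y z → z := con (+ 0) :+ z :* (con (+ 1) :- x :* y) :+ y :* (x :* z)) refl x y z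

  -- A nonzero element need not be apart from zero, but it is not not so.
  noZeroDivisors : x * y ≈ 0# → ¬ x ≈ 0# → ¬ y ≈ 0# → ⊥
  noZeroDivisors xy≈0 x≉0 y≉0 = ≉0⇒¬¬#0 x≉0 λ x#0 → y≉0 (cancel-inverse (proj₂ (#0⇒inverse x#0)) xy≈0)

  -- A subfield in which each element is zero or invertible. It contains the integers.
  record DiscreteSubfield {k} (K : Pred Carrier k) : Set (c ⊔ ℓ₁ ⊔ k) where
    field
      resp  : x ≈ y → K x → K y
      int∈  : ∀ n → K (int n)
      +∈    : K x → K y → K (x + y)
      *∈    : K x → K y → K (x * y)
      -∈    : K x → K (- x)
      zero? : K x → x ≈ 0# ⊎ ∃ λ y → K y × x * y ≈ 1#

    noZero : K x → x * y ≈ 0# → x ≈ 0# ⊎ y ≈ 0#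
    noZero x∈ xy≈0 with zero? x∈
    ... | inj₁ x≈0 = inj₁ x≈0
    ... | inj₂ (_ , _ , xx⁻¹≈1) = inj₂ (cancel-inverse xx⁻¹≈1 xy≈0)

  -- The quadratic extension F[s] of F by a square root s of a nonsquare d
  module Quadratic {k} {F : Pred Carrier k} (F-subfield : DiscreteSubfield F)
                   {d s : Carrier} (d∈ : F d) (s²≈d : s * s ≈ d) (nonsquare : ∀ {u} → F u → ¬ u * u ≈ d) where
    open DiscreteSubfield F-subfield

    F[s] : Pred Carrier (c ⊔ ℓ₁ ⊔ k)
    F[s] x = ∃₂ λ u v → F u × F v × x ≈ u + v * s

    u²≉v²d : ∀ {u v w} → F u → F w → v * w ≈ 1# → ¬ u * u - v * v * d ≈ 0#
    u²≉v²d {u} {v} {w} u∈ w∈ vw≈1 eq = nonsquare (*∈ u∈ w∈) (modulo₂ (w * w) (d * (v * w + 1#))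
      (solve 4 (λ u v w d → (u :* w) :* (u :* w) := d :+ w :* w :* (u :* u :- v :* v :* d)
         :+ d :* (v :* w :+ con (+ 1)) :* (v :* w :- con (+ 1))) refl u v w d) eq (x-y≈0 vw≈1))

    -- The norm of u + vs vanishes only at zero.
    norm-zero : ∀ {u v} → F u → F v → u * u - v * v * d ≈ 0# → u ≈ 0# × v ≈ 0#
    norm-zero {u} {v} u∈ v∈ eq with zero? v∈
    ... | inj₂ (w , w∈ , vw≈1) = ⊥-elim (u²≉v²d u∈ w∈ vw≈1 eq)
    ... | inj₁ v≈0 = [ (λ h → h) , (λ h → h) ]′ (noZero u∈ (modulo₂ 1# (v * d)
        (solve 3 (λ u v d → u :* u := con (+ 0) :+ con (+ 1) :* (u :* u :- v :* v :* d) :+ v :* d :* v) refl u v d) eq v≈0)) , v≈0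

    independent : ∀ {u v} → F u → F v → u + v * s ≈ 0# → u ≈ 0# × v ≈ 0#
    independent {u} {v} u∈ v∈ eq = norm-zero u∈ v∈ (modulo₂ (u - v * s) (v * v)
      (solve 4 (λ u v s d → u :* u :- v :* v :* d := con (+ 0) :+ (u :- v :* s) :* (u :+ v :* s) :+ v :* v :* (s :* s :- d)) refl u v s d)
      eq (x-y≈0 s²≈d))

    F[s]-subfield : DiscreteSubfield F[s]
    F[s]-subfield = record
      { resp  = λ { x≈y (u , v , u∈ , v∈ , eq) → u , v , u∈ , v∈ , trans (sym x≈y) eq }
      ; int∈  = λ n → int n , 0# , int∈ n , int∈ (+ 0) , solve 2 (λ n s → n := n :+ con (+ 0) :* s) refl (int n) s
      ; +∈    = λ { (u , v , u∈ , v∈ , eq) (u′ , v′ , u′∈ , v′∈ , eq′) → u + u′ , v + v′ , +∈ u∈ u′∈ , +∈ v∈ v′∈ ,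
                  trans (+-cong eq eq′) (solve 5 (λ u v u′ v′ s → u :+ v :* s :+ (u′ :+ v′ :* s) := u :+ u′ :+ (v :+ v′) :* s) refl u v u′ v′ s) }
      ; *∈    = λ { (u , v , u∈ , v∈ , eq) (u′ , v′ , u′∈ , v′∈ , eq′) → u * u′ + v * v′ * d , u * v′ + v * u′ ,
                  +∈ (*∈ u∈ u′∈) (*∈ (*∈ v∈ v′∈) d∈) , +∈ (*∈ u∈ v′∈) (*∈ v∈ u′∈) ,
                  trans (*-cong eq eq′) (modulo₁ (v * v′) (solve 6 (λ u v u′ v′ s d → (u :+ v :* s) :* (u′ :+ v′ :* s)
                     := u :* u′ :+ v :* v′ :* d :+ (u :* v′ :+ v :* u′) :* s :+ v :* v′ :* (s :* s :- d)) refl u v u′ v′ s d) (x-y≈0 s²≈d)) }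
      ; -∈    = λ { (u , v , u∈ , v∈ , eq) → - u , - v , -∈ u∈ , -∈ v∈ ,
                  trans (-‿cong eq) (solve 3 (λ u v s → :- (u :+ v :* s) := :- u :+ :- v :* s) refl u v s) }
      ; zero? = λ { (u , v , u∈ , v∈ , eq) → dec u∈ v∈ eq (zero? (+∈ (*∈ u∈ u∈) (-∈ (*∈ (*∈ v∈ v∈) d∈)))) }
      }
      where
      dec : ∀ {x u v} → F u → F v → x ≈ u + v * s → u * u - v * v * d ≈ 0# ⊎ (∃ λ y → F y × (u * u - v * v * d) * y ≈ 1#) →
            x ≈ 0# ⊎ ∃ λ y → F[s] y × x * y ≈ 1#
      dec {x} {u} {v} u∈ v∈ eq (inj₁ N≈0) = let u≈0 , v≈0 = norm-zero u∈ v∈ N≈0 in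
        inj₁ (trans eq (modulo₂ 1# s (solve 3 (λ u v s → u :+ v :* s := con (+ 0) :+ con (+ 1) :* u :+ s :* v) refl u v s) u≈0 v≈0))
      dec {x} {u} {v} u∈ v∈ eq (inj₂ (y , y∈ , Ny≈1)) = inj₂ (u * y + - v * y * s ,
        (u * y , - v * y , *∈ u∈ y∈ , *∈ (-∈ v∈) y∈ , refl) ,
        trans (*-congʳ eq) (modulo₂ 1# (- (v * v * y)) (solve 5 (λ u v s y d →
            (u :+ v :* s) :* (u :* y :+ :- v :* y :* s) := con (+ 1) :+ con (+ 1) :* ((u :* u :- v :* v :* d) :* y :- con (+ 1))
              :+ :- (v :* v :* y) :* (s :* s :- d)) refl u v s y d) (x-y≈0 Ny≈1) (x-y≈0 s²≈d)))

    -- If r = u + vs with v ≠ 0 is a root of x³ + bx + c over F, then so is -2u, the third root.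
    no-root : ∀ {b c} → F b → F c → (∀ {r} → F r → ¬ r * r * r + b * r + c ≈ 0#) →
              ∀ {r} → F[s] r → ¬ r * r * r + b * r + c ≈ 0#
    no-root {b} {c} b∈ c∈ no-root-F {r} (u , v , u∈ , v∈ , eq) root = [ rational , irrational ]′ (zero? v∈)
      where
      E₁ E₂ : Carrier
      E₁ = u * u * u + int (+ 3) * u * (v * v) * d + b * u + c
      E₂ = int (+ 3) * u * u + v * v * d + b
      parts : E₁ ≈ 0# × v * E₂ ≈ 0#
      parts = independent (+∈ (+∈ (+∈ (*∈ (*∈ u∈ u∈) u∈) (*∈ (*∈ (*∈ (int∈ (+ 3)) u∈) (*∈ v∈ v∈)) d∈)) (*∈ b∈ u∈)) c∈)
        (*∈ v∈ (+∈ (+∈ (*∈ (*∈ (int∈ (+ 3)) u∈) u∈) (*∈ (*∈ v∈ v∈) d∈)) b∈))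
        (modulo₂ 1# (- (int (+ 3) * u * (v * v) + v * v * v * s)) (solve 6 (λ u v s d b c → let r = u :+ v :* s in
          u :* u :* u :+ con (+ 3) :* u :* (v :* v) :* d :+ b :* u :+ c :+ v :* (con (+ 3) :* u :* u :+ v :* v :* d :+ b) :* s
          := con (+ 0) :+ con (+ 1) :* (r :* r :* r :+ b :* r :+ c)
            :+ :- (con (+ 3) :* u :* (v :* v) :+ v :* v :* v :* s) :* (s :* s :- d)) refl u v s d b c)
         (trans (+-congʳ (+-cong (*-cong (*-cong (sym eq) (sym eq)) (sym eq)) (*-congˡ (sym eq)))) root) (x-y≈0 s²≈d))
      rational : ¬ v ≈ 0#
      rational v≈0 = no-root-F u∈ (modulo₂ 1# (- (int (+ 3) * u * v * d)) (solve 5 (λ u v d b c → u :* u :* u :+ b :* u :+ c := con (+ 0)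
         :+ con (+ 1) :* (u :* u :* u :+ con (+ 3) :* u :* (v :* v) :* d :+ b :* u :+ c) :+ :- (con (+ 3) :* u :* v :* d) :* v) refl u v d b c)
         (proj₁ parts) v≈0)
      irrational : ¬ ∃ λ w → F w × v * w ≈ 1#
      irrational (w , w∈ , vw≈1) = no-root-F (*∈ (int∈ (ℤ.- + 2)) u∈) (modulo₂ 1# (- (int (+ 3) * u)) (solve 5 (λ u v d b c →
         let r = con (ℤ.- + 2) :* u in r :* r :* r :+ b :* r :+ c := con (+ 0)
         :+ con (+ 1) :* (u :* u :* u :+ con (+ 3) :* u :* (v :* v) :* d :+ b :* u :+ c)
         :+ :- (con (+ 3) :* u) :* (con (+ 3) :* u :* u :+ v :* v :* d :+ b)) refl u v d b c)
         (proj₁ parts) (cancel-inverse vw≈1 (proj₂ parts)))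

-- Cubic extensions

module CubicExtension {a ℓ₁ ℓ₂} (L : HeytingField a ℓ₁ ℓ₂) where
  open import Data.List.Membership.Propositional using (_∈_)
  open import Data.Rational using (ℚ)
  open import Defs using (module Extension)
  open FieldTheory L

  -- α, β, γ are the roots of x³ + bx + c, with multiplicity: Vieta's formulas.
  record Roots (b c α β γ : Carrier) : Set ℓ₁ where
    field
      sum     : α + β + γ ≈ 0#
      pairs   : α * β + β * γ + γ * α ≈ b
      product : α * β * γ ≈ - c

  module _ {b c α β γ : Carrier} (roots : Roots b c α β γ) where
    open Roots roots

    rotate : Roots b c β γ α
    rotate = record
      { sum     = trans (solve 3 (λ α β γ → β :+ γ :+ α := α :+ β :+ γ) refl α β γ) sum
      ; pairs   = trans (solve 3 (λ α β γ → β :* γ :+ γ :* α :+ α :* β := α :* β :+ β :* γ :+ γ :* α) refl α β γ) pairs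
      ; product = trans (solve 3 (λ α β γ → β :* γ :* α := α :* β :* γ) refl α β γ) product
      }

    root : α * α * α + b * α + c ≈ 0#
    root = modulo₃ (α * α) (- α) 1# (solve 5 (λ α β γ b c → α :* α :* α :+ b :* α :+ c := con (+ 0) :+ α :* α :* (α :+ β :+ γ)
       :+ :- α :* (α :* β :+ β :* γ :+ γ :* α :- b) :+ con (+ 1) :* (α :* β :* γ :- :- c)) refl α β γ b c)
       sum (x-y≈0 pairs) (x-y≈0 product)

    third : γ ≈ - (α + β)
    third = modulo₁ 1# (solve 3 (λ α β γ → γ := :- (α :+ β) :+ con (+ 1) :* (α :+ β :+ γ)) refl α β γ) sum

    b≈ : b ≈ - (α * α + α * β + β * β)
    b≈ = modulo₂ (α + β) (- 1#) (solve 4 (λ α β γ b → b := :- (α :* α :+ α :* β :+ β :* β) :+ (α :+ β) :* (α :+ β :+ γ)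
      :+ :- con (+ 1) :* (α :* β :+ β :* γ :+ γ :* α :- b)) refl α β γ b) sum (x-y≈0 pairs)

    c≈ : c ≈ α * β * (α + β)
    c≈ = modulo₂ (- (α * β)) 1# (solve 4 (λ α β γ c → c := α :* β :* (α :+ β) :+ :- (α :* β) :* (α :+ β :+ γ)
      :+ con (+ 1) :* (α :* β :* γ :- :- c)) refl α β γ c) sum (trans (x-y≈0 product) refl)

    -- The square root of the discriminant given by the order of the roots
    √disc : Carrier
    √disc = (α - β) * (β - γ) * (γ - α)

    √disc-square : √disc * √disc ≈ - int (+ 4) * (b * b * b) - int (+ 27) * (c * c)
    √disc-square = trans (*-cong √disc≈ √disc≈) (trans (solve 2 (λ α β →
        let γ = :- (α :+ β) ; b = :- (α :* α :+ α :* β :+ β :* β) ; c = α :* β :* (α :+ β)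
            s = (α :- β) :* (β :- γ) :* (γ :- α) in
         s :* s := :- con (+ 4) :* (b :* b :* b) :- con (+ 27) :* (c :* c)) refl α β)
       (+-cong (*-congˡ (*-cong (*-cong (sym b≈) (sym b≈)) (sym b≈))) (-‿cong (*-congˡ (*-cong (sym c≈) (sym c≈))))))
      where
      √disc≈ : √disc ≈ (α - β) * (β - - (α + β)) * (- (α + β) - α)
      √disc≈ = *-cong (*-congˡ (+-congˡ (-‿cong third))) (+-congʳ third)

    -- f′(α) = (α - β)(α - γ)
    derivative : (α - β) * (α - γ) ≈ int (+ 3) * α * α + b
    derivative = modulo₂ (- int (+ 2) * α) 1# (solve 4 (λ α β γ b → (α :- β) :* (α :- γ) := con (+ 3) :* α :* α :+ b
       :+ :- con (+ 2) :* α :* (α :+ β :+ γ) :+ con (+ 1) :* (α :* β :+ β :* γ :+ γ :* α :- b)) refl α β γ b) sum (x-y≈0 pairs)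

    -- With δ the discriminant, √δ = - f′(α) (β - γ) and f′(α) (6bα² - 9cα + 4b²) = -δ, so
    -- δ (β - γ) is a polynomial in α with coefficients in the field generated by √δ.
    difference : √disc * (int (+ 6) * b * α * α - int (+ 9) * c * α + int (+ 4) * b * b)
                 ≈ (- int (+ 4) * (b * b * b) - int (+ 27) * (c * c)) * (β - γ)
    difference = modulo₂ ((γ - β) * h) ((γ - β) * (int (+ 18) * b * α - int (+ 27) * c)) (solve 5 (λ α β γ b c →
       let h = con (+ 6) :* b :* α :* α :- con (+ 9) :* c :* α :+ con (+ 4) :* b :* b in
       (α :- β) :* (β :- γ) :* (γ :- α) :* h := (:- con (+ 4) :* (b :* b :* b) :- con (+ 27) :* (c :* c)) :* (β :- γ)
        :+ ((γ :- β) :* h) :* ((α :- β) :* (α :- γ) :- (con (+ 3) :* α :* α :+ b))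
        :+ ((γ :- β) :* (con (+ 18) :* b :* α :- con (+ 27) :* c)) :* (α :* α :* α :+ b :* α :+ c)) refl α β γ b c)
       (x-y≈0 derivative) root
      where h = int (+ 6) * b * α * α - int (+ 9) * c * α + int (+ 4) * b * b

  module Quads {k} {K : Pred Carrier k} (K-subfield : DiscreteSubfield K) {b c : Carrier} (b∈ : K b) (c∈ : K c) where
    open DiscreteSubfield K-subfield

    -- A polynomial k₀ + k₁x + k₂x² over K, that is, an element of K[x] modulo f
    record Quad : Set (a ⊔ k) where
      constructor quad
      field
        {k₀ k₁ k₂} : Carrier
        k₀∈ : K k₀
        k₁∈ : K k₁
        k₂∈ : K k₂

    open Quad

    ev : Quad → Carrier → Carrier
    ev P x = k₀ P + k₁ P * x + k₂ P * (x * x)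

    -- Sum, and product modulo f
    infixl 6 _⊕_
    infixl 7 _⊗_
    _⊕_ _⊗_ : Quad → Quad → Quad
    P ⊕ Q = quad (+∈ (k₀∈ P) (k₀∈ Q)) (+∈ (k₁∈ P) (k₁∈ Q)) (+∈ (k₂∈ P) (k₂∈ Q))
    P ⊗ Q = quad (+∈ (*∈ (k₀∈ P) (k₀∈ Q)) (-∈ (*∈ c∈ x³)))
                 (+∈ (+∈ (+∈ (*∈ (k₀∈ P) (k₁∈ Q)) (*∈ (k₁∈ P) (k₀∈ Q))) (-∈ (*∈ b∈ x³))) (-∈ (*∈ c∈ x⁴)))
                 (+∈ (+∈ (+∈ (*∈ (k₀∈ P) (k₂∈ Q)) (*∈ (k₁∈ P) (k₁∈ Q))) (*∈ (k₂∈ P) (k₀∈ Q))) (-∈ (*∈ b∈ x⁴)))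
      where
      x³ = +∈ (*∈ (k₁∈ P) (k₂∈ Q)) (*∈ (k₂∈ P) (k₁∈ Q))
      x⁴ = *∈ (k₂∈ P) (k₂∈ Q)

    const : ∀ {x} → K x → Quad
    const x∈ = quad x∈ (int∈ (+ 0)) (int∈ (+ 0))

    X : Quad
    X = quad (int∈ (+ 0)) (int∈ (+ 1)) (int∈ (+ 0))

    ev-const : ∀ {x} (x∈ : K x) y → ev (const x∈) y ≈ x
    ev-const {x} x∈ y = solve 2 (λ x y → x :+ con (+ 0) :* y :+ con (+ 0) :* (y :* y) := x) refl x y

    ev-X : ∀ y → ev X y ≈ y
    ev-X y = solve 1 (λ y → con (+ 0) :+ con (+ 1) :* y :+ con (+ 0) :* (y :* y) := y) refl y

    ev-⊕ : ∀ P Q x → ev (P ⊕ Q) x ≈ ev P x + ev Q x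
    ev-⊕ P Q x = solve 7 (λ p₀ p₁ p₂ q₀ q₁ q₂ x → p₀ :+ q₀ :+ (p₁ :+ q₁) :* x :+ (p₂ :+ q₂) :* (x :* x)
      := p₀ :+ p₁ :* x :+ p₂ :* (x :* x) :+ (q₀ :+ q₁ :* x :+ q₂ :* (x :* x))) refl (k₀ P) (k₁ P) (k₂ P) (k₀ Q) (k₁ Q) (k₂ Q) x

    ev-⊗ : ∀ P Q {x} → x * x * x + b * x + c ≈ 0# → ev (P ⊗ Q) x ≈ ev P x * ev Q x
    ev-⊗ P Q {x} f[x]≈0 = modulo₁ (- (k₁ P * k₂ Q + k₂ P * k₁ Q + k₂ P * k₂ Q * x)) (solve 9 (λ p₀ p₁ p₂ q₀ q₁ q₂ x b c →
      p₀ :* q₀ :+ :- (c :* (p₁ :* q₂ :+ p₂ :* q₁))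
      :+ (p₀ :* q₁ :+ p₁ :* q₀ :+ :- (b :* (p₁ :* q₂ :+ p₂ :* q₁)) :+ :- (c :* (p₂ :* q₂))) :* x
      :+ (p₀ :* q₂ :+ p₁ :* q₁ :+ p₂ :* q₀ :+ :- (b :* (p₂ :* q₂))) :* (x :* x)
      := (p₀ :+ p₁ :* x :+ p₂ :* (x :* x)) :* (q₀ :+ q₁ :* x :+ q₂ :* (x :* x))
      :+ :- (p₁ :* q₂ :+ p₂ :* q₁ :+ p₂ :* q₂ :* x) :* (x :* x :* x :+ b :* x :+ c)) refl
      (k₀ P) (k₁ P) (k₂ P) (k₀ Q) (k₁ Q) (k₂ Q) x b c) f[x]≈0

    -- P(β) P(γ) as a polynomial in α, obtained from β + γ = -α and βγ = α² + b
    adj : Quad → Quad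
    adj P = quad (+∈ (+∈ (+∈ (+∈ (*∈ p₀ p₀) (-∈ (*∈ (*∈ (*∈ (int∈ (+ 2)) b∈) p₀) p₂))) (*∈ (*∈ b∈ p₁) p₁)) (*∈ (*∈ c∈ p₁) p₂)) (*∈ (*∈ (*∈ b∈ b∈) p₂) p₂))
                 (+∈ (-∈ (*∈ p₀ p₁)) (-∈ (*∈ (*∈ c∈ p₂) p₂)))
                 (+∈ (+∈ (-∈ (*∈ p₀ p₂)) (*∈ p₁ p₁)) (*∈ (*∈ b∈ p₂) p₂))
      where
      p₀ = k₀∈ P
      p₁ = k₁∈ P
      p₂ = k₂∈ P

    -- P(α) P(β) P(γ)
    norm : Quad → Carrier
    norm P = k₀ (P ⊗ adj P)

    norm∈ : ∀ P → K (norm P)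
    norm∈ P = k₀∈ (P ⊗ adj P)

    ev-adj : ∀ {α β γ} → Roots b c α β γ → ∀ P → ev (adj P) α ≈ ev P β * ev P γ
    ev-adj {α} {β} {γ} roots P = trans
      (+-cong (+-cong (+-cong (+-cong (+-cong (+-congˡ (-‿cong (*-congʳ (*-congʳ (*-congˡ b′))))) (*-congʳ (*-congʳ b′))) (*-congʳ (*-congʳ c′)))
         (*-congʳ (*-congʳ (*-cong b′ b′)))) (*-congʳ (+-congˡ (-‿cong (*-congʳ (*-congʳ c′)))))) (*-congʳ (+-congˡ (*-congʳ (*-congʳ b′)))))
      (trans (solve 5 (λ α β p₀ p₁ p₂ →
         let γ = :- (α :+ β) ; b = :- (α :* α :+ α :* β :+ β :* β) ; c = α :* β :* (α :+ β) in
         p₀ :* p₀ :+ :- (con (+ 2) :* b :* p₀ :* p₂) :+ b :* p₁ :* p₁ :+ c :* p₁ :* p₂ :+ b :* b :* p₂ :* p₂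
         :+ (:- (p₀ :* p₁) :+ :- (c :* p₂ :* p₂)) :* α :+ (:- (p₀ :* p₂) :+ p₁ :* p₁ :+ b :* p₂ :* p₂) :* (α :* α)
         := (p₀ :+ p₁ :* β :+ p₂ :* (β :* β)) :* (p₀ :+ p₁ :* γ :+ p₂ :* (γ :* γ))) refl α β (k₀ P) (k₁ P) (k₂ P))
      (*-congˡ (sym (+-cong (+-congˡ (*-congˡ γ′)) (*-congˡ (*-cong γ′ γ′))))))
      where
      b′ = b≈ roots
      c′ = c≈ roots
      γ′ = third roots

    norm≈ : ∀ {α β γ} → Roots b c α β γ → ∀ P → norm P ≈ ev P α * ev (adj P) α
    norm≈ {α} roots P = sym (trans (sym (ev-⊗ P (adj P) (root roots))) (solve 6 (λ p₀ p₁ p₂ x b c →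
      let q₀ = p₀ :* p₀ :+ :- (con (+ 2) :* b :* p₀ :* p₂) :+ b :* p₁ :* p₁ :+ c :* p₁ :* p₂ :+ b :* b :* p₂ :* p₂
          q₁ = :- (p₀ :* p₁) :+ :- (c :* p₂ :* p₂)
          q₂ = :- (p₀ :* p₂) :+ p₁ :* p₁ :+ b :* p₂ :* p₂
      in p₀ :* q₀ :+ :- (c :* (p₁ :* q₂ :+ p₂ :* q₁))
        :+ (p₀ :* q₁ :+ p₁ :* q₀ :+ :- (b :* (p₁ :* q₂ :+ p₂ :* q₁)) :+ :- (c :* (p₂ :* q₂))) :* x
        :+ (p₀ :* q₂ :+ p₁ :* q₁ :+ p₂ :* q₀ :+ :- (b :* (p₂ :* q₂))) :* (x :* x)
        := p₀ :* q₀ :+ :- (c :* (p₁ :* q₂ :+ p₂ :* q₁))) refl (k₀ P) (k₁ P) (k₂ P) α b c))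

    module NoRoot (no-root : ∀ {r} → K r → ¬ r * r * r + b * r + c ≈ 0#) where

      -- A root is not in K, so 1 and α are independent over K.
      root∉K : ∀ {α} → α * α * α + b * α + c ≈ 0# → ∀ {u v} → K u → K v → u + v * α ≈ 0# → u ≈ 0# × v ≈ 0#
      root∉K {α} f[α]≈0 {u} {v} u∈ v∈ eq = from (zero? v∈)
        where
        from : v ≈ 0# ⊎ (∃ λ w → K w × v * w ≈ 1#) → u ≈ 0# × v ≈ 0#
        from (inj₁ v≈0) = modulo₂ 1# (- α) (solve 3 (λ u v α → u := con (+ 0) :+ con (+ 1) :* (u :+ v :* α) :+ :- α :* v) refl u v α) eq v≈0 , v≈0
        from (inj₂ (w , w∈ , vw≈1)) = ⊥-elim (no-root (resp (sym α≈) (-∈ (*∈ u∈ w∈))) f[α]≈0)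
          where
          α≈ : α ≈ - (u * w)
          α≈ = modulo₂ w (- α) (solve 4 (λ u v w α → α := :- (u :* w) :+ w :* (u :+ v :* α) :+ :- α :* (v :* w :- con (+ 1))) refl u v w α) eq (x-y≈0 vw≈1)

      -- The elements 1, α, α² are independent over K: division of f by a monic quadratic
      -- x² + rx + s with root α leaves a remainder of degree at most 1, which vanishes
      -- at α and so identically, and then r is a root of f.
      ev-injective : ∀ {α} → α * α * α + b * α + c ≈ 0# → ∀ P → ev P α ≈ 0# → k₀ P ≈ 0# × k₁ P ≈ 0# × k₂ P ≈ 0#
      ev-injective {α} f[α]≈0 P eq = from (zero? (k₂∈ P))
        where
        p₀ = k₀ P
        p₁ = k₁ P
        p₂ = k₂ P
        from : p₂ ≈ 0# ⊎ (∃ λ w → K w × p₂ * w ≈ 1#) → p₀ ≈ 0# × p₁ ≈ 0# × p₂ ≈ 0#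
        from (inj₁ p₂≈0) =
          let p₀≈0 , p₁≈0 = root∉K f[α]≈0 (k₀∈ P) (k₁∈ P) (modulo₂ 1# (- (α * α)) (solve 4 (λ u v w α →
                u :+ v :* α := con (+ 0) :+ con (+ 1) :* (u :+ v :* α :+ w :* (α :* α)) :+ :- (α :* α) :* w) refl p₀ p₁ p₂ α) eq p₂≈0)
          in p₀≈0 , p₁≈0 , p₂≈0
        from (inj₂ (w , w∈ , p₂w≈1)) = ⊥-elim (no-root r∈ (modulo₂ 1# r (solve 4 (λ r s b c →
             r :* r :* r :+ b :* r :+ c := con (+ 0) :+ con (+ 1) :* (c :+ r :* s) :+ r :* (b :- s :+ r :* r)) refl r s b c)
             (proj₁ remainder) (proj₂ remainder)))
          where
          r = p₁ * w
          s = p₀ * w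
          r∈ = *∈ (k₁∈ P) w∈
          s∈ = *∈ (k₀∈ P) w∈
          monic : α * α + r * α + s ≈ 0#
          monic = modulo₂ w (- (α * α)) (solve 5 (λ p₀ p₁ p₂ w α → α :* α :+ p₁ :* w :* α :+ p₀ :* w := con (+ 0)
             :+ w :* (p₀ :+ p₁ :* α :+ p₂ :* (α :* α)) :+ :- (α :* α) :* (p₂ :* w :- con (+ 1))) refl p₀ p₁ p₂ w α) eq (x-y≈0 p₂w≈1)
          remainder : c + r * s ≈ 0# × b - s + r * r ≈ 0#
          remainder = root∉K f[α]≈0 (+∈ c∈ (*∈ r∈ s∈)) (+∈ (+∈ b∈ (-∈ s∈)) (*∈ r∈ r∈)) (modulo₂ 1# (- (α - r)) (solve 5 (λ α r s b c →
             c :+ r :* s :+ (b :- s :+ r :* r) :* α := con (+ 0) :+ con (+ 1) :* (α :* α :* α :+ b :* α :+ c)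
             :+ :- (α :- r) :* (α :* α :+ r :* α :+ s)) refl α r s b c) f[α]≈0 monic)

      ev-zero : ∀ P x → k₀ P ≈ 0# × k₁ P ≈ 0# × k₂ P ≈ 0# → ev P x ≈ 0#
      ev-zero P x (h₀ , h₁ , h₂) = modulo₃ 1# x (x * x) (solve 4 (λ u v w x → u :+ v :* x :+ w :* (x :* x)
         := con (+ 0) :+ con (+ 1) :* u :+ x :* v :+ x :* x :* w) refl (k₀ P) (k₁ P) (k₂ P) x) h₀ h₁ h₂

      -- If P vanishes at one root then P = 0.
      ev≉0 : ∀ {α α′} → α * α * α + b * α + c ≈ 0# → α′ * α′ * α′ + b * α′ + c ≈ 0# → ∀ P → ¬ ev P α ≈ 0# → ¬ ev P α′ ≈ 0#
      ev≉0 {α} _ f[α′]≈0 P Pα≉0 Pα′≈0 = Pα≉0 (ev-zero P α (ev-injective f[α′]≈0 P Pα′≈0))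

      norm-inverse : ∀ {α β γ} → Roots b c α β γ → ∀ P → ¬ ev P α ≈ 0# → ∃ λ w → K w × norm P * w ≈ 1#
      norm-inverse {α} {β} {γ} roots P Pα≉0 = [ ⊥-elim ∘ norm≉0 , (λ h → h) ]′ (zero? (norm∈ P))
        where
        f[α] = root roots
        f[β] = root (rotate roots)
        f[γ] = root (rotate (rotate roots))
        norm≉0 : ¬ norm P ≈ 0#
        norm≉0 N≈0 = noZeroDivisors (trans (sym (norm≈ roots P)) N≈0) Pα≉0 λ adj≈0 →
          noZeroDivisors (trans (sym (ev-adj roots P)) adj≈0) (ev≉0 f[α] f[β] P Pα≉0) (ev≉0 f[α] f[γ] P Pα≉0)

      module Adjoin {α β γ : Carrier} (roots : Roots b c α β γ) where
        private f[α] = root roots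

        -- The field generated by α over K
        K[α] : Pred Carrier (a ⊔ ℓ₁ ⊔ k)
        K[α] x = ∃ λ P → x ≈ ev P α

        K⊆K[α] : ∀ {x} → K x → K[α] x
        K⊆K[α] x∈ = const x∈ , sym (ev-const x∈ α)

        α∈K[α] : K[α] α
        α∈K[α] = X , sym (ev-X α)

        K[α]-resp : ∀ {x y} → x ≈ y → K[α] x → K[α] y
        K[α]-resp x≈y (P , eq) = P , trans (sym x≈y) eq

        K[α]-+ : ∀ {x y} → K[α] x → K[α] y → K[α] (x + y)
        K[α]-+ (P , eq) (Q , eq′) = P ⊕ Q , trans (+-cong eq eq′) (sym (ev-⊕ P Q α))

        K[α]-* : ∀ {x y} → K[α] x → K[α] y → K[α] (x * y)
        K[α]-* (P , eq) (Q , eq′) = P ⊗ Q , trans (*-cong eq eq′) (sym (ev-⊗ P Q f[α]))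

        K[α]-neg : ∀ {x} → K[α] x → K[α] (- x)
        K[α]-neg {x} x∈ = K[α]-resp (solve 1 (λ x → con (ℤ.- + 1) :* x := :- x) refl x) (K[α]-* (K⊆K[α] (int∈ (ℤ.- + 1))) x∈)

        -- The inverse of P(α) is P(β) P(γ) divided by the norm.
        adj-inverse : ∀ {x} P → x ≈ ev P α → ¬ x ≈ 0# → ∃ λ z → K[α] z × x * z ≈ 1#
        adj-inverse {x} P eq x≉0 =
          let w , w∈ , Nw≈1 = norm-inverse roots P (x≉0 ∘ trans eq)
              A = adj P
          in ev A α * w , K[α]-* (A , refl) (K⊆K[α] w∈) ,
             trans (*-congʳ eq) (trans (sym (*-assoc _ _ _)) (trans (*-congʳ (sym (norm≈ roots P))) Nw≈1))

        K[α]-inverse : ∀ {x y} → x * y ≈ 1# → K[α] x → K[α] y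
        K[α]-inverse {x} {y} xy≈1 (P , eq) =
          let z , z∈ , xz≈1 = adj-inverse P eq (#0⇒≉0 (inverse⇒#0 xy≈1))
          in K[α]-resp (modulo₂ y (- z) (solve 3 (λ x y z → z := y :+ y :* (x :* z :- con (+ 1)) :+ :- z :* (x :* y :- con (+ 1))) refl x y z)
               (x-y≈0 xz≈1) (x-y≈0 xy≈1)) z∈

        K[α]-zero? : ∀ {x} → K[α] x → x ≈ 0# ⊎ x # 0#
        K[α]-zero? {x} (P@(quad {k₀} {k₁} {k₂} k₀∈ k₁∈ k₂∈) , eq) = decide (zero? k₀∈) (zero? k₁∈) (zero? k₂∈)
          where
          invertible : ¬ x ≈ 0# → x # 0#
          invertible x≉0 = inverse⇒#0 (proj₂ (proj₂ (adj-inverse P eq x≉0)))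
          zeros : x ≈ 0# → k₀ ≈ 0# × k₁ ≈ 0# × k₂ ≈ 0#
          zeros x≈0 = ev-injective f[α] P (trans (sym eq) x≈0)
          decide : k₀ ≈ 0# ⊎ (∃ λ y → K y × k₀ * y ≈ 1#) → k₁ ≈ 0# ⊎ (∃ λ y → K y × k₁ * y ≈ 1#) →
                   k₂ ≈ 0# ⊎ (∃ λ y → K y × k₂ * y ≈ 1#) → x ≈ 0# ⊎ x # 0#
          decide (inj₂ (_ , _ , h)) _ _ = inj₂ (invertible (#0⇒≉0 (inverse⇒#0 h) ∘ proj₁ ∘ zeros))
          decide _ (inj₂ (_ , _ , h)) _ = inj₂ (invertible (#0⇒≉0 (inverse⇒#0 h) ∘ proj₁ ∘ proj₂ ∘ zeros))
          decide _ _ (inj₂ (_ , _ , h)) = inj₂ (invertible (#0⇒≉0 (inverse⇒#0 h) ∘ proj₂ ∘ proj₂ ∘ zeros))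
          decide (inj₁ h₀) (inj₁ h₁) (inj₁ h₂) = inj₁ (trans eq (ev-zero P α (h₀ , h₁ , h₂)))

        -- If √disc is in K and the discriminant and 2 are invertible, all roots are in K[α].
        module Generated {half d⁻¹ : Carrier} (half∈ : K half) (2half≈1 : int (+ 2) * half ≈ 1#) (d⁻¹∈ : K d⁻¹)
                 (dd⁻¹≈1 : (- int (+ 4) * (b * b * b) - int (+ 27) * (c * c)) * d⁻¹ ≈ 1#) (√disc∈ : K (√disc roots)) where

          β∈K[α] : K[α] β
          β∈K[α] = K[α]-resp (sym β≈) (K[α]-* (K⊆K[α] half∈) (K[α]-+ (K[α]-neg α∈K[α])
              (K[α]-* (K⊆K[α] d⁻¹∈) (K[α]-* (K⊆K[α] √disc∈)
                (quad (*∈ (int∈ (+ 4)) (*∈ b∈ b∈)) (-∈ (*∈ (int∈ (+ 9)) c∈)) (*∈ (int∈ (+ 6)) b∈) , refl)))))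
            where
            s = √disc roots
            h = int (+ 4) * (b * b) + - (int (+ 9) * c) * α + int (+ 6) * b * (α * α)
            D = - int (+ 4) * (b * b * b) - int (+ 27) * (c * c)
            h≈ : s * h ≈ D * (β - γ)
            h≈ = trans (*-congˡ (solve 3 (λ α b c → con (+ 4) :* (b :* b) :+ :- (con (+ 9) :* c) :* α :+ con (+ 6) :* b :* (α :* α)
               := con (+ 6) :* b :* α :* α :- con (+ 9) :* c :* α :+ con (+ 4) :* b :* b) refl α b c)) (difference roots)
            β≈ : β ≈ half * (- α + d⁻¹ * (s * h))
            β≈ = sym (trans (*-congˡ (+-congˡ (*-congˡ h≈))) (modulo₃ (half * (β - γ)) (- half) β (solve 6 (λ α β γ half d⁻¹ D →
               half :* (:- α :+ d⁻¹ :* (D :* (β :- γ))) := β :+ half :* (β :- γ) :* (D :* d⁻¹ :- con (+ 1)) :+ :- half :* (α :+ β :+ γ)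
               :+ β :* (con (+ 2) :* half :- con (+ 1))) refl α β γ half d⁻¹ D) (x-y≈0 dd⁻¹≈1) (Roots.sum roots) (x-y≈0 2half≈1)))

          γ∈K[α] : K[α] γ
          γ∈K[α] = K[α]-resp (sym (third roots)) (K[α]-neg (K[α]-+ α∈K[α] β∈K[α]))

          -- An extension of ℚ generated by elements of K[α] is contained in K[α].
          generated : (ι : ℚ → Carrier) → (∀ q → K (ι q)) → ∀ {gs} → (∀ {g} → g ∈ gs → K[α] g) →
                      ∀ {x} → Extension.ℚ⟨_⟩ L ι gs x → K[α] x
          generated ι ι∈ {gs} gs∈ = go
            where
            open Extension L ι
            go : ∀ {x} → ℚ⟨ gs ⟩ x → K[α] x
            go (rational q)      = K⊆K[α] (ι∈ q)
            go (generator g∈)    = gs∈ g∈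
            go (plus x∈ y∈)      = K[α]-+ (go x∈) (go y∈)
            go (times x∈ y∈)     = K[α]-* (go x∈) (go y∈)
            go (minus x∈)        = K[α]-neg (go x∈)
            go (inverse xy≈1 x∈) = K[α]-inverse xy≈1 (go x∈)
            go (respects x≈y x∈) = K[α]-resp x≈y (go x∈)

-- Valuations

open import Algebra.Properties.AbelianGroup ℤ.+-0-abelianGroup using (∙-cancelˡ)
open import Data.Integer using (_≤_; _<_; _⊓_; ∣_∣)
open import Defs using (DiscreteValuation)

private
  module ℤS = ℤ-Solver

+-cancelʳ-≤ : ∀ m k n → m ℤ.+ n ≤ k ℤ.+ n → m ≤ k
+-cancelʳ-≤ m k n h = ≡.subst₂ _≤_ (cancel m n) (cancel k n) (ℤ.+-monoˡ-≤ (ℤ.- n) h)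
  where
  cancel : ∀ m n → m ℤ.+ n ℤ.+ ℤ.- n ≡ m
  cancel = ℤS.solve 2 (λ m n → m ℤS.:+ n ℤS.:+ ℤS.:- n ℤS.:= m) ≡.refl

-- Discrete valuations on a field with decidable equality to zero
module ValuationTheory {a ℓ₁ ℓ₂} (L : HeytingField a ℓ₁ ℓ₂)
    (discrete : ∀ x → HeytingField._≈_ L x (HeytingField.0# L) ⊎ HeytingField._#_ L x (HeytingField.0# L))
    (w : DiscreteValuation L) where
  open FieldTheory L
  open DiscreteValuation w

  private variable x y z : Carrier

  -- The order of x is at least m. Zero has every order.
  Ord≥ : ℤ → Pred Carrier ℓ₂
  Ord≥ m x = ∀ x# → m ≤ v x x#

  ≉0⇒#0 : ¬ x ≈ 0# → x # 0#
  ≉0⇒#0 {x} x≉0 = [ ⊥-elim ∘ x≉0 , (λ h → h) ]′ (discrete x)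

  v-unique : ∀ x# x#′ → v x x# ≡ v x x#′
  v-unique x# x#′ = v-cong x# x#′ refl

  v-1 : ∀ 1#0′ → v 1# 1#0′ ≡ + 0
  v-1 1#0′ = ∙-cancelˡ (v 1# 1#0′) (v 1# 1#0′) (+ 0) (≡.trans (≡.sym (v-* 1#0′ 1#0′ 1*1#0))
      (≡.trans (v-cong 1*1#0 1#0′ (*-identityˡ 1#)) (≡.sym (ℤ.+-identityʳ _))))
    where 1*1#0 = x#0y#0→xy#0 1#0′ 1#0′

  v-inverse : ∀ x# y# → x * y ≈ 1# → v x x# ℤ.+ v y y# ≡ + 0
  v-inverse x# y# xy≈1 = ≡.trans (≡.sym (v-* x# y# xy#)) (≡.trans (v-cong xy# 1#0 xy≈1) (v-1 1#0))
    where xy# = x#0y#0→xy#0 x# y#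

  i+i≡0⇒i≡0 : ∀ i → i ℤ.+ i ≡ + 0 → i ≡ + 0
  i+i≡0⇒i≡0 (+ zero) _ = ≡.refl

  neg#0 : x # 0# → - x # 0#
  neg#0 {x} x# = let y , xy≈1 = #0⇒inverse x# in
    inverse⇒#0 {y = - y} (trans (solve 2 (λ x y → :- x :* :- y := x :* y) refl x y) xy≈1)

  v-neg : ∀ x# -x# → v (- x) -x# ≡ v x x#
  v-neg {x} x# -x# = ≡.trans (v-cong -x# (x#0y#0→xy#0 -1#0 x#) (solve 1 (λ x → :- x := :- con (+ 1) :* x) refl x))
    (≡.trans (v-* -1#0 x# (x#0y#0→xy#0 -1#0 x#)) (≡.trans (≡.cong (ℤ._+ v x x#) v-[-1]) (ℤ.+-identityˡ _)))
    where
    -1#0 = neg#0 1#0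
    v-[-1] : v (- 1#) -1#0 ≡ + 0
    v-[-1] = i+i≡0⇒i≡0 _ (v-inverse -1#0 -1#0 (solve 0 (:- con (+ 1) :* :- con (+ 1) := con (+ 1)) refl))

  ord-cong : ∀ {m} → x ≈ y → Ord≥ m x → Ord≥ m y
  ord-cong x≈y h y# = ℤ.≤-trans (h x#) (ℤ.≤-reflexive (v-cong x# y# x≈y))
    where x# = #-congʳ (sym x≈y) y#

  ord-zero : ∀ {m} → x ≈ 0# → Ord≥ m x
  ord-zero x≈0 x# = ⊥-elim (#0⇒≉0 x# x≈0)

  ord-v : ∀ {n} x# → v x x# ≡ n → Ord≥ n x
  ord-v x# eq x#′ = ℤ.≤-reflexive (≡.trans (≡.sym eq) (v-unique x# x#′))

  ord-≤ : ∀ {m n} → m ≤ n → Ord≥ n x → Ord≥ m x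
  ord-≤ m≤n h x# = ℤ.≤-trans m≤n (h x#)

  ord-+ : ∀ {m} → Ord≥ m x → Ord≥ m y → Ord≥ m (x + y)
  ord-+ {x} {y} {m} hx hy x+y# = from (discrete x) (discrete y)
    where
    from : x ≈ 0# ⊎ x # 0# → y ≈ 0# ⊎ y # 0# → m ≤ v (x + y) x+y#
    from (inj₁ x≈0) _ = ord-cong (sym (trans (+-congʳ x≈0) (+-identityˡ y))) hy x+y#
    from _ (inj₁ y≈0) = ord-cong (sym (trans (+-congˡ y≈0) (+-identityʳ x))) hx x+y#
    from (inj₂ x#) (inj₂ y#) = ℤ.≤-trans (ℤ.⊓-glb (hx x#) (hy y#)) (v-+ x# y# x+y#)

  ord-* : ∀ {m n} → Ord≥ m x → Ord≥ n y → Ord≥ (m ℤ.+ n) (x * y)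
  ord-* {x} {y} {m} {n} hx hy xy# = from (discrete x) (discrete y)
    where
    from : x ≈ 0# ⊎ x # 0# → y ≈ 0# ⊎ y # 0# → m ℤ.+ n ≤ v (x * y) xy#
    from (inj₁ x≈0) _ = ord-zero (trans (*-congʳ x≈0) (zeroˡ y)) xy#
    from _ (inj₁ y≈0) = ord-zero (trans (*-congˡ y≈0) (zeroʳ x)) xy#
    from (inj₂ x#) (inj₂ y#) = ℤ.≤-trans (ℤ.+-mono-≤ (hx x#) (hy y#)) (ℤ.≤-reflexive (≡.sym (v-* x# y# xy#)))

  ord-*₀ : ∀ {m} → Ord≥ m x → Ord≥ (+ 0) y → Ord≥ m (x * y)
  ord-*₀ {m = m} hx hy = ord-≤ (ℤ.≤-reflexive (≡.sym (ℤ.+-identityʳ m))) (ord-* hx hy)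

  ord-₀* : ∀ {m} → Ord≥ (+ 0) x → Ord≥ m y → Ord≥ m (x * y)
  ord-₀* {m = m} hx hy = ord-≤ (ℤ.≤-reflexive (≡.sym (ℤ.+-identityˡ m))) (ord-* hx hy)

  ord-neg : ∀ {m} → Ord≥ m x → Ord≥ m (- x)
  ord-neg {x} h -x# = ℤ.≤-trans (h x#) (ℤ.≤-reflexive (≡.sym (v-neg x# -x#)))
    where x# = #-congʳ (solve 1 (λ x → :- :- x := x) refl x) (neg#0 -x#)

  ord-1 : Ord≥ (+ 0) 1#
  ord-1 1#0′ = ℤ.≤-reflexive (≡.sym (v-1 1#0′))

  ord-int : ∀ n → Ord≥ (+ 0) (int n)
  ord-int (+ n)    = ord-ℕ n
    where
    ord-ℕ : ∀ n → Ord≥ (+ 0) (int (+ n))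
    ord-ℕ zero    = ord-zero refl
    ord-ℕ (suc n) = ord-cong (sym (int-+ (+ 1) (+ n))) (ord-+ ord-1 (ord-ℕ n))
  ord-int -[1+ n ] = ord-neg (ord-int (+ suc n))

  -- If y has order n and xy has order at least m + n then x has order at least m.
  ord-divide : ∀ {m n} y# → v y y# ≡ n → Ord≥ (m ℤ.+ n) (x * y) → Ord≥ m x
  ord-divide {y} {x} {m} {n} y# eq h x# = +-cancelʳ-≤ m (v x x#) n (ℤ.≤-trans (h xy#)
      (ℤ.≤-reflexive (≡.trans (v-* x# y# xy#) (≡.cong (λ k → v x x# ℤ.+ k) eq))))
    where xy# = x#0y#0→xy#0 x# y#

  ord-inverse : ∀ {n} x# → v x x# ≡ n → x * y ≈ 1# → Ord≥ (ℤ.- n) y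
  ord-inverse {x} {y} {n} x# eq xy≈1 = ord-divide {m = ℤ.- n} x# eq (ord-≤ (ℤ.≤-reflexive (ℤ.+-inverseˡ n))
    (ord-cong (trans (sym xy≈1) (*-comm x y)) ord-1))

  ord? : ∀ m x → Ord≥ m x ⊎ ∃ λ x# → v x x# < m
  ord? m x = [ (λ x≈0 → inj₁ (ord-zero x≈0)) , (λ x# → from x# (m ℤ.≤? v x x#)) ]′ (discrete x)
    where
    from : ∀ x# → Dec (m ≤ v x x#) → Ord≥ m x ⊎ ∃ λ x# → v x x# < m
    from x# (yes m≤v) = inj₁ (λ x#′ → ℤ.≤-trans m≤v (ℤ.≤-reflexive (v-unique x# x#′)))
    from x# (no m≰v)  = inj₂ (x# , ℤ.≰⇒> m≰v)

  <⇒¬ord : ∀ {m} x# → v x x# < m → ¬ Ord≥ m x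
  <⇒¬ord x# v<m h = ℤ.<⇒≱ v<m (h x#)

  -- If y has larger order than x then x + y has the order of x.
  v-dominant : ∀ {n} x# → v x x# ≡ n → Ord≥ (ℤ.suc n) y → ∃ λ x+y# → v (x + y) x+y# ≡ n
  v-dominant {x} {y} {n} x# eq hy = x+y# , ℤ.≤-antisym (ℤ.≮⇒≥ upper) (ord-+ (ord-v x# eq) (ord-≤ (ℤ.i≤suc[i] n) hy) x+y#)
    where
    n<suc : v x x# < ℤ.suc n
    n<suc = ℤ.suc[i]≤j⇒i<j (ℤ.≤-reflexive (≡.cong ℤ.suc eq))
    x≈ : (x + y) - y ≈ x
    x≈ = solve 2 (λ x y → x :+ y :- y := x) refl x y
    x+y# : x + y # 0#
    x+y# = ≉0⇒#0 λ x+y≈0 → <⇒¬ord x# n<suc (ord-cong x≈ (ord-+ (ord-zero x+y≈0) (ord-neg hy)))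
    upper : ¬ n < v (x + y) x+y#
    upper lt = <⇒¬ord x# n<suc (ord-cong x≈ (ord-+ (λ x+y#′ → ℤ.≤-trans (ℤ.i<j⇒suc[i]≤j lt) (ℤ.≤-reflexive (v-unique x+y# x+y#′))) (ord-neg hy)))

-- Finite places

<1⇒≤0 : ∀ {i} → i < + 1 → i ≤ + 0
<1⇒≤0 (ℤ.+<+ (ℕ.s≤s n≤0)) = ℤ.+≤+ n≤0
<1⇒≤0 ℤ.-<+ = ℤ.-≤+

module FinitePlaces {a ℓ₁ ℓ₂} (L : HeytingField a ℓ₁ ℓ₂) where
  open FieldTheory L
  open CubicExtension L

  module Place {k} {K : Pred Carrier k} (K-subfield : DiscreteSubfield K) {b c : Carrier} (b∈ : K b) (c∈ : K c)
               (no-root : ∀ {r} → K r → ¬ r * r * r + b * r + c ≈ 0#)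
               (discrete : ∀ x → x ≈ 0# ⊎ x # 0#) (w : DiscreteValuation L) where
    open DiscreteSubfield K-subfield
    open Quads K-subfield b∈ c∈
    open Quad
    open NoRoot no-root
    open ValuationTheory L discrete w
    open DiscreteValuation w

    -- n is the value of a nonzero element of K.
    Value : ℤ → Set _
    Value n = ∃₂ λ x x# → K x × v x x# ≡ n

    value-+ : ∀ {m n} → Value m → Value n → Value (m ℤ.+ n)
    value-+ (x , x# , x∈ , eq) (y , y# , y∈ , eq′) = x * y , xy# , *∈ x∈ y∈ , ≡.trans (v-* x# y# xy#) (≡.cong₂ ℤ._+_ eq eq′)
      where xy# = x#0y#0→xy#0 x# y#

    value-neg : ∀ {m} → Value m → Value (ℤ.- m)
    value-neg {m} (x , x# , x∈ , eq) = from (zero? x∈)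
      where
      from : x ≈ 0# ⊎ (∃ λ y → K y × x * y ≈ 1#) → Value (ℤ.- m)
      from (inj₁ x≈0) = ⊥-elim (#0⇒≉0 x# x≈0)
      from (inj₂ (y , y∈ , xy≈1)) = y , y# , y∈ , ∙-inverse (v y y#) m (≡.trans (≡.cong (ℤ._+ v y y#) (≡.sym eq)) (v-inverse x# y# xy≈1))
        where
        y# = inverse⇒#0 (trans (*-comm y x) xy≈1)
        ∙-inverse : ∀ i m → m ℤ.+ i ≡ + 0 → i ≡ ℤ.- m
        ∙-inverse i m eq = ℤS.modulo₁ (+ 1) (ℤS.solve 2 (λ i m → i ℤS.:= ℤS.:- m ℤS.:+ ℤS.con (+ 1) ℤS.:* (m ℤS.:+ i)) ≡.refl i m) eq

    value-cancel : ∀ {m n} → Value (m ℤ.+ n) → Value n → Value m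
    value-cancel {m} {n} h h′ = ≡.subst Value (ℤS.solve 2 (λ m n → m ℤS.:+ n ℤS.:+ ℤS.:- n ℤS.:= m) ≡.refl m n) (value-+ h (value-neg h′))

    -- Some bound for the order: the order itself, or 0 for the zero element
    ord-K : ∀ {x} → K x → ∃ λ e → Ord≥ e x
    ord-K {x} _ = [ (λ x≈0 → + 0 , ord-zero x≈0) , (λ x# → v x x# , ord-v x# ≡.refl) ]′ (discrete x)

    -- If α is a limit of elements of K then values on K(α) are values on K: for x ∈ K close
    -- enough to α, the values of P(x) and P(α) are equal.
    dense : ∀ {α} → Ord≥ (+ 0) α → (∀ (m : ℕ) → ∃ λ x → K x × Ord≥ (+ m) (α - x)) →
            ∀ {y n} y# → v y y# ≡ n → ∀ P → y ≈ ev P α → Value n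
    dense {α} α-int approx {y} {n} y# vy≡n P y≈ =
      let x , x∈ , close = approx m
          x-int = ord-cong (solve 2 (λ α x → α :- (α :- x) := x) refl α x) (ord-+ α-int (ord-neg (ord-≤ (ℤ.+≤+ ℕ.z≤n) close)))
          close′ : Ord≥ (ℤ.suc n) ((α - x) * - (k₁ P + k₂ P * (α + x)))
          close′ = ord-≤ m+e≥ (ord-* close (ord-neg (ord-+ (ord-≤ (ℤ.i⊓j≤i e₁ e₂) ord₁) (ord-*₀ (ord-≤ (ℤ.i⊓j≤j e₁ e₂) ord₂) (ord-+ α-int x-int)))))
          z# , vz≡ = v-dominant y# vy≡n close′
          z≈ : y + (α - x) * - (k₁ P + k₂ P * (α + x)) ≈ ev P x
          z≈ = trans (+-congʳ y≈) (solve 5 (λ p q r α x → p :+ q :* α :+ r :* (α :* α) :+ (α :- x) :* :- (q :+ r :* (α :+ x))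
                 := p :+ q :* x :+ r :* (x :* x)) refl (k₀ P) (k₁ P) (k₂ P) α x)
      in y + (α - x) * - (k₁ P + k₂ P * (α + x)) , z# ,
         resp (sym z≈) (+∈ (+∈ (k₀∈ P) (*∈ (k₁∈ P) x∈)) (*∈ (k₂∈ P) (*∈ x∈ x∈))) , vz≡
      where
      e₁ = proj₁ (ord-K (k₁∈ P))
      ord₁ = proj₂ (ord-K (k₁∈ P))
      e₂ = proj₁ (ord-K (k₂∈ P))
      ord₂ = proj₂ (ord-K (k₂∈ P))
      m = ∣ ℤ.suc n ℤ.- (e₁ ⊓ e₂) ∣
      i≤+∣i∣ : ∀ i → i ≤ + ∣ i ∣
      i≤+∣i∣ (+ n)    = ℤ.≤-refl
      i≤+∣i∣ -[1+ n ] = ℤ.-≤+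
      m+e≥ : ℤ.suc n ≤ + m ℤ.+ (e₁ ⊓ e₂)
      m+e≥ = ℤ.≤-trans (ℤ.≤-reflexive (ℤS.solve 2 (λ n e → n ℤS.:= n ℤS.:- e ℤS.:+ e) ≡.refl (ℤ.suc n) (e₁ ⊓ e₂)))
               (ℤ.+-monoˡ-≤ (e₁ ⊓ e₂) (i≤+∣i∣ (ℤ.suc n ℤ.- (e₁ ⊓ e₂))))

    -- α is a limit of elements of K if there is a map x ↦ x′ on K that strictly increases
    -- the order of α - x, once that order is at least e.
    contraction : ∀ {α} e → + 0 ≤ e → (∃ λ x → K x × Ord≥ e (α - x)) →
                  (∀ {x} (m : ℕ) → K x → Ord≥ (e ℤ.+ + m) (α - x) → ∃ λ x′ → K x′ × Ord≥ (e ℤ.+ + suc m) (α - x′)) →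
                  ∀ m → ∃ λ x → K x × Ord≥ (+ m) (α - x)
    contraction {α} e 0≤e (x₀ , x₀∈ , start) step m = let x , x∈ , h = go m in
      x , x∈ , ord-≤ (ℤ.≤-trans (ℤ.≤-reflexive (≡.sym (ℤ.+-identityˡ (+ m)))) (ℤ.+-monoˡ-≤ (+ m) 0≤e)) h
      where
      go : ∀ m → ∃ λ x → K x × Ord≥ (e ℤ.+ + m) (α - x)
      go zero    = x₀ , x₀∈ , ord-≤ (ℤ.≤-reflexive (ℤ.+-identityʳ e)) start
      go (suc m) = let x , x∈ , h = go m in step m x∈ h

    module _ (b-int : Ord≥ (+ 0) b) (c-int : Ord≥ (+ 0) c) where

      -- α³ = -(bα + c)
      root-integral : ∀ {α} → α * α * α + b * α + c ≈ 0# → Ord≥ (+ 0) α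
      root-integral {α} f[α]≈0 α# = from (ℤ.≤-total (+ 0) (v α α#))
        where
        i = v α α#
        α²# = x#0y#0→xy#0 α# α#
        α³# = x#0y#0→xy#0 α²# α#
        from : + 0 ≤ i ⊎ i ≤ + 0 → + 0 ≤ i
        from (inj₁ h) = h
        from (inj₂ i≤0) = ≥0 (ℤ.≤-total (+ 0) i)
          where
          α³≥ : Ord≥ i (α * α * α)
          α³≥ = ord-cong (sym (modulo₁ 1# (solve 3 (λ α b c → α :* α :* α := :- (b :* α :+ c) :+ con (+ 1) :* (α :* α :* α :+ b :* α :+ c)) refl α b c) f[α]≈0))
             (ord-neg (ord-+ (ord-₀* b-int (ord-v α# ≡.refl)) (ord-≤ i≤0 c-int)))
          i≤3i : i ≤ i ℤ.+ i ℤ.+ i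
          i≤3i = ℤ.≤-trans (α³≥ α³#) (ℤ.≤-reflexive (≡.trans (v-* α²# α# α³#) (≡.cong (ℤ._+ i) (v-* α# α# α²#))))
          0≤2i : + 0 ≤ i ℤ.+ i
          0≤2i = +-cancelʳ-≤ (+ 0) (i ℤ.+ i) i (ℤ.≤-trans (ℤ.≤-reflexive (ℤ.+-identityˡ i)) i≤3i)
          ≥0 : + 0 ≤ i ⊎ i ≤ + 0 → + 0 ≤ i
          ≥0 (inj₁ h) = h
          ≥0 (inj₂ i≤0) = ℤ.≤-trans 0≤2i (ℤ.≤-trans (ℤ.+-monoʳ-≤ i i≤0) (ℤ.≤-reflexive (ℤ.+-identityʳ i)))

    -- The discriminant
    D : Carrier
    D = - int (+ 4) * (b * b * b) - int (+ 27) * (c * c)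

    unit≱1 : ∀ {x y} → x * y ≈ 1# → Ord≥ (+ 1) x → Ord≥ (+ 0) y → ⊥
    unit≱1 xy≈1 hx hy = from (ℤ.≤-trans (ord-cong xy≈1 (ord-*₀ hx hy) 1#0) (ℤ.≤-reflexive (v-1 1#0)))
      where
      from : + 1 ≤ + 0 → ⊥
      from (ℤ.+≤+ ())

    v≡0 : ∀ {x} x# → Ord≥ (+ 0) x → v x x# < + 1 → v x x# ≡ + 0
    v≡0 x# h v<1 = ℤ.≤-antisym (<1⇒≤0 v<1) (h x#)

    some-factor : ∀ {x y z} → Ord≥ (+ 1) (x * (y * z)) → Ord≥ (+ 1) x ⊎ Ord≥ (+ 1) y ⊎ Ord≥ (+ 1) z
    some-factor {x} {y} {z} h = from (ord? (+ 1) x) (ord? (+ 1) y) (ord? (+ 1) z)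
      where
      from : Ord≥ (+ 1) x ⊎ (∃ λ x# → v x x# < + 1) → Ord≥ (+ 1) y ⊎ (∃ λ y# → v y y# < + 1) →
             Ord≥ (+ 1) z ⊎ (∃ λ z# → v z z# < + 1) → Ord≥ (+ 1) x ⊎ Ord≥ (+ 1) y ⊎ Ord≥ (+ 1) z
      from (inj₁ hx) _ _ = inj₁ hx
      from _ (inj₁ hy) _ = inj₂ (inj₁ hy)
      from _ _ (inj₁ hz) = inj₂ (inj₂ hz)
      from (inj₂ (x# , vx)) (inj₂ (y# , vy)) (inj₂ (z# , vz)) = ⊥-elim (contra (ℤ.≤-trans (h xyz#) (ℤ.≤-trans
          (ℤ.≤-reflexive (≡.trans (v-* x# yz# xyz#) (≡.cong (λ k → v x x# ℤ.+ k) (v-* y# z# yz#))))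
          (ℤ.+-mono-≤ (<1⇒≤0 vx) (ℤ.+-mono-≤ (<1⇒≤0 vy) (<1⇒≤0 vz))))))
        where
        yz# = x#0y#0→xy#0 y# z#
        xyz# = x#0y#0→xy#0 x# yz#
        contra : + 1 ≤ + 0 → ⊥
        contra (ℤ.+≤+ ())

    module _ (b-int : Ord≥ (+ 0) b) (c-int : Ord≥ (+ 0) c) where

      -- The discriminant vanishes modulo the place but b does not. Then 3 is a unit, and
      -- f has a double root and the simple root 3c/b modulo the place.
      module SimpleRoot (b# : b # 0#) (vb≡0 : v b b# ≡ + 0) (D≥1 : Ord≥ (+ 1) D) where
        private
          u,bu≈1 : ∃ λ u → K u × b * u ≈ 1#
          u,bu≈1 = [ ⊥-elim ∘ #0⇒≉0 b# , (λ h → h) ]′ (zero? b∈)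
          u = proj₁ u,bu≈1
          u∈ = proj₁ (proj₂ u,bu≈1)
          bu≈1 = proj₂ (proj₂ u,bu≈1)
          u-int : Ord≥ (+ 0) u
          u-int = ord-inverse b# vb≡0 bu≈1

          3# : ∃ λ 3# → v (int (+ 3)) 3# ≡ + 0
          3# = [ (λ h → ⊥-elim (unit≱1 {x = b * b * b} {y = u * u * u}
                   (modulo₁ (b * b * u * u + b * u + 1#) (solve 2 (λ b u → b :* b :* b :* (u :* u :* u) := con (+ 1) :+ (b :* b :* u :* u :+ b :* u :+ con (+ 1)) :* (b :* u :- con (+ 1))) refl b u) (x-y≈0 bu≈1))
                   (b³≥1 h) (ord-*₀ (ord-*₀ u-int u-int) u-int)))
               , (λ (3# , v<1) → 3# , v≡0 3# (ord-int (+ 3)) v<1) ]′ (ord? (+ 1) (int (+ 3)))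
            where
            b³≥1 : Ord≥ (+ 1) (int (+ 3)) → Ord≥ (+ 1) (b * b * b)
            b³≥1 h = ord-cong (solve 2 (λ b c → :- (:- con (+ 4) :* (b :* b :* b) :- con (+ 27) :* (c :* c)) :+ :- (con (+ 3) :* (con (+ 9) :* (c :* c) :+ b :* b :* b)) := b :* b :* b) refl b c)
              (ord-+ (ord-neg D≥1) (ord-neg (ord-*₀ h (ord-+ (ord-*₀ (ord-int (+ 9)) (ord-*₀ c-int c-int)) (ord-*₀ (ord-*₀ b-int b-int) b-int)))))

          t,3t≈1 : ∃ λ t → K t × int (+ 3) * t ≈ 1#
          t,3t≈1 = [ ⊥-elim ∘ #0⇒≉0 (proj₁ 3#) , (λ h → h) ]′ (zero? (int∈ (+ 3)))
          t = proj₁ t,3t≈1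
          t∈ = proj₁ (proj₂ t,3t≈1)
          3t≈1 = proj₂ (proj₂ t,3t≈1)
          t-int : Ord≥ (+ 0) t
          t-int = ord-inverse (proj₁ 3#) (proj₂ 3#) 3t≈1

        x₀ : Carrier
        x₀ = int (+ 3) * c * u
        x₀∈ : K x₀
        x₀∈ = *∈ (*∈ (int∈ (+ 3)) c∈) u∈
        x₀-int : Ord≥ (+ 0) x₀
        x₀-int = ord-*₀ (ord-*₀ (ord-int (+ 3)) c-int) u-int

        -- The product of the differences is c D / b³.
        near : ∀ {α β γ} → Roots b c α β γ → Ord≥ (+ 1) (α - x₀) ⊎ Ord≥ (+ 1) (β - x₀) ⊎ Ord≥ (+ 1) (γ - x₀)
        near {α} {β} {γ} roots = some-factor (ord-cong (sym product≈) (ord-₀* (ord-*₀ (ord-*₀ (ord-*₀ c-int u-int) u-int) u-int) D≥1))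
          where
          f[x₀]≈ : x₀ * x₀ * x₀ + b * x₀ + c ≈ - (c * u * u * u * D)
          f[x₀]≈ = modulo₁ (int (+ 3) * c - int (+ 4) * c * (b * b * u * u + b * u + 1#)) (solve 3 (λ b c u → let x = con (+ 3) :* c :* u in
             x :* x :* x :+ b :* x :+ c := :- (c :* u :* u :* u :* (:- con (+ 4) :* (b :* b :* b) :- con (+ 27) :* (c :* c)))
               :+ (con (+ 3) :* c :- con (+ 4) :* c :* (b :* b :* u :* u :+ b :* u :+ con (+ 1))) :* (b :* u :- con (+ 1))) refl b c u) (x-y≈0 bu≈1)
          product≈ : (α - x₀) * ((β - x₀) * (γ - x₀)) ≈ c * u * u * u * D
          product≈ = trans (modulo₃ (x₀ * x₀) (- x₀) 1# (solve 6 (λ α β γ x b c → (α :- x) :* ((β :- x) :* (γ :- x)) := :- (x :* x :* x :+ b :* x :+ c)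
              :+ x :* x :* (α :+ β :+ γ) :+ :- x :* (α :* β :+ β :* γ :+ γ :* α :- b) :+ con (+ 1) :* (α :* β :* γ :- :- c)) refl α β γ x₀ b c)
              (Roots.sum roots) (x-y≈0 (Roots.pairs roots)) (x-y≈0 (Roots.product roots)))
            (trans (-‿cong f[x₀]≈) (solve 1 (λ x → :- :- x := x) refl (c * u * u * u * D)))

        -- The iteration x ↦ x + f(x)/(3b); note that f′(3c/b) = -3b modulo D.
        limit : ∀ {α} → α * α * α + b * α + c ≈ 0# → Ord≥ (+ 1) (α - x₀) → ∀ m → ∃ λ x → K x × Ord≥ (+ m) (α - x)
        limit {α} f[α]≈0 start = contraction (+ 1) (ℤ.+≤+ ℕ.z≤n) (x₀ , x₀∈ , start) step
          where
          α-int = root-integral b-int c-int f[α]≈0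
          step : ∀ {x} m → K x → Ord≥ (+ 1 ℤ.+ + m) (α - x) → ∃ λ x′ → K x′ × Ord≥ (+ 1 ℤ.+ + suc m) (α - x′)
          step {x} m x∈ h = x + (x * x * x + b * x + c) * (t * u)
            , +∈ x∈ (*∈ (+∈ (+∈ (*∈ (*∈ x∈ x∈) x∈) (*∈ b∈ x∈)) c∈) (*∈ t∈ u∈))
            , ord-≤ (ℤ.≤-reflexive (≡.cong +_ (ℕ.+-comm 1 (suc m)))) (ord-cong (sym α-x′≈) (ord-* h (ord-*₀ factor≥1 (ord-*₀ t-int u-int))))
            where
            h₁ : Ord≥ (+ 1) (α - x)
            h₁ = ord-≤ (ℤ.+≤+ (ℕ.s≤s ℕ.z≤n)) h
            x-int : Ord≥ (+ 0) x
            x-int = ord-cong (solve 2 (λ α x → α :- (α :- x) := x) refl α x) (ord-+ α-int (ord-neg (ord-≤ (ℤ.+≤+ ℕ.z≤n) h₁)))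
            factor = x * x + x * α + α * α + int (+ 4) * b
            α-x′≈ : α - (x + (x * x * x + b * x + c) * (t * u)) ≈ (α - x) * (factor * (t * u))
            α-x′≈ = modulo₃ (- (t * u)) (- (α - x) * (b * u)) (- (α - x)) (solve 6 (λ α x b c t u →
               α :- (x :+ (x :* x :* x :+ b :* x :+ c) :* (t :* u)) := (α :- x) :* ((x :* x :+ x :* α :+ α :* α :+ con (+ 4) :* b) :* (t :* u))
               :+ :- (t :* u) :* (α :* α :* α :+ b :* α :+ c) :+ :- (α :- x) :* (b :* u) :* (con (+ 3) :* t :- con (+ 1))
               :+ :- (α :- x) :* (b :* u :- con (+ 1))) refl α x b c t u) f[α]≈0 (x-y≈0 3t≈1) (x-y≈0 bu≈1)
            factor≈ : factor ≈ (α - x) * - (x + int (+ 2) * α) + (α - x₀) * (int (+ 3) * (α + x₀)) + - D * (u * u)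
            factor≈ = modulo₁ (- (int (+ 4) * b * (b * u + 1#))) (solve 5 (λ α x b c u → let x₀ = con (+ 3) :* c :* u in
               x :* x :+ x :* α :+ α :* α :+ con (+ 4) :* b := (α :- x) :* :- (x :+ con (+ 2) :* α) :+ (α :- x₀) :* (con (+ 3) :* (α :+ x₀))
               :+ :- (:- con (+ 4) :* (b :* b :* b) :- con (+ 27) :* (c :* c)) :* (u :* u)
               :+ :- (con (+ 4) :* b :* (b :* u :+ con (+ 1))) :* (b :* u :- con (+ 1))) refl α x b c u) (x-y≈0 bu≈1)
            factor≥1 : Ord≥ (+ 1) factor
            factor≥1 = ord-cong (sym factor≈) (ord-+ (ord-+
              (ord-*₀ h₁ (ord-neg (ord-+ x-int (ord-*₀ (ord-int (+ 2)) α-int))))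
              (ord-*₀ start (ord-*₀ (ord-int (+ 3)) (ord-+ α-int x₀-int))))
              (ord-*₀ (ord-neg D≥1) (ord-*₀ u-int u-int)))

      -- If b has order e > 0 and c has order at least 2e then f has a root of order at
      -- least e, which is a limit of elements of K.
      module SmallRoot {e} (b# : b # 0#) (vb≡e : v b b# ≡ e) (1≤e : + 1 ≤ e) (c≥2e : Ord≥ (e ℤ.+ e) c) where
        private
          u,bu≈1 : ∃ λ u → K u × b * u ≈ 1#
          u,bu≈1 = [ ⊥-elim ∘ #0⇒≉0 b# , (λ h → h) ]′ (zero? b∈)
          u = proj₁ u,bu≈1
          u∈ = proj₁ (proj₂ u,bu≈1)
          bu≈1 = proj₂ (proj₂ u,bu≈1)
          u-ord : Ord≥ (ℤ.- e) u
          u-ord = ord-inverse b# vb≡e bu≈1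
          0≤e : + 0 ≤ e
          0≤e = ℤ.≤-trans (ℤ.+≤+ ℕ.z≤n) 1≤e

        -- If all roots had order less than e, the products of two of them would have order
        -- greater than e, as αβγ = -c; but their sum is b.
        near : ∀ {α β γ} → Roots b c α β γ → Ord≥ e α ⊎ Ord≥ e β ⊎ Ord≥ e γ
        near {α} {β} {γ} roots = from (ord? e α) (ord? e β) (ord? e γ)
          where
          pair : ∀ {x y z} → x * y * z ≈ - c → (∃ λ z# → v z z# < e) → Ord≥ (ℤ.suc e) (x * y)
          pair {x} {y} {z} eq (z# , vz<e) = ord-divide {m = ℤ.suc e} z# ≡.refl (ord-≤
              (ℤ.≤-trans (ℤ.≤-reflexive (ℤS.solve 2 (λ e k → ℤS.con (+ 1) ℤS.:+ e ℤS.:+ k ℤS.:= e ℤS.:+ (ℤS.con (+ 1) ℤS.:+ k)) ≡.refl e (v z z#)))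
                (ℤ.+-monoʳ-≤ e (ℤ.i<j⇒suc[i]≤j vz<e)))
              (ord-cong (sym eq) (ord-neg c≥2e)))
          from : Ord≥ e α ⊎ (∃ λ α# → v α α# < e) → Ord≥ e β ⊎ (∃ λ β# → v β β# < e) → Ord≥ e γ ⊎ (∃ λ γ# → v γ γ# < e) →
                 Ord≥ e α ⊎ Ord≥ e β ⊎ Ord≥ e γ
          from (inj₁ h) _ _ = inj₁ h
          from _ (inj₁ h) _ = inj₂ (inj₁ h)
          from _ _ (inj₁ h) = inj₂ (inj₂ h)
          from (inj₂ α<) (inj₂ β<) (inj₂ γ<) = ⊥-elim (<⇒¬ord b# (ℤ.suc[i]≤j⇒i<j (ℤ.≤-reflexive (≡.cong ℤ.suc vb≡e)))
            (ord-cong (Roots.pairs roots) (ord-+ (ord-+ (pair (Roots.product roots) γ<) (pair (Roots.product (rotate roots)) α<))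
              (pair (Roots.product (rotate (rotate roots))) β<))))

        -- The iteration x ↦ -(c + x³)/b
        limit : ∀ {α} → α * α * α + b * α + c ≈ 0# → Ord≥ e α → ∀ m → ∃ λ x → K x × Ord≥ (+ m) (α - x)
        limit {α} f[α]≈0 α≥e = contraction e 0≤e (0# , int∈ (+ 0) , ord-cong (solve 1 (λ α → α := α :- con (+ 0)) refl α) α≥e) step
          where
          step : ∀ {x} m → K x → Ord≥ (e ℤ.+ + m) (α - x) → ∃ λ x′ → K x′ × Ord≥ (e ℤ.+ + suc m) (α - x′)
          step {x} m x∈ h = - (c + x * x * x) * u , *∈ (-∈ (+∈ c∈ (*∈ (*∈ x∈ x∈) x∈))) u∈
            , ord-≤ bound (ord-cong (sym α-x′≈) (ord-* (ord-* h (ord-neg factor≥2e)) u-ord))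
            where
            x≥e : Ord≥ e x
            x≥e = ord-cong (solve 2 (λ α x → α :- (α :- x) := x) refl α x) (ord-+ α≥e (ord-neg (ord-≤
              (ℤ.≤-trans (ℤ.≤-reflexive (≡.sym (ℤ.+-identityʳ e))) (ℤ.+-monoʳ-≤ e (ℤ.+≤+ ℕ.z≤n))) h)))
            factor≥2e : Ord≥ (e ℤ.+ e) (α * α + α * x + x * x)
            factor≥2e = ord-+ (ord-+ (ord-* α≥e α≥e) (ord-* α≥e x≥e)) (ord-* x≥e x≥e)
            α-x′≈ : α - - (c + x * x * x) * u ≈ (α - x) * - (α * α + α * x + x * x) * u
            α-x′≈ = modulo₂ u (- α) (solve 5 (λ α x b c u → α :- :- (c :+ x :* x :* x) :* u := (α :- x) :* :- (α :* α :+ α :* x :+ x :* x) :* u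
               :+ u :* (α :* α :* α :+ b :* α :+ c) :+ :- α :* (b :* u :- con (+ 1))) refl α x b c u) f[α]≈0 (x-y≈0 bu≈1)
            bound : e ℤ.+ + suc m ≤ e ℤ.+ + m ℤ.+ (e ℤ.+ e) ℤ.+ ℤ.- e
            bound = ℤ.≤-trans (ℤ.≤-reflexive (ℤS.solve 2 (λ e m → e ℤS.:+ (ℤS.con (+ 1) ℤS.:+ m) ℤS.:= e ℤS.:+ m ℤS.:+ ℤS.con (+ 1)) ≡.refl e (+ m)))
              (ℤ.≤-trans (ℤ.+-monoʳ-≤ (e ℤ.+ + m) 1≤e)
              (ℤ.≤-reflexive (ℤS.solve 2 (λ e m → e ℤS.:+ m ℤS.:+ e ℤS.:= e ℤS.:+ m ℤS.:+ (e ℤS.:+ e) ℤS.:+ ℤS.:- e) ≡.refl e (+ m))))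

    module _ (b-int : Ord≥ (+ 0) b) (c-int : Ord≥ (+ 0) c) where

      -- The discriminant is a unit at the place.
      module Separable (D#v : ∃ λ D# → v D D# ≡ + 0) where

        √disc-unit : ∀ {α β γ} (roots : Roots b c α β γ) → ∃ λ s# → v (√disc roots) s# ≡ + 0
        √disc-unit roots = s# , i+i≡0⇒i≡0 _ (≡.trans (≡.sym (v-* s# s# s²#)) (≡.trans (v-cong s²# (proj₁ D#v) (√disc-square roots)) (proj₂ D#v)))
          where
          s# = ≉0⇒#0 λ s≈0 → #0⇒≉0 (proj₁ D#v) (trans (sym (√disc-square roots)) (trans (*-congʳ s≈0) (zeroˡ _)))
          s²# = x#0y#0→xy#0 s# s#

        -- By Cramer's rule, as the Vandermonde determinant of α, β, γ is a unit.
        coefficients-ord : ∀ {α β γ} → Roots b c α β γ → ∀ {m} P → Ord≥ m (ev P α) → Ord≥ m (ev P β) → Ord≥ m (ev P γ) →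
                           Ord≥ m (k₀ P) × Ord≥ m (k₁ P) × Ord≥ m (k₂ P)
        coefficients-ord {α} {β} {γ} roots {m} P h₀ h₁ h₂ =
            divide (solve 6 (λ p q r α β γ → let x = p :+ q :* α :+ r :* (α :* α) ; y = p :+ q :* β :+ r :* (β :* β) ; z = p :+ q :* γ :+ r :* (γ :* γ) in
                 :- (x :* (β :* γ :* (β :- γ)) :+ y :* (γ :* α :* (γ :- α)) :+ z :* (α :* β :* (α :- β))) := p :* ((α :- β) :* (β :- γ) :* (γ :- α))) refl (k₀ P) (k₁ P) (k₂ P) α β γ)
              (ord-neg (combine (ord-*₀ (ord-*₀ β-int γ-int) β-γ) (ord-*₀ (ord-*₀ γ-int α-int) γ-α) (ord-*₀ (ord-*₀ α-int β-int) α-β)))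
          , divide (solve 6 (λ p q r α β γ → let x = p :+ q :* α :+ r :* (α :* α) ; y = p :+ q :* β :+ r :* (β :* β) ; z = p :+ q :* γ :+ r :* (γ :* γ) in
                 x :* ((β :+ γ) :* (β :- γ)) :+ y :* ((γ :+ α) :* (γ :- α)) :+ z :* ((α :+ β) :* (α :- β)) := q :* ((α :- β) :* (β :- γ) :* (γ :- α))) refl (k₀ P) (k₁ P) (k₂ P) α β γ)
              (combine (ord-*₀ (ord-+ β-int γ-int) β-γ) (ord-*₀ (ord-+ γ-int α-int) γ-α) (ord-*₀ (ord-+ α-int β-int) α-β))
          , divide (solve 6 (λ p q r α β γ → let x = p :+ q :* α :+ r :* (α :* α) ; y = p :+ q :* β :+ r :* (β :* β) ; z = p :+ q :* γ :+ r :* (γ :* γ) in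
                 :- (x :* (β :- γ) :+ y :* (γ :- α) :+ z :* (α :- β)) := r :* ((α :- β) :* (β :- γ) :* (γ :- α))) refl (k₀ P) (k₁ P) (k₂ P) α β γ)
              (ord-neg (combine β-γ γ-α α-β))
          where
          α-int = root-integral b-int c-int (root roots)
          β-int = root-integral b-int c-int (root (rotate roots))
          γ-int = root-integral b-int c-int (root (rotate (rotate roots)))
          α-β = ord-+ α-int (ord-neg β-int)
          β-γ = ord-+ β-int (ord-neg γ-int)
          γ-α = ord-+ γ-int (ord-neg α-int)
          combine : ∀ {x y z} → Ord≥ (+ 0) x → Ord≥ (+ 0) y → Ord≥ (+ 0) z → Ord≥ m (ev P α * x + ev P β * y + ev P γ * z)
          combine hx hy hz = ord-+ (ord-+ (ord-*₀ h₀ hx) (ord-*₀ h₁ hy)) (ord-*₀ h₂ hz)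
          divide : ∀ {x y} → x ≈ y * √disc roots → Ord≥ m x → Ord≥ m y
          divide {x} {y} eq h = ord-divide {m = m} (proj₁ (√disc-unit roots)) (proj₂ (√disc-unit roots))
            (ord-≤ (ℤ.≤-reflexive (ℤ.+-identityʳ m)) (ord-cong eq h))

        -- The least of the valuations of three conjugates is the least valuation of their coefficients.
        least : ∀ {α β γ} → Roots b c α β γ → ∀ P {m} y# → v (ev P α) y# ≡ m → Ord≥ m (ev P β) → Ord≥ m (ev P γ) → Value m
        least {α} roots P {m} y# vy≡m h₁ h₂ = from (ord? (ℤ.suc m) (k₀ P)) (ord? (ℤ.suc m) (k₁ P)) (ord? (ℤ.suc m) (k₂ P))
          where
          α-int = root-integral b-int c-int (root roots)
          hs = coefficients-ord roots P (ord-v y# vy≡m) h₁ h₂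
          value : ∀ {x} → K x → Ord≥ m x → (∃ λ x# → v x x# < ℤ.suc m) → Value m
          value {x} x∈ h (x# , lt) = x , x# , x∈ , ℤ.≤-antisym
            (≡.subst₂ _≤_ (ℤ.pred-suc (v x x#)) (ℤ.pred-suc m) (ℤ.pred-mono (ℤ.i<j⇒suc[i]≤j lt))) (h x#)
          from : Ord≥ (ℤ.suc m) (k₀ P) ⊎ (∃ λ x# → v (k₀ P) x# < ℤ.suc m) → Ord≥ (ℤ.suc m) (k₁ P) ⊎ (∃ λ x# → v (k₁ P) x# < ℤ.suc m) →
                 Ord≥ (ℤ.suc m) (k₂ P) ⊎ (∃ λ x# → v (k₂ P) x# < ℤ.suc m) → Value m
          from (inj₂ lt) _ _ = value (k₀∈ P) (proj₁ hs) lt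
          from _ (inj₂ lt) _ = value (k₁∈ P) (proj₁ (proj₂ hs)) lt
          from _ _ (inj₂ lt) = value (k₂∈ P) (proj₂ (proj₂ hs)) lt
          from (inj₁ l₀) (inj₁ l₁) (inj₁ l₂) = ⊥-elim (<⇒¬ord y# (ℤ.suc[i]≤j⇒i<j (ℤ.≤-reflexive (≡.cong ℤ.suc vy≡m)))
            (ord-+ (ord-+ l₀ (ord-*₀ l₁ α-int)) (ord-*₀ l₂ (ord-*₀ α-int α-int))))

        -- The values of the three conjugates of y are values on K. The least one is, and so
        -- are the least value of a product of two conjugates and the value of the norm. If
        -- the value of y is the greatest one, it is the difference of the latter two; if it
        -- is the middle one, it is the difference of the second and the first.
        separable : ∀ {α β γ} → Roots b c α β γ → ∀ {y n} y# → v y y# ≡ n → ∀ P → y ≈ ev P α → Value n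
        separable {α} {β} {γ} roots {y} {n} y# vy≡n P y≈ = ≡.subst Value (≡.trans (v-cong y₀# y# (sym y≈)) vy≡n)
            (from (ℤ.≤-total h₀ h₁) (ℤ.≤-total h₀ h₂))
          where
          roots′ = rotate roots
          roots″ = rotate roots′
          y₀# : ev P α # 0#
          y₀# = #-congʳ y≈ y#
          y₁# : ev P β # 0#
          y₁# = ≉0⇒#0 (ev≉0 (root roots) (root roots′) P (#0⇒≉0 y₀#))
          y₂# : ev P γ # 0#
          y₂# = ≉0⇒#0 (ev≉0 (root roots) (root roots″) P (#0⇒≉0 y₀#))
          h₀ = v (ev P α) y₀#
          h₁ = v (ev P β) y₁#
          h₂ = v (ev P γ) y₂#
          Q = adj P
          -- the conjugates P(β) P(γ), P(γ) P(α), P(α) P(β) of Q(α)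
          q₀# : ev Q α # 0#
          q₀# = #-congʳ (sym (ev-adj roots P)) (x#0y#0→xy#0 y₁# y₂#)
          q₀≡ : v (ev Q α) q₀# ≡ h₁ ℤ.+ h₂
          q₀≡ = ≡.trans (v-cong q₀# (x#0y#0→xy#0 y₁# y₂#) (ev-adj roots P)) (v-* y₁# y₂# _)
          q₁# : ev Q β # 0#
          q₁# = #-congʳ (sym (ev-adj roots′ P)) (x#0y#0→xy#0 y₂# y₀#)
          q₁≡ : v (ev Q β) q₁# ≡ h₂ ℤ.+ h₀
          q₁≡ = ≡.trans (v-cong q₁# (x#0y#0→xy#0 y₂# y₀#) (ev-adj roots′ P)) (v-* y₂# y₀# _)
          q₂# : ev Q γ # 0#
          q₂# = #-congʳ (sym (ev-adj roots″ P)) (x#0y#0→xy#0 y₀# y₁#)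
          q₂≡ : v (ev Q γ) q₂# ≡ h₀ ℤ.+ h₁
          q₂≡ = ≡.trans (v-cong q₂# (x#0y#0→xy#0 y₀# y₁#) (ev-adj roots″ P)) (v-* y₀# y₁# _)

          ord-from : ∀ {x m n} x# → v x x# ≡ n → m ≤ n → Ord≥ m x
          ord-from x# eq m≤n = ord-≤ m≤n (ord-v x# eq)

          norm-value : Value (h₀ ℤ.+ (h₁ ℤ.+ h₂))
          norm-value = norm P , N# , norm∈ P , ≡.trans (v-cong N# yq# (norm≈ roots P)) (≡.trans (v-* y₀# q₀# yq#) (≡.cong (λ k → h₀ ℤ.+ k) q₀≡))
            where
            yq# = x#0y#0→xy#0 y₀# q₀#
            N# = #-congʳ (sym (norm≈ roots P)) yq#

          from : h₀ ≤ h₁ ⊎ h₁ ≤ h₀ → h₀ ≤ h₂ ⊎ h₂ ≤ h₀ → Value h₀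
          from (inj₁ h₀≤h₁) (inj₁ h₀≤h₂) = least roots P y₀# ≡.refl (ord-from y₁# ≡.refl h₀≤h₁) (ord-from y₂# ≡.refl h₀≤h₂)
          from (inj₂ h₁≤h₀) (inj₂ h₂≤h₀) = value-cancel norm-value (least roots Q q₀# q₀≡
             (ord-from q₁# q₁≡ (ℤ.≤-trans (ℤ.≤-reflexive (ℤ.+-comm h₁ h₂)) (ℤ.+-monoʳ-≤ h₂ h₁≤h₀)))
             (ord-from q₂# q₂≡ (ℤ.≤-trans (ℤ.+-monoʳ-≤ h₁ h₂≤h₀) (ℤ.≤-reflexive (ℤ.+-comm h₁ h₀)))))
          from (inj₂ h₁≤h₀) (inj₁ h₀≤h₂) = value-cancel
             (least roots″ Q q₂# q₂≡
               (ord-from q₀# q₀≡ (ℤ.≤-trans (ℤ.≤-reflexive (ℤ.+-comm h₀ h₁)) (ℤ.+-monoʳ-≤ h₁ h₀≤h₂)))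
               (ord-from q₁# q₁≡ (ℤ.≤-trans (ℤ.+-monoʳ-≤ h₀ (ℤ.≤-trans h₁≤h₀ h₀≤h₂)) (ℤ.≤-reflexive (ℤ.+-comm h₀ h₂)))))
             (least roots′ P y₁# ≡.refl (ord-from y₂# ≡.refl (ℤ.≤-trans h₁≤h₀ h₀≤h₂)) (ord-from y₀# ≡.refl h₁≤h₀))
          from (inj₁ h₀≤h₁) (inj₂ h₂≤h₀) = value-cancel
             (≡.subst Value (ℤ.+-comm h₂ h₀) (least roots′ Q q₁# q₁≡
               (ord-from q₂# q₂≡ (ℤ.≤-trans (ℤ.≤-reflexive (ℤ.+-comm h₂ h₀)) (ℤ.+-monoʳ-≤ h₀ (ℤ.≤-trans h₂≤h₀ h₀≤h₁))))
               (ord-from q₀# q₀≡ (ℤ.≤-trans (ℤ.+-monoʳ-≤ h₂ h₀≤h₁) (ℤ.≤-reflexive (ℤ.+-comm h₂ h₁))))))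
             (least roots″ P y₂# ≡.refl (ord-from y₀# ≡.refl h₂≤h₀) (ord-from y₁# ≡.refl (ℤ.≤-trans h₂≤h₀ h₀≤h₁)))

      -- Every value is a value on K, if 2 v(b) ≤ v(c) whenever b and D have positive order.
      unramified : ∀ {α β γ} → Roots b c α β γ →
        (∀ x → ∃ λ P → x ≈ ev P α) → (∀ x → ∃ λ P → x ≈ ev P β) → (∀ x → ∃ λ P → x ≈ ev P γ) →
        D # 0# → b # 0# → (∀ b# → Ord≥ (+ 1) b → Ord≥ (+ 1) D → Ord≥ (v b b# ℤ.+ v b b#) c) →
        ∀ n → Value n
      unramified {α} {β} {γ} roots everyα everyβ everyγ D# b# ramified-c n = cases (ord? (+ 1) D) (ord? (+ 1) b)
        where
        y = proj₁ (surjective n)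
        y# = proj₁ (proj₂ (surjective n))
        vy≡n = proj₂ (proj₂ (surjective n))
        D-int : Ord≥ (+ 0) D
        D-int = ord-+ (ord-*₀ (ord-neg (ord-int (+ 4))) (ord-*₀ (ord-*₀ b-int b-int) b-int)) (ord-neg (ord-*₀ (ord-int (+ 27)) (ord-*₀ c-int c-int)))
        by-density : ∀ {x} → x * x * x + b * x + c ≈ 0# → (∀ y → ∃ λ P → y ≈ ev P x) → (∀ m → ∃ λ k → K k × Ord≥ (+ m) (x - k)) → Value n
        by-density f[x]≈0 every limit = dense (root-integral b-int c-int f[x]≈0) limit y# vy≡n (proj₁ (every y)) (proj₂ (every y))
        f[α] = root roots
        f[β] = root (rotate roots)
        f[γ] = root (rotate (rotate roots))
        cases : Ord≥ (+ 1) D ⊎ (∃ λ D# → v D D# < + 1) → Ord≥ (+ 1) b ⊎ (∃ λ b# → v b b# < + 1) → Value n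
        cases (inj₂ (D# , vD<1)) _ = Separable.separable (D# , v≡0 D# D-int vD<1) roots y# vy≡n (proj₁ (everyα y)) (proj₂ (everyα y))
        cases (inj₁ D≥1) (inj₂ (b# , vb<1)) =
          [ by-density f[α] everyα ∘ SR.limit f[α] , [ by-density f[β] everyβ ∘ SR.limit f[β] , by-density f[γ] everyγ ∘ SR.limit f[γ] ]′ ]′ (SR.near roots)
          where
          module SR = SimpleRoot b-int c-int b# (v≡0 b# b-int vb<1) D≥1
        cases (inj₁ D≥1) (inj₁ b≥1) =
          [ by-density f[α] everyα ∘ SR.limit f[α] , [ by-density f[β] everyβ ∘ SR.limit f[β] , by-density f[γ] everyγ ∘ SR.limit f[γ] ]′ ]′ (SR.near roots)
          where
          module SR = SmallRoot b-int c-int b# ≡.refl (b≥1 b#) (ramified-c b# b≥1 D≥1)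

-- Infinite places

-- Commutative rings in which a vanishing sum of two squares has vanishing terms
module FormallyReal {r ℓ} (R : CommutativeRing r ℓ)
  (squares-vanish : ∀ x y → CommutativeRing._≈_ R
    (CommutativeRing._+_ R (CommutativeRing._*_ R x x) (CommutativeRing._*_ R y y)) (CommutativeRing.0# R) →
    CommutativeRing._≈_ R x (CommutativeRing.0# R)) where
  open CommutativeRing R hiding (zero)
  open IntegerSolver R

  -- If x + iy is a root of the real polynomial X³ + BX + C whose discriminant is
  -- a square then y = 0: otherwise the discriminant is -4y²(9x² + y²)² < 0.
  real-cubic : ∀ x y B C ρ → x * x * x - int (+ 3) * x * y * y + B * x + C ≈ 0# →
               int (+ 3) * x * x * y - y * y * y + B * y ≈ 0# →
               ρ * ρ ≈ - int (+ 4) * (B * B * B) - int (+ 27) * (C * C) → y ≈ 0#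
  real-cubic x y B C ρ real-part imaginary-part ρ²≈ = y≈0
    where
    t C′ C₀ B₀ g : Carrier
    t = y * (int (+ 9) * x * x + y * y)
    B₀ = y * y - int (+ 3) * x * x
    C′ = - (x * x * x - int (+ 3) * x * y * y + B * x)
    C₀ = int (+ 2) * x * (x * x + y * y)
    g = - int (+ 4) * (B * B + B * B₀ + B₀ * B₀) + int (+ 27) * x * (C′ + C₀)

    squares : (int (+ 2) * y * t) * (int (+ 2) * y * t) + (y * ρ) * (y * ρ) ≈ 0#
    squares = modulo₃ (y * y) (y * g) (- (int (+ 27) * y * y) * (C + C′)) (solve 5 (λ x y B C ρ →
        let t = y :* (con (+ 9) :* x :* x :+ y :* y)
            B₀ = y :* y :- con (+ 3) :* x :* x
            C′ = :- (x :* x :* x :- con (+ 3) :* x :* y :* y :+ B :* x)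
            C₀ = con (+ 2) :* x :* (x :* x :+ y :* y)
            g = :- con (+ 4) :* (B :* B :+ B :* B₀ :+ B₀ :* B₀) :+ con (+ 27) :* x :* (C′ :+ C₀)
        in (con (+ 2) :* y :* t) :* (con (+ 2) :* y :* t) :+ (y :* ρ) :* (y :* ρ) := con (+ 0)
        :+ y :* y :* (ρ :* ρ :- (:- con (+ 4) :* (B :* B :* B) :- con (+ 27) :* (C :* C)))
        :+ y :* g :* (con (+ 3) :* x :* x :* y :- y :* y :* y :+ B :* y)
        :+ :- (con (+ 27) :* y :* y) :* (C :+ C′) :* (x :* x :* x :- con (+ 3) :* x :* y :* y :+ B :* x :+ C)) refl x y B C ρ)
        (x-y≈0 ρ²≈) imaginary-part real-part

    yt≈0 : y * t ≈ 0#
    yt≈0 = squares-vanish (y * t) (y * t) (trans (solve 2 (λ y t → y :* t :* (y :* t) :+ y :* t :* (y :* t) := y :* t :* (con (+ 2) :* y :* t)) refl y t)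
      (trans (*-congˡ (squares-vanish (int (+ 2) * y * t) (y * ρ) squares)) (zeroʳ (y * t))))

    y²≈0 : y * y ≈ 0#
    y²≈0 = squares-vanish (y * y) (int (+ 3) * x * y) (trans (solve 2 (λ x y →
      y :* y :* (y :* y) :+ con (+ 3) :* x :* y :* (con (+ 3) :* x :* y) := y :* (y :* (con (+ 9) :* x :* x :+ y :* y))) refl x y) yt≈0)

    y≈0 : y ≈ 0#
    y≈0 = squares-vanish y 0# (trans (solve 1 (λ y → y :* y :+ con (+ 0) :* con (+ 0) := y :* y) refl y) y²≈0)


-- Embeddings of L into R[i] for a formally real ring R
module InfinitePlaces {a ℓ₁ ℓ₂ r ℓ} (L : HeytingField a ℓ₁ ℓ₂) (R : CommutativeRing r ℓ)
  (squares-vanish : ∀ x y → CommutativeRing._≈_ R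
    (CommutativeRing._+_ R (CommutativeRing._*_ R x x) (CommutativeRing._*_ R y y)) (CommutativeRing.0# R) →
    CommutativeRing._≈_ R x (CommutativeRing.0# R)) where
  open FieldTheory L
  open CubicExtension L
  open FormallyReal R squares-vanish
  private
    module R = CommutativeRing R
    module RS = IntegerSolver R
  open R using () renaming (Carrier to ℛ)

  -- A ring homomorphism x ↦ re x + i im x from L to R[i]
  record ComplexEmbedding : Set (a ⊔ ℓ₁ ⊔ r ⊔ ℓ) where
    field
      re im : Carrier → ℛ
      cong  : ∀ {x y} → x ≈ y → re x R.≈ re y × im x R.≈ im y
      +-homo : ∀ x y → re (x + y) R.≈ re x R.+ re y × im (x + y) R.≈ im x R.+ im y
      *-homo : ∀ x y → re (x * y) R.≈ re x R.* re y R.+ R.- (im x R.* im y) × im (x * y) R.≈ re x R.* im y R.+ im x R.* re y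
      -‿homo : ∀ x → re (- x) R.≈ R.- re x × im (- x) R.≈ R.- im x
      0-homo : re 0# R.≈ R.0# × im 0# R.≈ R.0#
      1-homo : re 1# R.≈ R.1# × im 1# R.≈ R.0#

  module _ (σ : ComplexEmbedding) where
    private module σ = ComplexEmbedding σ
    open σ using (re; im)

    -- The image of x is p + iq.
    Image : Carrier → ℛ → ℛ → Set ℓ
    Image x p q = (re x R.≈ p) × (im x R.≈ q)

    -- The image of x is real.
    Real′ : Carrier → Set ℓ
    Real′ x = im x R.≈ R.0#

    private variable
      x y z : Carrier
      p q p′ q′ : ℛ

    σ-cong : x ≈ y → Image x p q → Image y p q
    σ-cong {x} {y} x≈y (h , k) = R.trans (R.sym (proj₁ (σ.cong x≈y))) h , R.trans (R.sym (proj₂ (σ.cong x≈y))) k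

    σ-unique : Image x p q → Image x p′ q′ → (p R.≈ p′) × (q R.≈ q′)
    σ-unique (h , k) (h′ , k′) = R.trans (R.sym h) h′ , R.trans (R.sym k) k′

    σ-self : ∀ x → Image x (re x) (im x)
    σ-self x = R.refl , R.refl

    σ-+ : Image x p q → Image y p′ q′ → Image (x + y) (p R.+ p′) (q R.+ q′)
    σ-+ {x} {y = y} (h , k) (h′ , k′) = R.trans (proj₁ (σ.+-homo x y)) (R.+-cong h h′) , R.trans (proj₂ (σ.+-homo x y)) (R.+-cong k k′)

    σ-* : Image x p q → Image y p′ q′ → Image (x * y) (p R.* p′ R.+ R.- (q R.* q′)) (p R.* q′ R.+ q R.* p′)
    σ-* {x} {y = y} (h , k) (h′ , k′) =
        R.trans (proj₁ (σ.*-homo x y)) (R.+-cong (R.*-cong h h′) (R.-‿cong (R.*-cong k k′)))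
      , R.trans (proj₂ (σ.*-homo x y)) (R.+-cong (R.*-cong h k′) (R.*-cong k h′))

    σ-neg : Image x p q → Image (- x) (R.- p) (R.- q)
    σ-neg {x} (h , k) = R.trans (proj₁ (σ.-‿homo x)) (R.-‿cong h) , R.trans (proj₂ (σ.-‿homo x)) (R.-‿cong k)

    -- The image of x is p, with imaginary part zero.
    Image-ℝ : Carrier → ℛ → Set ℓ
    Image-ℝ x p = Image x p R.0#

    real : Real′ x → Image-ℝ x (re x)
    real h = R.refl , h

    image-ℝ-+ : Image-ℝ x p → Image-ℝ y p′ → Image-ℝ (x + y) (p R.+ p′)
    image-ℝ-+ h h′ = proj₁ (σ-+ h h′) , R.trans (proj₂ (σ-+ h h′)) (R.+-identityʳ R.0#)

    image-ℝ-neg : Image-ℝ x p → Image-ℝ (- x) (R.- p)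
    image-ℝ-neg h = proj₁ (σ-neg h) , R.trans (proj₂ (σ-neg h)) (RS.solve 0 (RS.:- RS.con (+ 0) RS.:= RS.con (+ 0)) R.refl)

    image-ℝ-* : Image-ℝ x p → Image-ℝ y p′ → Image-ℝ (x * y) (p R.* p′)
    image-ℝ-* {x} {p} {y} {p′} h h′ =
        R.trans (proj₁ (σ-* h h′)) (RS.solve 2 (λ p p′ → p RS.:* p′ RS.:+ RS.:- (RS.con (+ 0) RS.:* RS.con (+ 0)) RS.:= p RS.:* p′) R.refl p p′)
      , R.trans (proj₂ (σ-* h h′)) (RS.solve 2 (λ p p′ → p RS.:* RS.con (+ 0) RS.:+ RS.con (+ 0) RS.:* p′ RS.:= RS.con (+ 0)) R.refl p p′)

    image-0 : Image-ℝ 0# R.0#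
    image-0 = σ.0-homo

    image-int : ∀ n → Image-ℝ (int n) (RS.int n)
    image-int (+ n)    = go n
      where
      go : ∀ n → Image-ℝ (int (+ n)) (RS.int (+ n))
      go zero    = image-0
      go (suc n) = let h = σ-cong (sym (int-+ (+ 1) (+ n))) (image-ℝ-+ σ.1-homo (go n))
                   in R.trans (proj₁ h) (R.sym (RS.int-+ (+ 1) (+ n))) , proj₂ h
    image-int -[1+ n ] = image-ℝ-neg (image-int (+ suc n))

    -- If the images of b, c and √disc are real then so are those of the roots.
    real-root : ∀ {b c α β γ} (roots : Roots b c α β γ) → Real′ b → Real′ c → Real′ (√disc roots) → Real′ α
    real-root {b} {c} {α} roots b-real c-real s-real = η≈0
      where
      s = √disc roots
      ξ = re α
      η = im α
      B = re b
      C = re c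
      ρ = re s
      infixl 6 _+ᵣ_
      infixl 7 _*ᵣ_
      _+ᵣ_ _*ᵣ_ : ℛ → ℛ → ℛ
      _+ᵣ_ = R._+_
      _*ᵣ_ = R._*_

      α² : Image (α * α) (ξ *ᵣ ξ +ᵣ R.- (η *ᵣ η)) (ξ *ᵣ η +ᵣ η *ᵣ ξ)
      α² = σ-* (σ-self α) (σ-self α)
      f[α] : Image (α * α * α + b * α + c)
               ((ξ *ᵣ ξ +ᵣ R.- (η *ᵣ η)) *ᵣ ξ +ᵣ R.- ((ξ *ᵣ η +ᵣ η *ᵣ ξ) *ᵣ η) +ᵣ (B *ᵣ ξ +ᵣ R.- (R.0# *ᵣ η)) +ᵣ C)
               ((ξ *ᵣ ξ +ᵣ R.- (η *ᵣ η)) *ᵣ η +ᵣ (ξ *ᵣ η +ᵣ η *ᵣ ξ) *ᵣ ξ +ᵣ (B *ᵣ η +ᵣ R.0# *ᵣ ξ) +ᵣ R.0#)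
      f[α] = σ-+ (σ-+ (σ-* α² (σ-self α)) (σ-* (real b-real) (σ-self α))) (real c-real)
      f[α]≈0 = σ-unique f[α] (σ-cong (sym (root roots)) image-0)

      ρ²≈ : ρ *ᵣ ρ R.≈ R.- RS.int (+ 4) *ᵣ (B *ᵣ B *ᵣ B) +ᵣ R.- (RS.int (+ 27) *ᵣ (C *ᵣ C))
      ρ²≈ = proj₁ (σ-unique (σ-cong (√disc-square roots) (image-ℝ-* (real s-real) (real s-real)))
        (image-ℝ-+ (image-ℝ-* (image-ℝ-neg (image-int (+ 4))) (image-ℝ-* (image-ℝ-* (real b-real) (real b-real)) (real b-real)))
          (image-ℝ-neg (image-ℝ-* (image-int (+ 27)) (image-ℝ-* (real c-real) (real c-real))))))

      η≈0 : η R.≈ R.0#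
      η≈0 = real-cubic ξ η B C ρ
        (R.trans (RS.solve 4 (λ x y B C → x RS.:* x RS.:* x RS.:- RS.con (+ 3) RS.:* x RS.:* y RS.:* y RS.:+ B RS.:* x RS.:+ C RS.:=
            (x RS.:* x RS.:+ RS.:- (y RS.:* y)) RS.:* x RS.:+ RS.:- ((x RS.:* y RS.:+ y RS.:* x) RS.:* y) RS.:+ (B RS.:* x RS.:+ RS.:- (RS.con (+ 0) RS.:* y)) RS.:+ C) R.refl ξ η B C)
          (proj₁ f[α]≈0))
        (R.trans (RS.solve 3 (λ x y B → RS.con (+ 3) RS.:* x RS.:* x RS.:* y RS.:- y RS.:* y RS.:* y RS.:+ B RS.:* y RS.:=
            (x RS.:* x RS.:+ RS.:- (y RS.:* y)) RS.:* y RS.:+ (x RS.:* y RS.:+ y RS.:* x) RS.:* x RS.:+ (B RS.:* y RS.:+ RS.con (+ 0) RS.:* x) RS.:+ RS.con (+ 0)) R.refl ξ η B)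
          (proj₂ f[α]≈0))
        ρ²≈

    real-inverse : x * y ≈ 1# → Real′ x → Real′ y
    real-inverse {x} {y} xy≈1 h = RS.modulo₂ ((im y)) ((re y)) (RS.solve 3 (λ p p′ q′ →
        q′ RS.:= RS.con (+ 0) RS.:+ q′ RS.:* (RS.con (+ 1) RS.:- (p RS.:* p′ RS.:+ RS.:- (RS.con (+ 0) RS.:* q′)))
           RS.:+ p′ RS.:* (p RS.:* q′ RS.:+ RS.con (+ 0) RS.:* p′)) R.refl (re x) ((re y)) ((im y))) (RS.x-y≈0 (R.sym (proj₁ parts))) (proj₂ parts)
      where
      parts = σ-unique (σ-* (real h) (σ-self y)) (σ-cong (sym xy≈1) σ.1-homo)

    real-+ : ∀ x y → Real′ x → Real′ y → Real′ (x + y)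
    real-+ x y h h′ = proj₂ (image-ℝ-+ (real h) (real h′))

    real-* : ∀ x y → Real′ x → Real′ y → Real′ (x * y)
    real-* x y h h′ = proj₂ (image-ℝ-* (real h) (real h′))

    real-neg : ∀ x → Real′ x → Real′ (- x)
    real-neg x h = proj₂ (image-ℝ-neg (real h))

    real-resp : ∀ x y → x ≈ y → Real′ x → Real′ y
    real-resp x y x≈y h = proj₂ (σ-cong x≈y (real h))

open import Algebra.Morphism.Structures using (IsRingHomomorphism)
open import Data.List using ([]; _∷_; map; length)
open import Data.List.Membership.Propositional using (_∈_)
open import Data.List.Relation.Unary.Any using (here; there)
open import Data.Nat.Primality using (Prime; prime⇒nonZero)
open import Data.Rational as ℚ using (ℚ; 0ℚ; 1ℚ)
import Data.Rational.Properties as ℚ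
open import Data.Integer.Coprimality using (Coprime)
import Data.Integer.Divisibility as ℤ
import Data.Nat.Divisibility as ℕ
open import Defs
open import Algebra.Definitions.RawSemiring ℚ[X] using (Irreducible)

-- The image of ℚ in a field
module RationalSubfield {a ℓ₁ ℓ₂} (L : HeytingField a ℓ₁ ℓ₂) (ι : ℚ → HeytingField.Carrier L)
                        (ι-isHom : IsRingHomomorphism ℚ.+-*-rawRing (fieldRawRing L) ι) where
  open RationalRoots
  open FieldTheory L
  private module ι = IsRingHomomorphism ι-isHom

  ι-int : ∀ n → ι (fromℤ n) ≈ int n
  ι-int (+ n)    = ι-ℕ n
    where
    ι-ℕ : ∀ n → ι (fromℤ (+ n)) ≈ int (+ n)
    ι-ℕ zero    = ι.0#-homo
    ι-ℕ (suc n) = trans (reflexive (≡.cong ι (fromℤ-+ (+ 1) (+ n)))) (trans (ι.+-homo 1ℚ (fromℤ (+ n)))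
      (trans (+-cong ι.1#-homo (ι-ℕ n)) (sym (int-+ (+ 1) (+ n)))))
  ι-int -[1+ n ] = trans (ι.-‿homo (fromℤ (+ suc n))) (-‿cong (ι-int (+ suc n)))

  ι-zero : ∀ q → ι q ≈ 0# → q ≡ 0ℚ
  ι-zero q ιq≈0 with q ℚ.≟ 0ℚ
  ... | yes q≡0 = q≡0
  ... | no q≢0  = ⊥-elim (1≉0 (trans (sym ι.1#-homo) (trans (sym (ι.⟦⟧-cong (ℚ.*-inverseʳ q {{ℚ.≢-nonZero q≢0}})))
      (trans (ι.*-homo q _) (trans (*-congʳ ιq≈0) (zeroˡ _))))))

  ι-injective : ∀ p q → ι p ≈ ι q → p ≡ q
  ι-injective p q eq = ℚ-Solver.x-y≈0⇒x≈y (ι-zero (p ℚ.- q) (trans (ι.+-homo p (ℚ.- q)) (trans (+-congˡ (ι.-‿homo q)) (x-y≈0 eq))))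

  -- Elements of the image of ℚ
  Rational : Pred Carrier ℓ₁
  Rational x = ∃ λ q → x ≈ ι q

  Rational-subfield : DiscreteSubfield Rational
  Rational-subfield = record
    { resp  = λ { x≈y (q , eq) → q , trans (sym x≈y) eq }
    ; int∈  = λ n → fromℤ n , sym (ι-int n)
    ; +∈    = λ { (p , eq) (q , eq′) → p ℚ.+ q , trans (+-cong eq eq′) (sym (ι.+-homo p q)) }
    ; *∈    = λ { (p , eq) (q , eq′) → p ℚ.* q , trans (*-cong eq eq′) (sym (ι.*-homo p q)) }
    ; -∈    = λ { (q , eq) → ℚ.- q , trans (-‿cong eq) (sym (ι.-‿homo q)) }
    ; zero? = λ { (q , eq) → decide q eq (q ℚ.≟ 0ℚ) }
    }
    where
    decide : ∀ {x} q → x ≈ ι q → Dec (q ≡ 0ℚ) → x ≈ 0# ⊎ ∃ λ y → Rational y × x * y ≈ 1#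
    decide q eq (yes q≡0) = inj₁ (trans eq (trans (ι.⟦⟧-cong q≡0) ι.0#-homo))
    decide q eq (no q≢0)  = inj₂ (ι q⁻¹ , (q⁻¹ , refl) , trans (*-congʳ eq) (trans (sym (ι.*-homo q q⁻¹))
        (trans (ι.⟦⟧-cong (ℚ.*-inverseʳ q {{ℚ.≢-nonZero q≢0}})) ι.1#-homo)))
      where q⁻¹ = ℚ.1/_ q {{ℚ.≢-nonZero q≢0}}

  int-zero : ∀ n → int n ≈ 0# → n ≡ + 0
  int-zero n eq = ≡.cong ℚ.↥_ (≡.trans (≡.sym (fromℤ≡ n)) (ι-zero (fromℤ n) (trans (ι-int n) eq)))

  nonsquare : ∀ {δ} → (∀ n → n ℤ.* n ≢ δ) → ∀ {u} → Rational u → ¬ u * u ≈ int δ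
  nonsquare {δ} h {u} (q , eq) u²≈δ =
    let n , n²≡δ = rational-square⇒integer-square δ q
         (ι-injective (q ℚ.* q) (fromℤ δ) (trans (ι.*-homo q q) (trans (*-cong (sym eq) (sym eq)) (trans u²≈δ (sym (ι-int δ))))))
    in h n n²≡δ

  no-rational-root : ∀ b c → Irreducible (X³+ b X+ c) → ∀ {r} → Rational r → ¬ r * r * r + int b * r + int c ≈ 0#
  no-rational-root b c irr {r} (q , eq) root = irreducible⇒no-root b c irr q (ι-zero (q ℚ.* q ℚ.* q ℚ.+ fromℤ b ℚ.* q ℚ.+ fromℤ c)
    (trans (ι.+-homo (q ℚ.* q ℚ.* q ℚ.+ fromℤ b ℚ.* q) (fromℤ c)) (trans (+-cong
       (trans (ι.+-homo (q ℚ.* q ℚ.* q) (fromℤ b ℚ.* q)) (+-cong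
          (trans (ι.*-homo (q ℚ.* q) q) (*-cong (trans (ι.*-homo q q) (*-cong (sym eq) (sym eq))) (sym eq)))
          (trans (ι.*-homo (fromℤ b) q) (*-cong (ι-int b) (sym eq)))))
       (ι-int c)) root)))

-- The three roots in a splitting field
module SplittingRoots {a ℓ₁ ℓ₂} (L : HeytingField a ℓ₁ ℓ₂) (b c : ℤ) (S : SplittingField (X³+ b X+ c) L) where
  open RationalRoots
  open FieldTheory L
  open CubicExtension L
  open SplittingField S
  open RationalSubfield L ι ι-isHom
  open PolynomialCoefficients ring
  open Polynomial (fieldRawRing L) using (coeff; ∏[X-_])
  private
    module ι = IsRingHomomorphism ι-isHom
    product-coeff : ∀ n → coeff (map ι (X³+ b X+ c)) n ≈ leading * coeff ∏[X- roots ] n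
    product-coeff n = trans (splits n) (coeff-const* leading ∏[X- roots ] n)

  three-roots : ∃₂ λ α β → ∃ λ γ → roots ≡ α ∷ β ∷ γ ∷ [] × Roots (int b) (int c) α β γ
  three-roots = by-length roots product-coeff
    where
    -- With fewer than three roots the coefficient 1 of x³ would vanish. With more of them
    -- the leading coefficient would, and with it all others.
    too-few : ∀ rs → (∀ n → coeff (map ι (X³+ b X+ c)) n ≈ leading * coeff ∏[X- rs ] n) → length rs ℕ.< 3 → ⊥
    too-few rs h short = 1≉0 (trans (sym ι.1#-homo) (trans (h 3) (trans (*-congˡ (∏-degree rs 3 short)) (zeroʳ leading))))
    by-length : ∀ rs → (∀ n → coeff (map ι (X³+ b X+ c)) n ≈ leading * coeff ∏[X- rs ] n) →
                ∃₂ λ α β → ∃ λ γ → rs ≡ α ∷ β ∷ γ ∷ [] × Roots (int b) (int c) α β γ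
    by-length [] h = ⊥-elim (too-few [] h (ℕ.s≤s ℕ.z≤n))
    by-length rs@(_ ∷ []) h = ⊥-elim (too-few rs h (ℕ.s≤s (ℕ.s≤s ℕ.z≤n)))
    by-length rs@(_ ∷ _ ∷ []) h = ⊥-elim (too-few rs h (ℕ.s≤s (ℕ.s≤s (ℕ.s≤s ℕ.z≤n))))
    by-length rs@(_ ∷ _ ∷ _ ∷ _ ∷ rs′) h = ⊥-elim (1≉0 (trans (sym ι.1#-homo) (trans (h 3)
      (trans (*-congʳ (trans (sym (*-identityʳ leading)) (trans (*-congˡ (sym (∏-monic rs))) (sym (h (length rs)))))) (zeroˡ _)))))
    by-length (α ∷ β ∷ γ ∷ []) h = α , β , γ , ≡.refl , record
      { sum     = trans (solve 1 (λ x → x := :- :- x) refl (α + β + γ)) (trans (-‿cong (trans (sym (proj₂ (proj₂ (vieta α β γ)))) (trans (monic 2) ι.0#-homo))) (solve 0 (:- con (+ 0) := con (+ 0)) refl))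
      ; pairs   = trans (sym (proj₁ (proj₂ (vieta α β γ)))) (trans (monic 1) (ι-int b))
      ; product = trans (solve 1 (λ x → x := :- :- x) refl (α * β * γ)) (-‿cong (trans (sym (proj₁ (vieta α β γ))) (trans (monic 0) (ι-int c))))
      }
      where
      leading≈1 : leading ≈ 1#
      leading≈1 = trans (sym (*-identityʳ leading)) (trans (*-congˡ (sym (∏-monic (α ∷ β ∷ γ ∷ [])))) (trans (sym (h 3)) ι.1#-homo))
      monic : ∀ n → coeff ∏[X- α ∷ β ∷ γ ∷ [] ] n ≈ coeff (map ι (X³+ b X+ c)) n
      monic n = trans (sym (*-identityˡ _)) (trans (*-congʳ (sym leading≈1)) (sym (h n)))

-- The splitting field over its quadratic subfield

module CubicSplittingField {a ℓ₁ ℓ₂} (p : ℕ) (b c : ℤ) (p-prime : Prime p) (p≢3 : p ≢ 3) (b≡±p : b ≡ + p ⊎ b ≡ ℤ.- + p)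
  (irreducible : Irreducible (X³+ b X+ c)) (c-condition : Coprime c (+ p) ⊎ (+ p) ℤ.^ 2 ℤ.∣ c)
  (L : HeytingField a ℓ₁ ℓ₂) (S : SplittingField (X³+ b X+ c) L) where
  open import Data.Fin using (zero; suc)
  open import Data.Vec.Functional using (Vector)
  open import Function using (mk⇔)
  open IntegerForms using (bézout)
  open SquareDiscriminant using (3-coprime; discriminant-nonsquare)
  open RationalRoots using (irreducible⇒no-integer-root)
  open RealNumbers using (ℝ-ring; squares-vanish)
  open FieldTheory L
  open CubicExtension L
  open SplittingField S using (ι; ι-isHom; roots; generate)
  open RationalSubfield L ι ι-isHom
  open Extension L ι

  δ : ℤ
  δ = ℤ.- (+ 4) ℤ.* b ℤ.^ 3 ℤ.- + 27 ℤ.* c ℤ.^ 2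

  -- The image of δ in L
  D : Carrier
  D = - int (+ 4) * (int b * int b * int b) - int (+ 27) * (int c * int c)

  int-δ : int δ ≈ D
  int-δ = trans (int-+ (ℤ.- (+ 4) ℤ.* b ℤ.^ 3) (ℤ.- (+ 27 ℤ.* c ℤ.^ 2))) (+-cong
    (trans (int-* (ℤ.- (+ 4)) (b ℤ.^ 3)) (*-congˡ (trans (int-* b (b ℤ.^ 2)) (trans (*-congˡ (trans (int-* b (b ℤ.^ 1)) (*-congˡ (trans (int-* b (+ 1)) (*-identityʳ (int b))))))
      (sym (*-assoc (int b) (int b) (int b)))))))
    (trans (int-neg (+ 27 ℤ.* c ℤ.^ 2)) (-‿cong (trans (int-* (+ 27) (c ℤ.^ 2)) (*-congˡ (trans (int-* c (c ℤ.^ 1)) (*-congˡ (trans (int-* c (+ 1)) (*-identityʳ (int c))))))))))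

  δ-nonsquare : ∀ {u} → Rational u → ¬ u * u ≈ D
  δ-nonsquare u∈ eq = nonsquare {δ = δ} (discriminant-nonsquare b c p-prime p≢3 b≡±p (irreducible⇒no-integer-root b c irreducible) c-condition)
    u∈ (trans eq (sym int-δ))

  module ℚ-field = DiscreteSubfield Rational-subfield

  D∈ℚ : Rational D
  D∈ℚ = ℚ-field.resp int-δ (ℚ-field.int∈ δ)

  module WithRoots {α β γ : Carrier} (roots≡ : roots ≡ α ∷ β ∷ γ ∷ []) (vieta-roots : Roots (int b) (int c) α β γ) where
    √δ : Carrier
    √δ = √disc vieta-roots

    open Quadratic Rational-subfield {d = D} {s = √δ} D∈ℚ (√disc-square vieta-roots) δ-nonsquare

    -- The field generated by √δ, which is the set F[s] of all u + v√δ with rational u, v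
    K : Pred Carrier (a ⊔ ℓ₁)
    K = ℚ⟨ √δ ∷ [] ⟩

    module ℚ[√δ] = DiscreteSubfield F[s]-subfield

    K⊆ℚ[√δ] : ∀ {x} → K x → F[s] x
    K⊆ℚ[√δ] (rational q) = ι q , 0# , (q , refl) , ℚ-field.int∈ (+ 0) , solve 2 (λ x s → x := x :+ con (+ 0) :* s) refl (ι q) √δ
    K⊆ℚ[√δ] (generator (here ≡.refl)) = 0# , 1# , ℚ-field.int∈ (+ 0) , ℚ-field.int∈ (+ 1) , solve 1 (λ s → s := con (+ 0) :+ con (+ 1) :* s) refl √δ
    K⊆ℚ[√δ] (plus x∈ y∈) = ℚ[√δ].+∈ (K⊆ℚ[√δ] x∈) (K⊆ℚ[√δ] y∈)
    K⊆ℚ[√δ] (times x∈ y∈) = ℚ[√δ].*∈ (K⊆ℚ[√δ] x∈) (K⊆ℚ[√δ] y∈)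
    K⊆ℚ[√δ] (minus x∈) = ℚ[√δ].-∈ (K⊆ℚ[√δ] x∈)
    K⊆ℚ[√δ] (inverse xy≈1 x∈) = from xy≈1 (ℚ[√δ].zero? (K⊆ℚ[√δ] x∈))
      where
      from : ∀ {x y} → x * y ≈ 1# → x ≈ 0# ⊎ (∃ λ z → F[s] z × x * z ≈ 1#) → F[s] y
      from xy≈1 (inj₁ x≈0) = ⊥-elim (#0⇒≉0 (inverse⇒#0 xy≈1) x≈0)
      from {x} {y} xy≈1 (inj₂ (z , z∈ , xz≈1)) = ℚ[√δ].resp (modulo₂ y (- z) (solve 3 (λ x y z →
        z := y :+ y :* (x :* z :- con (+ 1)) :+ :- z :* (x :* y :- con (+ 1))) refl x y z) (x-y≈0 xz≈1) (x-y≈0 xy≈1)) z∈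
    K⊆ℚ[√δ] (respects x≈y x∈) = ℚ[√δ].resp x≈y (K⊆ℚ[√δ] x∈)

    ℚ⊆K : ∀ {x} → Rational x → K x
    ℚ⊆K (q , eq) = respects (sym eq) (rational q)

    √δ∈K : K √δ
    √δ∈K = generator (here ≡.refl)

    ℚ[√δ]⊆K : ∀ {x} → F[s] x → K x
    ℚ[√δ]⊆K (u , v , u∈ , v∈ , eq) = respects (sym eq) (plus (ℚ⊆K u∈) (times (ℚ⊆K v∈) √δ∈K))

    K-subfield : DiscreteSubfield K
    K-subfield = record
      { resp  = respects
      ; int∈  = λ n → ℚ⊆K (ℚ-field.int∈ n)
      ; +∈    = plus
      ; *∈    = times
      ; -∈    = minus
      ; zero? = λ x∈ → [ inj₁ , (λ (y , y∈ , xy≈1) → inj₂ (y , ℚ[√δ]⊆K y∈ , xy≈1)) ]′ (ℚ[√δ].zero? (K⊆ℚ[√δ] x∈))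
      }

    open DiscreteSubfield K-subfield

    degree-2 : HasDegree 2 K
    degree-2 = basis , basis∈ , spans , independent′
      where
      basis : Vector Carrier 2
      basis zero       = 1#
      basis (suc zero) = √δ
      basis∈ : ∀ i → K (basis i)
      basis∈ zero       = int∈ (+ 1)
      basis∈ (suc zero) = √δ∈K
      combination≈ : ∀ q → ι (q zero) + ι (q (suc zero)) * √δ ≈ ι (q zero) * 1# + (ι (q (suc zero)) * √δ + 0#)
      combination≈ q = solve 3 (λ u v s → u :+ v :* s := u :* con (+ 1) :+ (v :* s :+ con (+ 0))) refl (ι (q zero)) (ι (q (suc zero))) √δ
      spans : ∀ x → K x → ∃ λ q → x ≈ ι (q zero) * 1# + (ι (q (suc zero)) * √δ + 0#)
      spans x x∈ = from (K⊆ℚ[√δ] x∈)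
        where
        from : F[s] x → ∃ λ (q : Vector ℚ 2) → x ≈ ι (q zero) * 1# + (ι (q (suc zero)) * √δ + 0#)
        from (u , v , (p , u≈) , (q , v≈) , x≈) = coefficients , trans x≈ (trans (+-cong u≈ (*-congʳ v≈)) (combination≈ coefficients))
          where
          coefficients : Vector ℚ 2
          coefficients zero       = p
          coefficients (suc zero) = q
      independent′ : ∀ (q : Vector ℚ 2) → ι (q zero) * 1# + (ι (q (suc zero)) * √δ + 0#) ≈ 0# → ∀ i → q i ≡ 0ℚ
      independent′ q eq i = from i (independent (q zero , refl) (q (suc zero) , refl) (trans (combination≈ q) eq))
        where
        from : ∀ i → ι (q zero) ≈ 0# × ι (q (suc zero)) ≈ 0# → q i ≡ 0ℚ
        from zero       (h , _) = ι-zero (q zero) h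
        from (suc zero) (_ , h) = ι-zero (q (suc zero)) h

    no-root-K : ∀ {r} → K r → ¬ r * r * r + int b * r + int c ≈ 0#
    no-root-K r∈ = no-root (ℚ-field.int∈ b) (ℚ-field.int∈ c) (no-rational-root b c irreducible) (K⊆ℚ[√δ] r∈)

    open Quads K-subfield (int∈ b) (int∈ c)
    open NoRoot no-root-K

    half : ∃ λ h → K h × int (+ 2) * h ≈ 1#
    half = [ (λ h → ⊥-elim (2≢0 (int-zero (+ 2) h))) , (λ h → h) ]′ (zero? (int∈ (+ 2)))
      where
      2≢0 : + 2 ≢ + 0
      2≢0 ()

    D≉0 : ¬ D ≈ 0#
    D≉0 D≈0 = δ-nonsquare (ℚ-field.int∈ (+ 0)) (trans (zeroˡ 0#) (sym D≈0))

    D⁻¹ : ∃ λ d → K d × D * d ≈ 1#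
    D⁻¹ = [ ⊥-elim ∘ D≉0 , (λ h → h) ]′ (zero? (ℚ⊆K D∈ℚ))

    b# : int b # 0#
    b# = [ (λ b≈0 → ⊥-elim (b≢0 (int-zero b b≈0))) , (λ (_ , _ , h) → inverse⇒#0 h) ]′ (zero? (int∈ b))
      where
      p≢0 : p ≢ 0
      p≢0 = ℕ.≢-nonZero⁻¹ p {{prime⇒nonZero p-prime}}
      b≢0 : b ≢ + 0
      b≢0 b≡0 = [ (λ b≡p → p≢0 (ℤ.+-injective (≡.trans (≡.sym b≡p) b≡0)))
                , (λ b≡-p → p≢0 (ℤ.+-injective (ℤ.neg-injective (≡.trans (≡.sym b≡-p) b≡0)))) ]′ b≡±p

    -- Every element of L is a quadratic polynomial over K in each of the roots.
    every : ∀ {α β γ} (rts : Roots (int b) (int c) α β γ) → K (√disc rts) → (∀ {g} → g ∈ roots → g ∈ α ∷ β ∷ γ ∷ []) →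
            ∀ x → ∃ λ P → x ≈ ev P α
    every {α} {β} {γ} rts √∈ members x = generated ι (λ q → rational q) (λ g∈ → member (members g∈)) (generate x)
      where
      open Adjoin rts
      module G = Adjoin.Generated rts (proj₁ (proj₂ half)) (proj₂ (proj₂ half)) (proj₁ (proj₂ D⁻¹)) (proj₂ (proj₂ D⁻¹)) √∈
      open G using (generated)
      member : ∀ {g} → g ∈ α ∷ β ∷ γ ∷ [] → K[α] g
      member (here ≡.refl) = α∈K[α]
      member (there (here ≡.refl)) = G.β∈K[α]
      member (there (there (here ≡.refl))) = G.γ∈K[α]

    -- A cyclic permutation of the roots preserves √δ.
    rotated-√δ∈K : K (√disc (rotate vieta-roots))
    rotated-√δ∈K = resp (solve 3 (λ α β γ → (α :- β) :* (β :- γ) :* (γ :- α) := (β :- γ) :* (γ :- α) :* (α :- β)) refl α β γ) √δ∈K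

    rotated-√δ∈K′ : K (√disc (rotate (rotate vieta-roots)))
    rotated-√δ∈K′ = resp (solve 3 (λ α β γ → (α :- β) :* (β :- γ) :* (γ :- α) := (γ :- α) :* (α :- β) :* (β :- γ)) refl α β γ) √δ∈K

    members : ∀ {g} → g ∈ roots → g ∈ α ∷ β ∷ γ ∷ []
    members = ≡.subst (_ ∈_) roots≡

    rotate-∈ : ∀ {α β γ g : Carrier} → g ∈ α ∷ β ∷ γ ∷ [] → g ∈ β ∷ γ ∷ α ∷ []
    rotate-∈ (here eq)                 = there (there (here eq))
    rotate-∈ (there (here eq))         = here eq
    rotate-∈ (there (there (here eq))) = there (here eq)

    everyα = every vieta-roots √δ∈K members
    everyβ = every (rotate vieta-roots) rotated-√δ∈K (rotate-∈ ∘ members)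
    everyγ = every (rotate (rotate vieta-roots)) rotated-√δ∈K′ (rotate-∈ ∘ rotate-∈ ∘ members)

    discrete : ∀ x → x ≈ 0# ⊎ x # 0#
    discrete x = Adjoin.K[α]-zero? vieta-roots (everyα x)

    module AtPlace (w : DiscreteValuation L) where
      open ValuationTheory L discrete w
      open DiscreteValuation w
      open FinitePlaces.Place L K-subfield (int∈ b) (int∈ c) no-root-K discrete w using (unit≱1; some-factor; unramified)

      -- If b and δ have positive order then so do p and 27c². As p ≠ 3, c is then not prime to
      -- p, so p² divides c, and p has the order of b.
      c-ord : ∀ b# → Ord≥ (+ 1) (int b) → Ord≥ (+ 1) D → Ord≥ (v (int b) b# ℤ.+ v (int b) b#) (int c)
      c-ord b# b≥1 D≥1 = [ ⊥-elim ∘ not-coprime , (λ { (ℕ.divides k eq) → divisible k eq }) ]′ c-condition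
        where
        p≥ : ∀ {m} → Ord≥ m (int b) → Ord≥ m (int (+ p))
        p≥ h = [ (λ b≡p → ≡.subst (λ n → Ord≥ _ (int n)) b≡p h)
               , (λ b≡-p → ord-cong (solve 1 (λ x → :- :- x := x) refl (int (+ p))) (ord-neg (ord-cong (int-neg (+ p)) (≡.subst (λ n → Ord≥ _ (int n)) b≡-p h)))) ]′ b≡±p

        prime-to-p : ∀ {n} → Coprime n (+ p) → ¬ Ord≥ (+ 1) (int n)
        prime-to-p {n} coprime n≥1 = from (bézout n (+ p) coprime)
          where
          from : (∃₂ λ u w → u ℤ.* n ℤ.+ w ℤ.* + p ≡ + 1) → ⊥
          from (u , w , eq) = unit≱1 {x = 1#} {y = 1#} (*-identityˡ 1#)
            (ord-cong (trans (sym (trans (int-+ (u ℤ.* n) (w ℤ.* + p)) (+-cong (int-* u n) (int-* w (+ p))))) (reflexive (≡.cong int eq)))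
              (ord-+ (ord-₀* (ord-int u) n≥1) (ord-₀* (ord-int w) (p≥ b≥1)))) ord-1

        27c² : Ord≥ (+ 1) (int (+ 27) * (int c * int c))
        27c² = ord-cong (solve 2 (λ b c → :- (:- con (+ 4) :* (b :* b :* b) :- con (+ 27) :* (c :* c)) :+ :- (b :* (con (+ 4) :* (b :* b))) := con (+ 27) :* (c :* c)) refl (int b) (int c))
          (ord-+ (ord-neg D≥1) (ord-neg (ord-*₀ b≥1 (ord-*₀ (ord-int (+ 4)) (ord-*₀ (ord-int b) (ord-int b))))))

        27≱1 : ¬ Ord≥ (+ 1) (int (+ 27))
        27≱1 h = [ 3≱1 , [ 3≱1 , 3≱1 ]′ ]′ (some-factor (ord-cong (solve 0 (con (+ 27) := con (+ 3) :* (con (+ 3) :* con (+ 3))) refl) h))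
          where
          3≱1 : ¬ Ord≥ (+ 1) (int (+ 3))
          3≱1 = prime-to-p {+ 3} (3-coprime p-prime p≢3)

        not-coprime : ¬ Coprime c (+ p)
        not-coprime coprime = [ 27≱1 , [ prime-to-p {c} coprime , prime-to-p {c} coprime ]′ ]′ (some-factor 27c²)

        divisible : ∀ k → ℤ.∣ c ∣ ≡ k ℕ.* ℤ.∣ (+ p) ℤ.^ 2 ∣ → Ord≥ (v (int b) b# ℤ.+ v (int b) b#) (int c)
        divisible k eq = from-abs c (ord-cong (sym ∣c∣≈) (ord-₀* (ord-int (+ k)) (ord-* p≥v p≥v)))
          where
          p≥v : Ord≥ (v (int b) b#) (int (+ p))
          p≥v = p≥ (ord-v b# ≡.refl)
          ∣c∣≡ : + ℤ.∣ c ∣ ≡ + k ℤ.* (+ p ℤ.* + p)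
          ∣c∣≡ = ≡.trans (≡.cong +_ (≡.trans eq (≡.cong (k ℕ.*_) (≡.trans (ℤ.abs-* (+ p) ((+ p) ℤ.^ 1)) (≡.cong (p ℕ.*_) (≡.trans (ℤ.abs-* (+ p) (+ 1)) (ℕ.*-identityʳ p)))))))
             (≡.trans (ℤ.pos-* k (p ℕ.* p)) (≡.cong (λ m → + k ℤ.* m) (ℤ.pos-* p p)))
          ∣c∣≈ : int (+ ℤ.∣ c ∣) ≈ int (+ k) * (int (+ p) * int (+ p))
          ∣c∣≈ = trans (reflexive (≡.cong int ∣c∣≡)) (trans (int-* (+ k) (+ p ℤ.* + p)) (*-congˡ (int-* (+ p) (+ p))))
          from-abs : ∀ {m} c → Ord≥ m (int (+ ℤ.∣ c ∣)) → Ord≥ m (int c)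
          from-abs (+ n)    h = h
          from-abs -[1+ n ] h = ord-neg h

      ramification-index-1 : HasRamificationIndex w K 1
      ramification-index-1 n = mk⇔ (λ _ → ℕ.1∣ ℤ.∣ n ∣)
        (λ _ → unramified (ord-int b) (ord-int c) vieta-roots everyα everyβ everyγ (≉0⇒#0 D≉0) b# c-ord n)

    module AtInfinity (σ : Carrier → ℂ) (σ-isHom : IsRingHomomorphism (fieldRawRing L) ℂ-rawRing σ)
                      (K-real : ∀ x → K x → Real (σ x)) where
      private module σ = IsRingHomomorphism σ-isHom
      open InfinitePlaces L ℝ-ring squares-vanish

      embedding : ComplexEmbedding
      embedding = record
        { re = re ∘ σ ; im = im ∘ σ ; cong = σ.⟦⟧-cong ; +-homo = σ.+-homo ; *-homo = σ.*-homo ; -‿homo = σ.-‿homo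
        ; 0-homo = σ.0#-homo ; 1-homo = σ.1#-homo }

      rational-real : ∀ x → Rational x → Real (σ x)
      rational-real x x∈ = K-real x (ℚ⊆K x∈)

      roots-real : ∀ {g} → g ∈ α ∷ β ∷ γ ∷ [] → Real (σ g)
      roots-real (here ≡.refl) = real-root embedding vieta-roots (rational-real _ (ℚ-field.int∈ b)) (rational-real _ (ℚ-field.int∈ c)) (K-real _ √δ∈K)
      roots-real (there (here ≡.refl)) = real-root embedding (rotate vieta-roots) (rational-real _ (ℚ-field.int∈ b)) (rational-real _ (ℚ-field.int∈ c)) (K-real _ rotated-√δ∈K)
      roots-real (there (there (here ≡.refl))) = real-root embedding (rotate (rotate vieta-roots)) (rational-real _ (ℚ-field.int∈ b)) (rational-real _ (ℚ-field.int∈ c)) (K-real _ rotated-√δ∈K′)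

      all-real : ∀ {x} → ℚ⟨ roots ⟩ x → Real (σ x)
      all-real (rational q)   = rational-real (ι q) (q , refl)
      all-real (generator g∈) = roots-real (members g∈)
      all-real (plus {x} {y} x∈ y∈)  = real-+ embedding x y (all-real x∈) (all-real y∈)
      all-real (times {x} {y} x∈ y∈) = real-* embedding x y (all-real x∈) (all-real y∈)
      all-real (minus {x} x∈)        = real-neg embedding x (all-real x∈)
      all-real (inverse {x} {y} xy≈1 x∈) = real-inverse embedding {x} {y} xy≈1 (all-real x∈)
      all-real (respects {x} {y} x≈y x∈) = real-resp embedding x y x≈y (all-real x∈)

    unramified-over-ℚ[√δ] : ∃ λ √δ → √δ * √δ ≈ ι (fromℤ δ) × HasDegree 2 ℚ⟨ √δ ∷ [] ⟩ × Unramified ℚ⟨ √δ ∷ [] ⟩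
    unramified-over-ℚ[√δ] = √δ , trans (√disc-square vieta-roots) (trans (sym int-δ) (sym (ι-int δ))) , degree-2 , record
      { finite   = λ w → AtPlace.ramification-index-1 w
      ; infinite = λ σ σ-isHom K-real x → AtInfinity.all-real σ σ-isHom K-real (generate x)
      }

open import Data.Integer using (ℤ; +_; -_; _-_; _*_; _^_)
open import Data.Integer.Divisibility using (_∣_)

corollary83 : ∀ {ℓ ℓ₁ ℓ₂} (p : ℕ) (b c : ℤ) →
  Prime p → p ≢ 3 → b ≡ + p ⊎ b ≡ - (+ p) →
  Irreducible (X³+ b X+ c) →
  Coprime c (+ p) ⊎ (+ p) ^ 2 ∣ c →
  (L : HeytingField ℓ ℓ₁ ℓ₂) (S : SplittingField (X³+ b X+ c) L) →
  let open HeytingField L using (_≈_) renaming (_*_ to _*ᴸ_)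
      open SplittingField S using (ι)
      open Extension L ι
      δ = - (+ 4) * b ^ 3 - + 27 * c ^ 2
  in ∃ λ √δ → √δ *ᴸ √δ ≈ ι (fromℤ δ) ×
              HasDegree 2 ℚ⟨ √δ ∷ [] ⟩ ×
              Unramified ℚ⟨ √δ ∷ [] ⟩
corollary83 p b c p-prime p≢3 b≡±p irreducible c-condition L S =
  let α , β , γ , roots≡ , vieta-roots = SplittingRoots.three-roots L b c S
  in CubicSplittingField.WithRoots.unramified-over-ℚ[√δ] p b c p-prime p≢3 b≡±p irreducible c-condition L S roots≡ vieta-roots
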